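{- Let $f\in\mathbb{Z}[x_1,\dots,x_d]$ have degree $m$. If $f$ is not of the form $c\cdot g(x_1,\dots,x_d)^2$ with $c\in\mathbb{Q}$ and $g\in\mathbb{Q}[x_1,\dots,x_d]$, then there is $B\in\mathbb{Z}$ with $1\le|B|\le H(f)^{O_{d,m}(1)}$ such that for all primes $\ell\nmid B$, \[ \sum_{x_1,\dots,x_d\in\mathbb{Z}/\ell\mathbb{Z}}\left(\frac{f(x_1,\dots,x_d)}{\ell}\right)\ll_{d,m}\ell^{d-1/2}. \]
   Context: $H(f)$ is the height of $f$, i.e. the maximum absolute value of its coefficients; $\left(\frac{\cdot}{\ell}\right)$ is the Legendre (Kronecker) symbol. -}

module Defs where

open import Data.Nat as ℕ using (ℕ; zero; suc; _⊔_; _≤_)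
import Data.Nat.Properties as ℕP
open import Data.Integer as ℤ using (ℤ; +_; ∣_∣)
import Data.Integer.Properties as ℤP
open import Data.Integer.DivMod using (_%ℕ_)
open import Data.Rational as ℚ using (ℚ)
import Data.Rational.Properties as ℚP
open import Data.List using (List; []; _∷_; map; foldr; concatMap; upTo)
open import Data.List.Relation.Unary.Any using (any?)
open import Data.Vec as Vec using (Vec; []; _∷_)
import Data.Vec.Properties as VecP
open import Data.Product using (_×_; _,_; ∃; ∃-syntax; Σ)
open import Relation.Nullary using (¬_; yes; no; Dec)
open import Relation.Binary.PropositionalEquality using (_≡_; _≢_)

Mono : ℕ → Set
Mono d = Vec ℕ d

totalDeg : ∀ {d} → Mono d → ℕ
totalDeg = Vec.foldr _ ℕ._+_ 0

-- A polynomial in d variables with coefficients in A, given as a finite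
-- list of terms (coefficient, exponent vector).  Repeated exponents are
-- allowed; the actual coefficient of a monomial is the sum over terms.
PolyZ : ℕ → Set
PolyZ d = List (ℤ × Mono d)

PolyQ : ℕ → Set
PolyQ d = List (ℚ × Mono d)

_≟m_ : ∀ {d} (e e′ : Mono d) → Dec (e ≡ e′)
_≟m_ = VecP.≡-dec ℕP._≟_

coeffZ : ∀ {d} → PolyZ d → Mono d → ℤ
coeffZ [] e = + 0
coeffZ ((c , e′) ∷ p) e with e′ ≟m e
... | yes _ = c ℤ.+ coeffZ p e
... | no  _ = coeffZ p e

coeffQ : ∀ {d} → PolyQ d → Mono d → ℚ
coeffQ [] e = ℚ.0ℚ
coeffQ ((c , e′) ∷ p) e with e′ ≟m e
... | yes _ = c ℚ.+ coeffQ p e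
... | no  _ = coeffQ p e

addMono : ∀ {d} → Mono d → Mono d → Mono d
addMono = Vec.zipWith ℕ._+_

mulQ : ∀ {d} → PolyQ d → PolyQ d → PolyQ d
mulQ p q = concatMap (λ { (a , e) → map (λ { (b , e′) → (a ℚ.* b , addMono e e′) }) q }) p

toQ : ∀ {d} → PolyZ d → PolyQ d
toQ = map (λ { (c , e) → (c ℚ./ 1 , e) })

HasDegree : ∀ {d} → PolyZ d → ℕ → Set
HasDegree {d} f m =
  (∃[ e ] (coeffZ f e ≢ + 0 × totalDeg e ≡ m)) ×
  (∀ (e : Mono d) → coeffZ f e ≢ + 0 → totalDeg e ≤ m)

IsConstTimesSquare : ∀ {d} → PolyZ d → Set
IsConstTimesSquare {d} f =
  ∃[ c ] ∃[ g ] (∀ (e : Mono d) → coeffQ (toQ f) e ≡ c ℚ.* coeffQ (mulQ g g) e)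

-- height H(f): maximum absolute value of the coefficients
-- (every monomial with nonzero coefficient occurs among the listed exponents)
height : ∀ {d} → PolyZ d → ℕ
height f = foldr (λ { (_ , e) h → ∣ coeffZ f e ∣ ⊔ h }) 0 f

evalZ : ∀ {d} → PolyZ d → Vec ℤ d → ℤ
evalZ f x = foldr (λ { (c , e) s → c ℤ.* Vec.foldr _ ℤ._*_ (+ 1) (Vec.zipWith ℤ._^_ x e) ℤ.+ s }) (+ 0) f

points : (ℓ d : ℕ) → List (Vec ℤ d)
points ℓ zero    = [] ∷ []
points ℓ (suc d) = concatMap (λ v → map (λ i → (+ i) ∷ v) (upTo ℓ)) (points ℓ d)

legendre : ℕ → ℤ → ℤ
legendre zero    a = + 0
legendre (suc k) a with a %ℕ suc k
... | zero = + 0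
... | suc r with any? (λ y → (y ℕ.* y) ℕ.% suc k ℕP.≟ suc r) (upTo (suc k))
...   | yes _ = + 1
...   | no  _ = ℤ.-[1+ 0 ]

charSum : ∀ {d} → ℕ → PolyZ d → ℤ
charSum {d} ℓ f = foldr (λ x s → legendre ℓ (evalZ f x) ℤ.+ s) (+ 0) (points ℓ d)

{-# OPTIONS --safe #-}

-- One variable (Stepanov).  Let q = ℓ = 2e + 1, let u ∈ F_q[X] have bounded degree and not be a constant times a
-- square, and let a = ±1.  Linear algebra gives r_j, s_j of degree < q/2, not all zero, such that
-- R = u^M Σ_{j<J} (r_j + s_j u^e) X^{jq} vanishes to order M ≈ √q at every x with u(x)^e = a; here J ≈ M/2.
-- R is not zero: modulo X^q an equation R = 0 reads r² u = u(0) s², so u would be u(0) times a square.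
-- Comparing deg R with the number of roots, u(x)^e = a has at most q/2 + O(√q) solutions for both signs.
--
-- The square root of u(4 u(0) t) / u(0) is a power series whose coefficients are integer polynomials in those of u,
-- and u is u(0) times a square if and only if the coefficients between deg u / 2 and deg u vanish.
--
-- Several variables.  Fix an integer point a with f(a) ≠ 0.  If these coefficients for u(t) = f(a + t v) vanish for
-- all v in a large grid, they vanish identically in v, and f is f(a) times a square over ℚ.  Otherwise one of them is
-- nonzero at some integer v₀, and B is its product with f(a).  For ℓ ∤ B the same coefficient vanishes for
-- O(ℓ^{d-1}) of the v modulo ℓ, and the theorem follows from (ℓ - 1) S = Σ_v Σ_{t≠0} χ(f(a + t v)).
module Submission where

open import Defs
open import Algebra.Bundles using (CommutativeRing; RawRing)
import Algebra.Morphism.RingMonomorphism as RingMonomorphism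
open import Algebra.Morphism.Structures using (IsRingMonomorphism)
import Algebra.Solver.Ring
import Algebra.Solver.Ring.AlmostCommutativeRing as ACR
open import Algebra.Structures using (IsCommutativeRing)
open import Data.Bool as Bool using (Bool; false; true)
open import Data.Fin as Fin using (Fin)
open import Data.Integer as ℤ using (+_; -[1+_]; ℤ; ∣_∣)
open import Data.Integer.DivMod using (_%ℕ_; _/ℕ_; a≡a%ℕn+[a/ℕn]*n; n%ℕd<d)
import Data.Integer.Divisibility.Signed as ℤD
import Data.Integer.Properties as ℤP
open import Data.List using (List; []; _++_; _∷_; applyUpTo; cartesianProduct; cartesianProductWith; concatMap; filter; foldr; length; map; upTo)
open import Data.List.Membership.Propositional using (_∈_; _∉_; lose)
open import Data.List.Membership.Propositional.Properties using (∈-cartesianProductWith⁺; ∈-cartesianProductWith⁻; ∈-cartesianProduct⁺; ∈-cartesianProduct⁻; ∈-upTo⁺; ∈-upTo⁻)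
import Data.List.Properties as ListP
open import Data.List.Relation.Unary.All as All using (All; []; _∷_)
open import Data.List.Relation.Unary.All.Properties as AllP using (All¬⇒¬Any; ¬Any⇒All¬)
open import Data.List.Relation.Unary.AllPairs using (AllPairs; []; _∷_)
import Data.List.Relation.Unary.AllPairs.Properties as AllPairsP
open import Data.List.Relation.Unary.Any as Any using (any?; here; there)
open import Data.List.Relation.Unary.Unique.Propositional using (Unique)
open import Data.List.Relation.Unary.Unique.Propositional.Properties using (Unique[x∷xs]⇒x∉xs; cartesianProductWith⁺; cartesianProduct⁺; upTo⁺)
open import Data.Maybe using (Maybe)
open import Data.Nat as ℕ using (ℕ; zero; suc; _≤_; _<_; z≤n; s≤s)
import Data.Nat.Divisibility as ℕD
open import Data.Nat.Primality using (Prime; euclidsLemma; prime⇒irreducible; prime⇒nonTrivial)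
import Data.Nat.Properties as ℕP
open import Data.Nat.Tactic.RingSolver using (solve-∀)
open import Data.Product using (_,_; _×_; proj₁; proj₂; ∃-syntax)
open import Data.Product.Properties using (≡-dec)
open import Data.Rational as ℚ using (ℚ)
import Data.Rational.Properties as ℚP
open import Data.Rational.Unnormalised using (*≡*; mkℚᵘ)
import Data.Rational.Unnormalised.Properties as ℚᵘP
open import Data.Sum as Sum using (_⊎_; inj₁; inj₂)
open import Data.Vec as Vec using (Vec; []; _∷_)
import Data.Vec.Properties as VecP
open import Data.Vec.Relation.Binary.Pointwise.Inductive as PW using (Pointwise; []; _∷_)
import Data.Vec.Relation.Unary.All as VAll
import Data.Vec.Relation.Unary.All.Properties as VAllP
open import Function using (_∘_)
open import Level using (0ℓ)
open import Relation.Binary.Consequences using (dec⇒weaklyDec)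
open import Relation.Binary.Definitions using (tri<; tri>; tri≈)
open import Relation.Binary.PropositionalEquality as ≡ using (_≡_; _≢_)
open import Relation.Nullary using (Dec; contradiction; no; yes; ¬_)
open import Relation.Nullary.Decidable using (_×-dec_; decidable-stable; ¬?)

-- That f is not a constant times a square must be witnessed by one integer which has polynomial
-- height, survives reduction modulo ℓ and still controls almost every line. Coefficients of a
-- square root do all of this because they are universal: (1 + 4y)^(1/2) = 1 + 2y - 2y² + ... has
-- integer coefficients, so the substitution 4 u(0) t leaves no denominators, and the resulting
-- expressions commute with ring homomorphisms. The same expression is evaluated over ℤ for the
-- height, over ℤ/ℓ for the character sum, over R[s] to see how it varies with the direction, over ℚ
-- and over polynomials in the point x to reconstruct g. Hence most of the development is for an
-- arbitrary commutative ring. Expanding at a point with f(a) ≠ 0 keeps u(0) nonzero, over ℚ and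
-- modulo every ℓ that does not divide B. The points a and v₀ are found by search in boxes whose
-- size depends only on d and m; this bounds B effectively and turns a negative hypothesis into
-- data. In place of √ℓ an integer N with 4N² ≤ ℓ < 4(N + 1)² is used.

module _ (R : CommutativeRing 0ℓ 0ℓ) where
  open CommutativeRing R

  Discrete NoZeroDivisors Nontrivial HasInverses : Set
  Discrete = ∀ x y → Dec (x ≈ y)
  NoZeroDivisors = ∀ x y → x * y ≈ 0# → x ≈ 0# ⊎ y ≈ 0#
  Nontrivial = ¬ 1# ≈ 0#
  HasInverses = ∀ x → ¬ x ≈ 0# → ∃[ y ] x * y ≈ 1#

-- Integers in a commutative ring, and a ring solver with integer constants

module Kit (R : CommutativeRing 0ℓ 0ℓ) where
  open CommutativeRing R public
  open import Algebra.Properties.Semiring.Mult semiring public using (×-homo-+; ×1-homo-*) renaming (_×_ to _×′_)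
  open import Algebra.Properties.Ring ring public using (-‿distribˡ-*; -‿distribʳ-*; -0#≈0#; -‿involutive; -‿+-comm; x∙y⁻¹≈ε⇒x≈y)
  open import Algebra.Properties.Semiring.Exp semiring public using (_^_; ^-congˡ; ^-homo-*)
  open import Relation.Binary.Reasoning.Setoid setoid public

  ι : ℤ → Carrier
  ι (+ n) = n ×′ 1#
  ι -[1+ n ] = - (suc n ×′ 1#)

  ι-⊖ : ∀ m n → ι (m ℤ.⊖ n) ≈ m ×′ 1# - n ×′ 1#
  ι-⊖ m zero = sym (trans (+-congˡ -0#≈0#) (+-identityʳ _))
  ι-⊖ zero (suc n) = sym (+-identityˡ _)
  ι-⊖ (suc m) (suc n) = begin
    ι (suc m ℤ.⊖ suc n)                 ≈⟨ reflexive (≡.cong ι (ℤP.[1+m]⊖[1+n]≡m⊖n m n)) ⟩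
    ι (m ℤ.⊖ n)                         ≈⟨ ι-⊖ m n ⟩
    m ×′ 1# - n ×′ 1#                     ≈⟨ +-identityʳ _ ⟨
    (m ×′ 1# - n ×′ 1#) + 0#              ≈⟨ +-congˡ (-‿inverseʳ 1#) ⟨
    (m ×′ 1# - n ×′ 1#) + (1# - 1#)       ≈⟨ +-comm _ _ ⟩
    (1# - 1#) + (m ×′ 1# - n ×′ 1#)       ≈⟨ +-assoc _ _ _ ⟩
    1# + (- 1# + (m ×′ 1# - n ×′ 1#))     ≈⟨ +-congˡ (+-assoc _ _ _) ⟨
    1# + ((- 1# + m ×′ 1#) - n ×′ 1#)     ≈⟨ +-congˡ (+-congʳ (+-comm _ _)) ⟩
    1# + ((m ×′ 1# - 1#) - n ×′ 1#)       ≈⟨ +-congˡ (+-assoc _ _ _) ⟩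
    1# + (m ×′ 1# + (- 1# - n ×′ 1#))     ≈⟨ +-assoc _ _ _ ⟨
    (1# + m ×′ 1#) + (- 1# - n ×′ 1#)     ≈⟨ +-congˡ (-‿+-comm _ _) ⟩
    (1# + m ×′ 1#) - (1# + n ×′ 1#)       ∎

  ι-neg : ∀ i → ι (ℤ.- i) ≈ - ι i
  ι-neg (+ zero) = sym -0#≈0#
  ι-neg (+ suc n) = refl
  ι-neg -[1+ n ] = sym (-‿involutive _)

  ι-+ : ∀ i j → ι (i ℤ.+ j) ≈ ι i + ι j
  ι-+ (+ m) (+ n) = ×-homo-+ 1# m n
  ι-+ (+ m) -[1+ n ] = ι-⊖ m (suc n)
  ι-+ -[1+ m ] (+ n) = trans (ι-⊖ n (suc m)) (+-comm _ _)
  ι-+ -[1+ m ] -[1+ n ] = begin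
    - (suc (suc (m ℕ.+ n)) ×′ 1#)       ≈⟨ reflexive (≡.cong (λ k → - (suc k ×′ 1#)) (ℕP.+-suc m n)) ⟨
    - ((suc m ℕ.+ suc n) ×′ 1#)         ≈⟨ -‿cong (×-homo-+ 1# (suc m) (suc n)) ⟩
    - (suc m ×′ 1# + suc n ×′ 1#)        ≈⟨ -‿+-comm _ _ ⟨
    - (suc m ×′ 1#) - suc n ×′ 1#        ∎

  ι-*+ : ∀ m j → ι (+ m ℤ.* j) ≈ ι (+ m) * ι j
  ι-*+ m (+ n) = trans (reflexive (≡.cong ι (≡.sym (ℤP.pos-* m n)))) (×1-homo-* m n)
  ι-*+ m -[1+ n ] = begin
    ι (+ m ℤ.* -[1+ n ])         ≈⟨ reflexive (≡.cong ι (≡.sym (ℤP.neg-distribʳ-* (+ m) (+ suc n)))) ⟩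
    ι (ℤ.- (+ m ℤ.* + suc n))    ≈⟨ ι-neg (+ m ℤ.* + suc n) ⟩
    - ι (+ m ℤ.* + suc n)        ≈⟨ -‿cong (ι-*+ m (+ suc n)) ⟩
    - (ι (+ m) * ι (+ suc n))    ≈⟨ -‿distribʳ-* _ _ ⟩
    ι (+ m) * ι -[1+ n ]         ∎

  ι-* : ∀ i j → ι (i ℤ.* j) ≈ ι i * ι j
  ι-* (+ m) j = ι-*+ m j
  ι-* -[1+ m ] j = begin
    ι (-[1+ m ] ℤ.* j)           ≈⟨ reflexive (≡.cong ι (≡.sym (ℤP.neg-distribˡ-* (+ suc m) j))) ⟩
    ι (ℤ.- (+ suc m ℤ.* j))      ≈⟨ ι-neg (+ suc m ℤ.* j) ⟩
    - ι (+ suc m ℤ.* j)          ≈⟨ -‿cong (ι-*+ (suc m) j) ⟩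
    - (ι (+ suc m) * ι j)        ≈⟨ -‿distribˡ-* _ _ ⟩
    ι -[1+ m ] * ι j             ∎

  ι-1 : ι (+ 1) ≈ 1#
  ι-1 = +-identityʳ 1#

  private
    acr : ACR.AlmostCommutativeRing 0ℓ 0ℓ
    acr = ACR.fromCommutativeRing R

    ι-morphism : ℤ.+-*-rawRing ACR.-Raw-AlmostCommutative⟶ acr
    ι-morphism = record
      { ⟦_⟧ = ι ; +-homo = ι-+ ; *-homo = ι-* ; -‿homo = ι-neg ; 0-homo = refl ; 1-homo = ι-1 }

    ι-≟ : ∀ i j → Maybe (ι i ≈ ι j)
    ι-≟ i j = Data.Maybe.map (λ eq → reflexive (≡.cong ι eq)) (dec⇒weaklyDec ℤ._≟_ i j)

  module Solver = Algebra.Solver.Ring ℤ.+-*-rawRing acr ι-morphism ι-≟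
  open Solver public using (solve; _:=_; _:+_; _:*_; _:-_; :-_; con)

-- Power series, and polynomials as coefficient lists

module Poly (R : CommutativeRing 0ℓ 0ℓ) where
  open Kit R

  Seq : Set
  Seq = ℕ → Carrier

  tl : Seq → Seq
  tl p n = p (suc n)

  -- The Cauchy product. Recursion on the index splits off the constant term of the first factor, so
  -- that no finite sums have to be manipulated.
  mul : Seq → Seq → Seq
  mul p q zero = p 0 * q 0
  mul p q (suc n) = p 0 * q (suc n) + mul (tl p) q n

  mul-cong-≤ : ∀ {p p′ q q′ : Seq} n → (∀ k → k ≤ n → p k ≈ p′ k) → (∀ k → k ≤ n → q k ≈ q′ k) →
               mul p q n ≈ mul p′ q′ n
  mul-cong-≤ zero ep eq = *-cong (ep 0 z≤n) (eq 0 z≤n)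
  mul-cong-≤ (suc n) ep eq = +-cong (*-cong (ep 0 z≤n) (eq (suc n) ℕP.≤-refl))
    (mul-cong-≤ n (λ k k≤n → ep (suc k) (s≤s k≤n)) (λ k k≤n → eq k (ℕP.m≤n⇒m≤1+n k≤n)))

  mul-cong : ∀ {p p′ q q′ : Seq} → (∀ k → p k ≈ p′ k) → (∀ k → q k ≈ q′ k) → ∀ n → mul p q n ≈ mul p′ q′ n
  mul-cong ep eq n = mul-cong-≤ n (λ k _ → ep k) (λ k _ → eq k)

  mul-zeroˡ : ∀ (p q : Seq) n → (∀ k → k ≤ n → p k ≈ 0#) → mul p q n ≈ 0#
  mul-zeroˡ p q zero z = trans (*-congʳ (z 0 z≤n)) (zeroˡ _)
  mul-zeroˡ p q (suc n) z = trans (+-cong (trans (*-congʳ (z 0 z≤n)) (zeroˡ _))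
    (mul-zeroˡ (tl p) q n λ k k≤n → z (suc k) (s≤s k≤n))) (+-identityˡ 0#)

  mul-scale : ∀ c (p q : Seq) n → mul (λ k → c * p k) q n ≈ c * mul p q n
  mul-scale c p q zero = *-assoc _ _ _
  mul-scale c p q (suc n) = trans (+-cong (*-assoc _ _ _) (mul-scale c (tl p) q n)) (sym (distribˡ _ _ _))

  mul-distribʳ : ∀ (p p′ q : Seq) n → mul (λ k → p k + p′ k) q n ≈ mul p q n + mul p′ q n
  mul-distribʳ p p′ q zero = distribʳ _ _ _
  mul-distribʳ p p′ q (suc n) = trans (+-congˡ (mul-distribʳ (tl p) (tl p′) q n))
    (solve 5 (λ a b c x y → (a :+ b) :* c :+ (x :+ y) := (a :* c :+ x) :+ (b :* c :+ y)) refl _ _ _ _ _)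

  -- The mirror image of the defining recursion; commutativity comes from playing one against the
  -- other.
  mul-sucʳ : ∀ (p q : Seq) n → mul p q (suc n) ≈ p (suc n) * q 0 + mul p (tl q) n
  mul-sucʳ p q zero = +-comm _ _
  mul-sucʳ p q (suc n) = begin
    p 0 * q (suc (suc n)) + mul (tl p) q (suc n)                           ≈⟨ +-congˡ (mul-sucʳ (tl p) q n) ⟩
    p 0 * q (suc (suc n)) + (p (suc (suc n)) * q 0 + mul (tl p) (tl q) n)  ≈⟨ solve 3 (λ a b c → a :+ (b :+ c) := b :+ (a :+ c)) refl _ _ _ ⟩
    p (suc (suc n)) * q 0 + (p 0 * q (suc (suc n)) + mul (tl p) (tl q) n)  ∎

  mul-comm : ∀ (p q : Seq) n → mul p q n ≈ mul q p n
  mul-comm p q zero = *-comm _ _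
  mul-comm p q (suc n) = trans (+-cong (*-comm _ _) (mul-comm (tl p) q n)) (sym (mul-sucʳ q p n))

  mul-assoc : ∀ (p q r : Seq) n → mul (mul p q) r n ≈ mul p (mul q r) n
  mul-assoc p q r zero = *-assoc _ _ _
  mul-assoc p q r (suc n) = begin
    p 0 * q 0 * r (suc n) + mul (λ k → p 0 * q (suc k) + mul (tl p) q k) r n
      ≈⟨ +-congˡ (mul-distribʳ _ _ r n) ⟩
    p 0 * q 0 * r (suc n) + (mul (λ k → p 0 * q (suc k)) r n + mul (mul (tl p) q) r n)
      ≈⟨ +-congˡ (+-cong (mul-scale _ _ r n) (mul-assoc (tl p) q r n)) ⟩
    p 0 * q 0 * r (suc n) + (p 0 * mul (tl q) r n + mul (tl p) (mul q r) n)
      ≈⟨ solve 5 (λ a b c x y → a :* b :* c :+ (a :* x :+ y) := a :* (b :* c :+ x) :+ y) refl _ _ _ _ _ ⟩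
    p 0 * (q 0 * r (suc n) + mul (tl q) r n) + mul (tl p) (mul q r) n ∎

  oneˢ : Seq
  oneˢ zero = 1#
  oneˢ (suc n) = 0#

  mul-identityˡ : ∀ q n → mul oneˢ q n ≈ q n
  mul-identityˡ q zero = *-identityˡ _
  mul-identityˡ q (suc n) = trans (+-cong (*-identityˡ _) (mul-zeroˡ _ q n λ _ _ → refl)) (+-identityʳ _)

  SeqRing : CommutativeRing 0ℓ 0ℓ
  SeqRing = record
    { Carrier = Seq
    ; _≈_ = λ p q → ∀ n → p n ≈ q n
    ; _+_ = λ p q n → p n + q n
    ; _*_ = mul
    ; -_ = λ p n → - p n
    ; 0# = λ _ → 0#
    ; 1# = oneˢ
    ; isCommutativeRing = record
      { isRing = record
        { +-isAbelianGroup = record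
          { isGroup = record
            { isMonoid = record
              { isSemigroup = record
                { isMagma = record
                  { isEquivalence = record { refl = λ n → refl ; sym = λ e n → sym (e n) ; trans = λ e f n → trans (e n) (f n) }
                  ; ∙-cong = λ e f n → +-cong (e n) (f n) }
                ; assoc = λ p q r n → +-assoc _ _ _ }
              ; identity = (λ p n → +-identityˡ _) , (λ p n → +-identityʳ _) }
            ; inverse = (λ p n → -‿inverseˡ _) , (λ p n → -‿inverseʳ _)
            ; ⁻¹-cong = λ e n → -‿cong (e n) }
          ; comm = λ p q n → +-comm _ _ }
        ; *-cong = mul-cong
        ; *-assoc = mul-assoc
        ; *-identity = mul-identityˡ , (λ p n → trans (mul-comm p oneˢ n) (mul-identityˡ p n))
        ; distrib = (λ p q r n → trans (mul-comm p _ n) (trans (mul-distribʳ q r p n) (+-cong (mul-comm q p n) (mul-comm r p n))))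
                  , (λ p q r → mul-distribʳ q r p) }
      ; *-comm = mul-comm } }

  coef : List Carrier → Seq
  coef [] n = 0#
  coef (c ∷ p) zero = c
  coef (c ∷ p) (suc n) = coef p n

  scale : Carrier → List Carrier → List Carrier
  scale c = map (c *_)

  coef-map : ∀ (φ : Carrier → Carrier) → φ 0# ≈ 0# → ∀ p n → coef (map φ p) n ≈ φ (coef p n)
  coef-map φ z [] n = sym z
  coef-map φ z (c ∷ p) zero = refl
  coef-map φ z (c ∷ p) (suc n) = coef-map φ z p n

  coef-scale : ∀ c p n → coef (scale c p) n ≈ c * coef p n
  coef-scale c = coef-map (c *_) (zeroʳ c)

  opaque
    -- Kept opaque so that goals remain ring expressions instead of unfolding into list operations.
    add : List Carrier → List Carrier → List Carrier
    add [] q = q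
    add (c ∷ p) [] = c ∷ p
    add (c ∷ p) (d ∷ q) = c + d ∷ add p q

    mulP : List Carrier → List Carrier → List Carrier
    mulP [] q = []
    mulP (c ∷ p) q = add (scale c q) (0# ∷ mulP p q)

    negP : List Carrier → List Carrier
    negP = map (λ c → - c)

    add-∷ : ∀ c d p q → add (c ∷ p) (d ∷ q) ≡ c + d ∷ add p q
    add-∷ c d p q = ≡.refl

    mulP-∷ : ∀ c p q → mulP (c ∷ p) q ≡ add (scale c q) (0# ∷ mulP p q)
    mulP-∷ c p q = ≡.refl

    coef-add : ∀ p q n → coef (add p q) n ≈ coef p n + coef q n
    coef-add [] q n = sym (+-identityˡ _)
    coef-add (c ∷ p) [] n = sym (+-identityʳ _)
    coef-add (c ∷ p) (d ∷ q) zero = refl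
    coef-add (c ∷ p) (d ∷ q) (suc n) = coef-add p q n

    coef-neg : ∀ p n → coef (negP p) n ≈ - coef p n
    coef-neg = coef-map (λ c → - c) -0#≈0#

    coef-mul : ∀ p q n → coef (mulP p q) n ≈ mul (coef p) (coef q) n
    coef-mul [] q n = sym (mul-zeroˡ _ (coef q) n λ _ _ → refl)
    coef-mul (c ∷ p) q zero = trans (coef-add (scale c q) _ 0) (trans (+-identityʳ _) (coef-scale c q 0))
    coef-mul (c ∷ p) q (suc n) = trans (coef-add (scale c q) _ (suc n)) (+-cong (coef-scale c q (suc n)) (coef-mul p q n))

  infix 4 _≋_
  -- Trailing zeros let different lists represent one polynomial, so equality is that of
  -- coefficients. As a record it lets both lists be inferred from the type.
  record _≋_ (p q : List Carrier) : Set where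
    constructor mk≋
    field at : ∀ n → coef p n ≈ coef q n
  open _≋_ public

  private
    rawPoly : RawRing 0ℓ 0ℓ
    rawPoly = record { Carrier = List Carrier ; _≈_ = _≋_ ; _+_ = add ; _*_ = mulP ; -_ = negP ; 0# = [] ; 1# = 1# ∷ [] }

    coef-one : ∀ n → coef (1# ∷ []) n ≈ oneˢ n
    coef-one zero = refl
    coef-one (suc n) = refl

    coef-isRingMonomorphism : IsRingMonomorphism rawPoly (CommutativeRing.rawRing SeqRing) coef
    coef-isRingMonomorphism = record
      { isRingHomomorphism = record
        { isSemiringHomomorphism = record
          { isNearSemiringHomomorphism = record
            { +-isMonoidHomomorphism = record
              { isMagmaHomomorphism = record { isRelHomomorphism = record { cong = at } ; homo = coef-add }
              ; ε-homo = λ n → refl }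
            ; *-homo = coef-mul }
          ; 1#-homo = coef-one }
        ; -‿homo = coef-neg }
      ; injective = mk≋ }

  abstract
    -- The laws are pulled back from power series along `coef`, which is injective by the choice of
    -- equality.
    poly-isCommutativeRing : IsCommutativeRing _≋_ add mulP negP [] (1# ∷ [])
    poly-isCommutativeRing = RingMonomorphism.isCommutativeRing coef-isRingMonomorphism (CommutativeRing.isCommutativeRing SeqRing)

  PolyRing : CommutativeRing 0ℓ 0ℓ
  PolyRing = record { isCommutativeRing = poly-isCommutativeRing }

  module P = Kit PolyRing

  C : Carrier → List Carrier
  C c = c ∷ []

  X : List Carrier
  X = 0# ∷ 1# ∷ []

  ∷-cong : ∀ {c d p q} → c ≈ d → p ≋ q → c ∷ p ≋ d ∷ q
  ∷-cong e f = mk≋ λ { zero → e ; (suc n) → at f n }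

  ∷≋[] : ∀ {c p} → c ≈ 0# → p ≋ [] → c ∷ p ≋ []
  ∷≋[] e f = mk≋ λ { zero → e ; (suc n) → at f n }

  ≋[]⇒tail : ∀ {c p} → c ∷ p ≋ [] → p ≋ []
  ≋[]⇒tail e = mk≋ λ n → at e (suc n)

  scale≋C* : ∀ c p → scale c p ≋ C c P.* p
  scale≋C* c p = mk≋ λ n → trans (coef-scale c p n) (sym (trans (coef-mul (C c) p n) (go n)))
    where
    go : ∀ n → mul (coef (C c)) (coef p) n ≈ c * coef p n
    go zero = refl
    go (suc n) = trans (+-congˡ (mul-zeroˡ _ (coef p) n λ _ _ → refl)) (+-identityʳ _)

  X* : ∀ p → X P.* p ≋ 0# ∷ p
  X* p = mk≋ λ n → trans (coef-mul X p n) (go n)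
    where
    go : ∀ n → mul (coef X) (coef p) n ≈ coef (0# ∷ p) n
    go zero = zeroˡ _
    go (suc n) = trans (+-cong (zeroˡ _) (trans (mul-cong {q = coef p} (λ { zero → refl ; (suc k) → refl }) (λ _ → refl) n)
      (mul-identityˡ (coef p) n))) (+-identityˡ _)

  cons≋ : ∀ c p → c ∷ p ≋ C c P.+ X P.* p
  cons≋ c p = P.sym (P.trans (P.+-congˡ (X* p)) (mk≋ λ n → trans (coef-add (C c) (0# ∷ p) n) (go n)))
    where
    go : ∀ n → coef (C c) n + coef (0# ∷ p) n ≈ coef (c ∷ p) n
    go zero = +-identityʳ c
    go (suc n) = +-identityˡ _

  opaque
    unfolding add mulP

    C-+ : ∀ c d → C (c + d) ≋ C c P.+ C d
    C-+ c d = P.refl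

    C-* : ∀ c d → C (c * d) ≋ C c P.* C d
    C-* c d = mk≋ λ { zero → sym (+-identityʳ _) ; (suc n) → refl }

  C-cong : ∀ {c d} → c ≈ d → C c ≋ C d
  C-cong e = ∷-cong e P.refl

  C-0 : C 0# ≋ []
  C-0 = ∷≋[] refl P.refl

  eval : Carrier → List Carrier → Carrier
  eval x [] = 0#
  eval x (c ∷ p) = c + x * eval x p

  eval-≋[] : ∀ x {p} → p ≋ [] → eval x p ≈ 0#
  eval-≋[] x {[]} e = refl
  eval-≋[] x {c ∷ p} e = trans (+-cong (at e 0) (trans (*-congˡ (eval-≋[] x {p} (≋[]⇒tail e))) (zeroʳ _))) (+-identityˡ _)

  eval-cong : ∀ x {p q} → p ≋ q → eval x p ≈ eval x q
  eval-cong x {[]} {q} e = sym (eval-≋[] x {q} (P.sym e))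
  eval-cong x {c ∷ p} {[]} e = eval-≋[] x {c ∷ p} e
  eval-cong x {c ∷ p} {d ∷ q} e = +-cong (at e 0) (*-congˡ (eval-cong x {p} {q} (mk≋ λ n → at e (suc n))))

  eval-point : ∀ p {x y} → x ≈ y → eval x p ≈ eval y p
  eval-point [] e = refl
  eval-point (c ∷ p) e = +-congˡ (*-cong e (eval-point p e))

  opaque
    unfolding add

    eval-+ : ∀ x p q → eval x (p P.+ q) ≈ eval x p + eval x q
    eval-+ x [] q = sym (+-identityˡ _)
    eval-+ x (c ∷ p) [] = sym (+-identityʳ _)
    eval-+ x (c ∷ p) (d ∷ q) = trans (+-congˡ (*-congˡ (eval-+ x p q)))
      (solve 5 (λ c d x y z → (c :+ d) :+ x :* (y :+ z) := (c :+ x :* y) :+ (d :+ x :* z)) refl _ _ _ _ _)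

  eval-scale : ∀ x c p → eval x (scale c p) ≈ c * eval x p
  eval-scale x c [] = sym (zeroʳ _)
  eval-scale x c (d ∷ p) = trans (+-congˡ (*-congˡ (eval-scale x c p)))
    (solve 4 (λ c d x y → c :* d :+ x :* (c :* y) := c :* (d :+ x :* y)) refl _ _ _ _)

  opaque
    unfolding mulP

    eval-* : ∀ x p q → eval x (p P.* q) ≈ eval x p * eval x q
    eval-* x [] q = sym (zeroˡ _)
    eval-* x (c ∷ p) q = begin
      eval x (add (scale c q) (0# ∷ mulP p q))          ≈⟨ eval-+ x (scale c q) _ ⟩
      eval x (scale c q) + (0# + x * eval x (mulP p q)) ≈⟨ +-cong (eval-scale x c q) (trans (+-identityˡ _) (*-congˡ (eval-* x p q))) ⟩
      c * eval x q + x * (eval x p * eval x q)          ≈⟨ solve 4 (λ c q x p → c :* q :+ x :* (p :* q) := (c :+ x :* p) :* q) refl _ _ _ _ ⟩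
      (c + x * eval x p) * eval x q                     ∎

  eval-C : ∀ x c → eval x (C c) ≈ c
  eval-C x c = trans (+-congˡ (zeroʳ x)) (+-identityʳ c)

  eval-X : ∀ x → eval x X ≈ x
  eval-X x = trans (+-identityˡ _) (trans (*-congˡ (eval-C x 1#)) (*-identityʳ x))

  eval-^ : ∀ x p n → eval x (p P.^ n) ≈ eval x p ^ n
  eval-^ x p zero = eval-C x 1#
  eval-^ x p (suc n) = trans (eval-* x p _) (*-congˡ (eval-^ x p n))

  opaque
    unfolding add

    length-add : ∀ {N} p q → length p ≤ N → length q ≤ N → length (add p q) ≤ N
    length-add [] q a b = b
    length-add (c ∷ p) [] a b = a
    length-add (c ∷ p) (d ∷ q) (s≤s a) (s≤s b) = s≤s (length-add p q a b)

  length-map : ∀ (φ : Carrier → Carrier) p → length (map φ p) ≡ length p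
  length-map φ [] = ≡.refl
  length-map φ (c ∷ p) = ≡.cong suc (length-map φ p)

  opaque
    unfolding mulP

    length-mul : ∀ p q → length (mulP p q) ≤ length p ℕ.+ length q
    length-mul [] q = z≤n
    length-mul (c ∷ p) q = length-add (scale c q) _
      (ℕP.≤-trans (ℕP.≤-reflexive (length-map _ q)) (ℕP.m≤n+m (length q) (suc (length p))))
      (s≤s (length-mul p q))

  coef-≥length : ∀ p n → length p ≤ n → coef p n ≈ 0#
  coef-≥length [] n _ = refl
  coef-≥length (c ∷ p) (suc n) (s≤s l) = coef-≥length p n l

  -- The derivative, from the product rule (c + X p)' = p + X p'.
  D : List Carrier → List Carrier
  D [] = []
  D (c ∷ p) = add p (0# ∷ D p)

  length-D : ∀ p → length (D p) ≤ length p
  length-D [] = z≤n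
  length-D (c ∷ p) = length-add p _ (ℕP.n≤1+n _) (s≤s (length-D p))

  coef-D : ∀ p n → coef (D p) n ≈ ι (+ suc n) * coef p (suc n)
  coef-D [] n = sym (zeroʳ _)
  coef-D (c ∷ p) zero = trans (coef-add p _ 0) (trans (+-identityʳ _) (sym (trans (*-congʳ ι-1) (*-identityˡ _))))
  coef-D (c ∷ p) (suc n) = begin
    coef (add p (0# ∷ D p)) (suc n)                            ≈⟨ coef-add p _ (suc n) ⟩
    coef p (suc n) + coef (D p) n                              ≈⟨ +-congˡ (coef-D p n) ⟩
    coef p (suc n) + ι (+ suc n) * coef p (suc n)              ≈⟨ +-congʳ (*-identityˡ _) ⟨
    1# * coef p (suc n) + ι (+ suc n) * coef p (suc n)         ≈⟨ distribʳ _ _ _ ⟨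
    ι (+ suc (suc n)) * coef p (suc n)                         ∎

  D-cong : ∀ {p q} → p ≋ q → D p ≋ D q
  D-cong {p} {q} e = mk≋ λ n → trans (coef-D p n) (trans (*-congˡ (at e (suc n))) (sym (coef-D q n)))

  D-+ : ∀ p q → D (p P.+ q) ≋ D p P.+ D q
  D-+ p q = mk≋ λ n → begin
    coef (D (add p q)) n                                            ≈⟨ coef-D (add p q) n ⟩
    ι (+ suc n) * coef (add p q) (suc n)                            ≈⟨ *-congˡ (coef-add p q (suc n)) ⟩
    ι (+ suc n) * (coef p (suc n) + coef q (suc n))                 ≈⟨ distribˡ _ _ _ ⟩
    ι (+ suc n) * coef p (suc n) + ι (+ suc n) * coef q (suc n)     ≈⟨ +-cong (coef-D p n) (coef-D q n) ⟨
    coef (D p) n + coef (D q) n                                     ≈⟨ coef-add (D p) (D q) n ⟨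
    coef (add (D p) (D q)) n                                        ∎

  D-scale : ∀ c p → D (scale c p) ≋ scale c (D p)
  D-scale c p = mk≋ λ n → begin
    coef (D (scale c p)) n                ≈⟨ coef-D (scale c p) n ⟩
    ι (+ suc n) * coef (scale c p) (suc n)  ≈⟨ *-congˡ (coef-scale c p (suc n)) ⟩
    ι (+ suc n) * (c * coef p (suc n))    ≈⟨ solve 3 (λ a b c → a :* (b :* c) := b :* (a :* c)) refl _ _ _ ⟩
    c * (ι (+ suc n) * coef p (suc n))    ≈⟨ *-congˡ (coef-D p n) ⟨
    c * coef (D p) n                      ≈⟨ coef-scale c (D p) n ⟨
    coef (scale c (D p)) n                ∎

  D-∷ : ∀ c p → D (c ∷ p) ≋ p P.+ X P.* D p
  D-∷ c p = P.+-congˡ (P.sym (X* (D p)))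

  mul-∷ : ∀ c p q → (c ∷ p) P.* q ≋ C c P.* q P.+ X P.* (p P.* q)
  mul-∷ c p q = P.trans (P.reflexive (mulP-∷ c p q)) (P.+-cong (scale≋C* c q) (P.sym (X* (mulP p q))))

  D-* : ∀ p q → D (p P.* q) ≋ D p P.* q P.+ p P.* D q
  D-* [] q = P.trans (D-cong (P.zeroˡ q)) (P.sym (P.trans (P.+-cong (P.zeroˡ q) (P.zeroˡ (D q))) (P.+-identityˡ _)))
  D-* (c ∷ p) q = P.begin
    D ((c ∷ p) P.* q)                                                  P.≈⟨ D-cong (P.reflexive (mulP-∷ c p q)) ⟩
    D (scale c q P.+ (0# ∷ mulP p q))                                  P.≈⟨ D-+ (scale c q) (0# ∷ mulP p q) ⟩
    D (scale c q) P.+ D (0# ∷ mulP p q)                                P.≈⟨ P.+-cong (P.trans (D-scale c q) (scale≋C* c (D q))) (D-∷ 0# (mulP p q)) ⟩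
    C c P.* D q P.+ (p P.* q P.+ X P.* D (p P.* q))                    P.≈⟨ P.+-congˡ (P.+-congˡ (P.*-congˡ (D-* p q))) ⟩
    C c P.* D q P.+ (p P.* q P.+ X P.* (D p P.* q P.+ p P.* D q))      P.≈⟨ P.solve 6 (λ c q p x p′ q′ →
        c P.:* q′ P.:+ (p P.:* q P.:+ x P.:* (p′ P.:* q P.:+ p P.:* q′)) P.:=
        (p P.:+ x P.:* p′) P.:* q P.:+ (c P.:+ x P.:* p) P.:* q′) P.refl (C c) q p X (D p) (D q) ⟩
    (p P.+ X P.* D p) P.* q P.+ (C c P.+ X P.* p) P.* D q              P.≈⟨ P.+-cong (P.*-congʳ (D-∷ c p)) (P.*-congʳ (cons≋ c p)) ⟨
    D (c ∷ p) P.* q P.+ (c ∷ p) P.* D q                                P.∎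

  D-^ : ∀ p n → D (p P.^ suc n) ≋ P.ι (+ suc n) P.* (D p P.* p P.^ n)
  D-^ p zero = P.trans (D-cong (P.*-identityʳ p)) (P.sym (P.trans (P.*-congʳ P.ι-1) (P.trans (P.*-identityˡ _) (P.*-identityʳ _))))
  D-^ p (suc n) = P.begin
    D (p P.* p P.^ suc n)                                              P.≈⟨ D-* p _ ⟩
    D p P.* p P.^ suc n P.+ p P.* D (p P.^ suc n)                      P.≈⟨ P.+-congˡ (P.*-congˡ (D-^ p n)) ⟩
    D p P.* (p P.* p P.^ n) P.+ p P.* (P.ι (+ suc n) P.* (D p P.* p P.^ n))  P.≈⟨
       P.solve 4 (λ i d p q → d P.:* (p P.:* q) P.:+ p P.:* (i P.:* (d P.:* q)) P.:= (P.con (+ 1) P.:+ i) P.:* (d P.:* (p P.:* q))) P.refl (P.ι (+ suc n)) (D p) p (p P.^ n) ⟩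
    (P.ι (+ 1) P.+ P.ι (+ suc n)) P.* (D p P.* (p P.* p P.^ n))        P.≈⟨ P.*-congʳ (P.ι-+ (+ 1) (+ suc n)) ⟨
    P.ι (+ suc (suc n)) P.* (D p P.* p P.^ suc n)                      P.∎

  mul-deg : ∀ k j (p q : Seq) → (∀ n → k < n → p n ≈ 0#) → (∀ n → j < n → q n ≈ 0#) →
            ∀ n → k ℕ.+ j < n → mul p q n ≈ 0#
  mul-deg zero j p q hp hq (suc n) l = trans (+-cong (trans (*-congˡ (hq (suc n) l)) (zeroʳ _)) (mul-zeroˡ (tl p) q n λ k _ → hp (suc k) (s≤s z≤n))) (+-identityʳ _)
  mul-deg (suc k) j p q hp hq (suc n) (s≤s l) = trans (+-cong
    (trans (*-congˡ (hq (suc n) (s≤s (ℕP.≤-trans (ℕP.m≤n+m j k) (ℕP.<⇒≤ l))))) (zeroʳ _))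
    (mul-deg k j (tl p) q (λ n k<n → hp (suc n) (s≤s k<n)) hq n l)) (+-identityʳ _)

  mul-top : ∀ k j (p q : Seq) → (∀ n → k < n → p n ≈ 0#) → (∀ n → j < n → q n ≈ 0#) → mul p q (k ℕ.+ j) ≈ p k * q j
  mul-top zero zero p q hp hq = refl
  mul-top zero (suc j) p q hp hq = trans (+-congˡ (mul-zeroˡ (tl p) q j λ k _ → hp (suc k) (s≤s z≤n))) (+-identityʳ _)
  mul-top (suc k) j p q hp hq = trans (+-cong
    (trans (*-congˡ (hq (suc (k ℕ.+ j)) (s≤s (ℕP.m≤n+m j k)))) (zeroʳ _))
    (mul-top k j (tl p) q (λ n k<n → hp (suc n) (s≤s k<n)) hq)) (+-identityˡ _)

  tab : ℕ → Seq → List Carrier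
  tab zero p = []
  tab (suc n) p = p 0 ∷ tab n (tl p)

  length-tab : ∀ n p → length (tab n p) ≡ n
  length-tab zero p = ≡.refl
  length-tab (suc n) p = ≡.cong suc (length-tab n (tl p))

  coef-tab : ∀ n p k → k < n → coef (tab n p) k ≈ p k
  coef-tab (suc n) p zero l = refl
  coef-tab (suc n) p (suc k) (s≤s l) = coef-tab n (tl p) k l

  coef-tab-≥ : ∀ n p k → n ≤ k → coef (tab n p) k ≈ 0#
  coef-tab-≥ n p k l = coef-≥length (tab n p) k (ℕP.≤-trans (ℕP.≤-reflexive (length-tab n p)) l)

-- Ring homomorphisms and their action on polynomials

module Morphism where
  record Hom (R S : CommutativeRing 0ℓ 0ℓ) : Set where
    private
      module R = Kit R
      module S = Kit S
    field
      ⟦_⟧ : R.Carrier → S.Carrier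
      cong : ∀ {x y} → x R.≈ y → ⟦ x ⟧ S.≈ ⟦ y ⟧
      +-hom : ∀ x y → ⟦ x R.+ y ⟧ S.≈ ⟦ x ⟧ S.+ ⟦ y ⟧
      *-hom : ∀ x y → ⟦ x R.* y ⟧ S.≈ ⟦ x ⟧ S.* ⟦ y ⟧
      1-hom : ⟦ R.1# ⟧ S.≈ S.1#

    0-hom : ⟦ R.0# ⟧ S.≈ S.0#
    0-hom = S.begin
      ⟦ R.0# ⟧                                  S.≈⟨ S.solve 1 (λ x → x S.:= (x S.:+ x) S.:- x) S.refl _ ⟩
      (⟦ R.0# ⟧ S.+ ⟦ R.0# ⟧) S.- ⟦ R.0# ⟧      S.≈⟨ S.+-congʳ (S.trans (S.sym (+-hom _ _)) (cong (R.+-identityˡ _))) ⟩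
      ⟦ R.0# ⟧ S.- ⟦ R.0# ⟧                     S.≈⟨ S.-‿inverseʳ _ ⟩
      S.0#                                      S.∎

    neg-hom : ∀ x → ⟦ R.- x ⟧ S.≈ S.- ⟦ x ⟧
    neg-hom x = S.begin
      ⟦ R.- x ⟧                              S.≈⟨ S.solve 2 (λ x y → y S.:= (y S.:+ x) S.:- x) S.refl ⟦ x ⟧ _ ⟩
      (⟦ R.- x ⟧ S.+ ⟦ x ⟧) S.- ⟦ x ⟧        S.≈⟨ S.+-congʳ (S.trans (S.sym (+-hom _ _)) (S.trans (cong (R.-‿inverseˡ _)) 0-hom)) ⟩
      S.0# S.- ⟦ x ⟧                         S.≈⟨ S.+-identityˡ _ ⟩
      S.- ⟦ x ⟧                              S.∎

    ι-hom : ∀ i → ⟦ R.ι i ⟧ S.≈ S.ι i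
    ι-hom (+ n) = go n
      where
      go : ∀ n → ⟦ n R.×′ R.1# ⟧ S.≈ n S.×′ S.1#
      go zero = 0-hom
      go (suc n) = S.trans (+-hom _ _) (S.+-cong 1-hom (go n))
    ι-hom -[1+ n ] = S.trans (neg-hom _) (S.-‿cong (ι-hom (+ suc n)))

    ^-hom : ∀ x n → ⟦ x R.^ n ⟧ S.≈ ⟦ x ⟧ S.^ n
    ^-hom x zero = 1-hom
    ^-hom x (suc n) = S.trans (*-hom _ _) (S.*-congˡ (^-hom x n))

  module _ (R : CommutativeRing 0ℓ 0ℓ) where
    open Poly R

    C-Hom : Hom R PolyRing
    C-Hom = record { ⟦_⟧ = C ; cong = C-cong ; +-hom = C-+ ; *-hom = C-* ; 1-hom = P.refl }

    eval-Hom : CommutativeRing.Carrier R → Hom PolyRing R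
    eval-Hom x = record { ⟦_⟧ = eval x ; cong = eval-cong x ; +-hom = eval-+ x ; *-hom = eval-* x ; 1-hom = eval-C x (CommutativeRing.1# R) }

  module _ {R S : CommutativeRing 0ℓ 0ℓ} (φ : Hom R S) where
    private
      module PR = Poly R
      module PS = Poly S
      module R = Kit R
      module S = Kit S
    open Hom φ

    coef-mapHom : ∀ p n → PS.coef (map ⟦_⟧ p) n S.≈ ⟦ PR.coef p n ⟧
    coef-mapHom [] n = S.sym 0-hom
    coef-mapHom (c ∷ p) zero = S.refl
    coef-mapHom (c ∷ p) (suc n) = coef-mapHom p n

    mul-hom : ∀ p q n → ⟦ PR.mul p q n ⟧ S.≈ PS.mul (⟦_⟧ ∘ p) (⟦_⟧ ∘ q) n
    mul-hom p q zero = *-hom _ _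
    mul-hom p q (suc n) = S.trans (+-hom _ _) (S.+-cong (*-hom _ _) (mul-hom (PR.tl p) q n))

    map-Hom : Hom PR.PolyRing PS.PolyRing
    map-Hom = record
      { ⟦_⟧ = map ⟦_⟧
      ; cong = λ {p} {q} e → PS.mk≋ λ n → S.trans (coef-mapHom p n) (S.trans (cong (PR.at e n)) (S.sym (coef-mapHom q n)))
      ; +-hom = λ p q → PS.mk≋ λ n → S.begin
          PS.coef (map ⟦_⟧ (p PR.P.+ q)) n                        S.≈⟨ coef-mapHom (p PR.P.+ q) n ⟩
          ⟦ PR.coef (p PR.P.+ q) n ⟧                              S.≈⟨ cong (PR.coef-add p q n) ⟩
          ⟦ PR.coef p n R.+ PR.coef q n ⟧                         S.≈⟨ +-hom _ _ ⟩
          ⟦ PR.coef p n ⟧ S.+ ⟦ PR.coef q n ⟧                     S.≈⟨ S.+-cong (coef-mapHom p n) (coef-mapHom q n) ⟨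
          PS.coef (map ⟦_⟧ p) n S.+ PS.coef (map ⟦_⟧ q) n         S.≈⟨ PS.coef-add (map ⟦_⟧ p) (map ⟦_⟧ q) n ⟨
          PS.coef (map ⟦_⟧ p PS.P.+ map ⟦_⟧ q) n                  S.∎
      ; *-hom = λ p q → PS.mk≋ λ n → S.begin
          PS.coef (map ⟦_⟧ (p PR.P.* q)) n                        S.≈⟨ coef-mapHom (p PR.P.* q) n ⟩
          ⟦ PR.coef (p PR.P.* q) n ⟧                              S.≈⟨ cong (PR.coef-mul p q n) ⟩
          ⟦ PR.mul (PR.coef p) (PR.coef q) n ⟧                    S.≈⟨ mul-hom (PR.coef p) (PR.coef q) n ⟩
          PS.mul (⟦_⟧ ∘ PR.coef p) (⟦_⟧ ∘ PR.coef q) n            S.≈⟨ PS.mul-cong (coef-mapHom p) (coef-mapHom q) n ⟨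
          PS.mul (PS.coef (map ⟦_⟧ p)) (PS.coef (map ⟦_⟧ q)) n    S.≈⟨ PS.coef-mul (map ⟦_⟧ p) (map ⟦_⟧ q) n ⟨
          PS.coef (map ⟦_⟧ p PS.P.* map ⟦_⟧ q) n                  S.∎
      ; 1-hom = PS.∷-cong 1-hom PS.P.refl }

-- Polynomials over a domain: orders of vanishing and the number of roots

module Domain (R : CommutativeRing 0ℓ 0ℓ)
  (_≟_ : Discrete R)
  (domain : NoZeroDivisors R) where
  open Morphism
  open Kit R
  open Poly R

  zero? : ∀ p → Dec (p ≋ [])
  zero? [] = yes P.refl
  zero? (c ∷ p) with c ≟ 0# | zero? p
  ... | yes c0 | yes p0 = yes (∷≋[] c0 p0)
  ... | no c≉0 | _ = no λ e → c≉0 (at e 0)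
  ... | yes _ | no p≉0 = no λ e → p≉0 (≋[]⇒tail e)

  mul-tailˡ : ∀ {c} p q → c ≈ 0# → (c ∷ p) P.* q ≋ [] → p P.* q ≋ []
  mul-tailˡ {c} p q c0 e = ≋[]⇒tail {0#} (P.begin
    0# ∷ (p P.* q)                     P.≈⟨ X* _ ⟨
    X P.* (p P.* q)                    P.≈⟨ P.+-identityˡ _ ⟨
    [] P.+ X P.* (p P.* q)             P.≈⟨ P.+-congʳ (P.trans (P.*-congʳ (P.trans (C-cong c0) C-0)) (P.zeroˡ _)) ⟨
    C c P.* q P.+ X P.* (p P.* q)      P.≈⟨ mul-∷ c p q ⟨
    (c ∷ p) P.* q                      P.≈⟨ e ⟩
    []                                 P.∎)

  -- The product of the constant terms is zero, so one of them is; dropping it divides that factor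
  -- by X, and the recursion continues with a shorter list.
  poly-domain : ∀ p q → p P.* q ≋ [] → p ≋ [] ⊎ q ≋ []
  poly-domain [] q e = inj₁ P.refl
  poly-domain (c ∷ p) [] e = inj₂ P.refl
  poly-domain (c ∷ p) (d ∷ q) e = Sum.[
      (λ c0 → Sum.map₁ (∷≋[] c0) (poly-domain p (d ∷ q) (mul-tailˡ p (d ∷ q) c0 e)))
    , (λ d0 → Sum.map₂ (∷≋[] d0) (poly-domain (c ∷ p) q (P.trans (P.*-comm (c ∷ p) q) (mul-tailˡ q (c ∷ p) d0 (P.trans (P.*-comm (d ∷ q) (c ∷ p)) e)))))
    ]′ (domain c d (trans (sym (coef-mul (c ∷ p) (d ∷ q) 0)) (at e 0)))

  poly-cancelˡ : ∀ p {q r} → ¬ p ≋ [] → p P.* q ≋ p P.* r → q ≋ r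
  poly-cancelˡ p {q} {r} p≉0 e with poly-domain p (q P.- r) (P.trans (P.solve 3 (λ p q r → p P.:* (q P.:- r) P.:= p P.:* q P.:- p P.:* r) P.refl p q r)
     (P.trans (P.+-congʳ e) (P.-‿inverseʳ _)))
  ... | inj₁ p0 = contradiction p0 p≉0
  ... | inj₂ d = P.x∙y⁻¹≈ε⇒x≈y q r d

  poly-^-≉ : ∀ p n → ¬ 1# ≈ 0# → ¬ p ≋ [] → ¬ p P.^ n ≋ []
  poly-^-≉ p zero 1≉0 p≉0 e = 1≉0 (at e 0)
  poly-^-≉ p (suc n) 1≉0 p≉0 e with poly-domain p (p P.^ n) e
  ... | inj₁ a = p≉0 a
  ... | inj₂ b = poly-^-≉ p n 1≉0 p≉0 b

  -- Horner's scheme: the quotient of c ∷ p by X − x.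
  syn : Carrier → List Carrier → List Carrier
  syn x [] = []
  syn x (d ∷ p) = eval x (d ∷ p) ∷ syn x p

  length-syn : ∀ x p → length (syn x p) ≡ length p
  length-syn x [] = ≡.refl
  length-syn x (d ∷ p) = ≡.cong suc (length-syn x p)

  X-_ : Carrier → List Carrier
  X- x = X P.- C x

  syn-spec : ∀ x c p → c ∷ p ≋ (X- x) P.* syn x p P.+ C (eval x (c ∷ p))
  syn-spec x c [] = P.sym (P.trans (P.+-cong (P.zeroʳ (X- x)) (C-cong (eval-C x c))) (P.+-identityˡ _))
  syn-spec x c (d ∷ p) = P.begin
    c ∷ d ∷ p                                               P.≈⟨ cons≋ c (d ∷ p) ⟩
    C c P.+ X P.* (d ∷ p)                                   P.≈⟨ P.+-congˡ (P.*-congˡ (syn-spec x d p)) ⟩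
    C c P.+ X P.* ((X- x) P.* syn x p P.+ C E)              P.≈⟨ P.solve 5 (λ c X x s E →
       c P.:+ X P.:* ((X P.:- x) P.:* s P.:+ E) P.:= (X P.:- x) P.:* (E P.:+ X P.:* s) P.:+ (c P.:+ x P.:* E)) P.refl (C c) X (C x) (syn x p) (C E) ⟩
    (X- x) P.* (C E P.+ X P.* syn x p) P.+ (C c P.+ C x P.* C E)  P.≈⟨ P.+-cong (P.*-congˡ (P.sym (cons≋ E (syn x p)))) (P.trans (P.+-congˡ (P.sym (C-* x E))) (P.sym (C-+ c (x * E)))) ⟩
    (X- x) P.* (E ∷ syn x p) P.+ C (c + x * E)              P.∎
    where E = eval x (d ∷ p)

  Dⁿ : ℕ → List Carrier → List Carrier
  Dⁿ zero p = p
  Dⁿ (suc n) p = D (Dⁿ n p)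

  Dⁿ-cong : ∀ n {p q} → p ≋ q → Dⁿ n p ≋ Dⁿ n q
  Dⁿ-cong zero e = e
  Dⁿ-cong (suc n) e = D-cong (Dⁿ-cong n e)

  D-C : ∀ c → D (C c) ≋ []
  D-C c = P.trans (P.+-identityˡ _) (∷≋[] refl P.refl)

  D-C* : ∀ c p → D (C c P.* p) ≋ C c P.* D p
  D-C* c p = P.trans (D-cong (P.sym (scale≋C* c p))) (P.trans (D-scale c p) (scale≋C* c (D p)))

  D-X- : ∀ x → D (X- x) ≋ P.1#
  D-X- x = mk≋ λ n → trans (coef-D (X- x) n) (trans (*-congˡ (trans (coef-add X _ (suc n)) (trans (+-congˡ (trans (coef-neg (C x) (suc n)) -0#≈0#)) (+-identityʳ _)))) (go n))
    where
    go : ∀ n → ι (+ suc n) * coef X (suc n) ≈ coef (1# ∷ []) n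
    go zero = trans (*-identityʳ _) ι-1
    go (suc n) = zeroʳ _

  -- Leibniz' rule has only two terms here because the second derivative of a linear factor is zero.
  Dⁿ-X-* : ∀ x q n → Dⁿ (suc n) ((X- x) P.* q) ≋ (X- x) P.* Dⁿ (suc n) q P.+ C (ι (+ suc n)) P.* Dⁿ n q
  Dⁿ-X-* x q zero = P.trans (D-* (X- x) q) (P.trans (P.+-comm _ _) (P.+-congˡ (P.*-congʳ (P.trans (D-X- x) (C-cong (sym ι-1))))))
  Dⁿ-X-* x q (suc n) = P.begin
    D (Dⁿ (suc n) ((X- x) P.* q))                              P.≈⟨ D-cong (Dⁿ-X-* x q n) ⟩
    D ((X- x) P.* A P.+ C i P.* B)                             P.≈⟨ D-+ _ _ ⟩
    D ((X- x) P.* A) P.+ D (C i P.* B)                         P.≈⟨ P.+-cong (D-* (X- x) A) (D-C* i B) ⟩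
    (D (X- x) P.* A P.+ (X- x) P.* D A) P.+ C i P.* A          P.≈⟨ P.+-congʳ (P.+-congʳ (P.*-congʳ (D-X- x))) ⟩
    (P.1# P.* A P.+ (X- x) P.* D A) P.+ C i P.* A              P.≈⟨ P.solve 4 (λ o a l i → (o P.:* a P.:+ l) P.:+ i P.:* a P.:= l P.:+ (o P.:+ i) P.:* a) P.refl P.1# A _ (C i) ⟩
    (X- x) P.* D A P.+ (P.1# P.+ C i) P.* A                    P.≈⟨ P.+-congˡ (P.*-congʳ (P.trans (P.sym (C-+ 1# i)) (C-cong refl))) ⟩
    (X- x) P.* D A P.+ C (ι (+ suc (suc n))) P.* A             P.∎
    where
    i = ι (+ suc n)
    A = Dⁿ (suc n) q
    B = Dⁿ n q

  -- Ordinary derivatives detect multiplicity only up to the characteristic; below, no order exceeds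
  -- a bound M for which 1, ..., M - 1 are nonzero in the ring.
  Ord : Carrier → ℕ → List Carrier → Set
  Ord x k p = ∀ i → i < k → eval x (Dⁿ i p) ≈ 0#

  eval-X- : ∀ x y → eval y (X- x) ≈ y - x
  eval-X- x y = trans (eval-+ y X _) (+-cong (eval-X y) (trans (Hom.neg-hom (eval-Hom R y) (C x)) (-‿cong (eval-C y x))))

  eval-Dⁿ-X-* : ∀ x y q n → eval y (Dⁿ (suc n) ((X- x) P.* q)) ≈ (y - x) * eval y (Dⁿ (suc n) q) + ι (+ suc n) * eval y (Dⁿ n q)
  eval-Dⁿ-X-* x y q n = trans (eval-cong y (Dⁿ-X-* x q n)) (trans (eval-+ y _ _)
    (+-cong (trans (eval-* y (X- x) _) (*-congʳ (eval-X- x y))) (trans (eval-* y (C _) _) (*-congʳ (eval-C y _)))))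

  Distinct : List Carrier → Set
  Distinct = AllPairs (λ x y → ¬ x ≈ y)

  module _ (M : ℕ) (char : ∀ i → suc i < M → ¬ ι (+ suc i) ≈ 0#) where

    -- At x itself the first Leibniz term drops out and leaves (i + 1) times the i-th derivative of
    -- q. The factor i + 1 cancels, so exactly one order is lost.
    Ord-quotient-same : ∀ x k q → suc k ≤ M → Ord x (suc k) ((X- x) P.* q) → Ord x k q
    Ord-quotient-same x k q k<M o i i<k with domain (ι (+ suc i)) (eval x (Dⁿ i q))
       (trans (sym (+-identityˡ _)) (trans (+-congʳ (sym (trans (*-congʳ (-‿inverseʳ x)) (zeroˡ _)))) (trans (sym (eval-Dⁿ-X-* x x q i)) (o (suc i) (s≤s i<k)))))
    ... | inj₁ a = contradiction a (char i (ℕP.≤-trans (s≤s i<k) k<M))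
    ... | inj₂ b = b

    -- The derivatives of q at y vanish one after the other: the second Leibniz term is zero by the
    -- previous step, and y - x cancels from the first.
    Ord-quotient-other : ∀ x y k q → ¬ x ≈ y → Ord y k ((X- x) P.* q) → Ord y k q
    Ord-quotient-other x y k q x≉y o i i<k with domain (y - x) (eval y (Dⁿ i q)) (go i i<k)
      where
      go : ∀ i → i < k → (y - x) * eval y (Dⁿ i q) ≈ 0#
      go zero i<k = trans (*-congʳ (sym (eval-X- x y))) (trans (sym (eval-* y (X- x) q)) (o 0 i<k))
      go (suc i) i<k = begin
        (y - x) * eval y (Dⁿ (suc i) q)                                       ≈⟨ +-identityʳ _ ⟨
        (y - x) * eval y (Dⁿ (suc i) q) + 0#                                  ≈⟨ +-congˡ (trans (*-congˡ (Ord-quotient-other x y k q x≉y o i (ℕP.<-trans ℕP.≤-refl i<k))) (zeroʳ _)) ⟨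
        (y - x) * eval y (Dⁿ (suc i) q) + ι (+ suc i) * eval y (Dⁿ i q)       ≈⟨ eval-Dⁿ-X-* x y q i ⟨
        eval y (Dⁿ (suc i) ((X- x) P.* q))                                    ≈⟨ o (suc i) i<k ⟩
        0#                                                                    ∎
    ... | inj₁ a = contradiction (sym (x∙y⁻¹≈ε⇒x≈y y x a)) x≉y
    ... | inj₂ b = b

    private
      -- Here k counts the factors X - x still to be removed at the current point. Every division
      -- shortens the list by one entry, and the length bound says that the factors outlast it.
      roots : ∀ k x xs p → k ≤ M → All (λ y → ¬ x ≈ y) xs → Distinct xs → Ord x k p → All (λ y → Ord y M p) xs →
              length p ≤ k ℕ.+ length xs ℕ.* M → p ≋ []
      roots zero x [] [] _ _ _ _ _ _ = P.refl
      roots zero x (y ∷ xs) p k≤M x≉ (y≉ ∷ ds) o (oy ∷ os) l = roots M y xs p ℕP.≤-refl y≉ ds oy os l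
      roots (suc k) x xs [] _ _ _ _ _ _ = P.refl
      roots (suc k) x xs (c ∷ p) k≤M x≉ ds o os (s≤s l) = P.trans p≋ (P.trans (P.*-congˡ q≋0) (P.zeroʳ _))
        where
        p≋ : c ∷ p ≋ (X- x) P.* syn x p
        p≋ = P.trans (syn-spec x c p) (P.trans (P.+-congˡ (P.trans (C-cong (o 0 (s≤s z≤n))) C-0)) (P.+-identityʳ _))
        transport : ∀ {y k} → Ord y k (c ∷ p) → Ord y k ((X- x) P.* syn x p)
        transport {y} o i i<k = trans (eval-cong y (Dⁿ-cong i (P.sym p≋))) (o i i<k)
        others : ∀ {ys} → All (λ y → ¬ x ≈ y) ys → All (λ y → Ord y M (c ∷ p)) ys → All (λ y → Ord y M (syn x p)) ys
        others [] [] = []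
        others (n ∷ ns) (o ∷ os) = Ord-quotient-other x _ M (syn x p) n (transport o) ∷ others ns os
        q≋0 : syn x p ≋ []
        q≋0 = roots k x xs (syn x p) (ℕP.<⇒≤ k≤M) x≉ ds (Ord-quotient-same x k (syn x p) k≤M (transport o)) (others x≉ os)
          (ℕP.≤-trans (ℕP.≤-reflexive (length-syn x p)) l)

    too-many-roots : ∀ xs p → Distinct xs → All (λ y → Ord y M p) xs → length p ≤ length xs ℕ.* M → p ≋ []
    too-many-roots [] [] _ _ _ = P.refl
    too-many-roots (x ∷ xs) p (x≉ ∷ ds) (o ∷ os) l = roots M x xs p ℕP.≤-refl x≉ ds o os l

  too-many-simple-roots : ∀ xs p → Distinct xs → All (λ y → eval y p ≈ 0#) xs → length p ≤ length xs → p ≋ []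
  too-many-simple-roots xs p ds es l = too-many-roots 1 (λ { i (s≤s ()) }) xs p ds (All.map (λ { e zero _ → e ; e (suc i) (s≤s ()) }) es)
    (ℕP.≤-trans l (ℕP.≤-reflexive (≡.sym (ℕP.*-identityʳ _))))

-- Division with remainder and square roots in F[X]

module Field (R : CommutativeRing 0ℓ 0ℓ)
  (_≟_ : Discrete R)
  (domain : NoZeroDivisors R)
  (inverse : HasInverses R) where
  open Kit R
  open Poly R
  open Domain R _≟_ domain

  degree : ∀ p → ¬ p ≋ [] → ∃[ k ] (¬ coef p k ≈ 0# × (∀ n → k < n → coef p n ≈ 0#))
  degree [] p≉0 = contradiction P.refl p≉0
  degree (c ∷ p) p≉0 with zero? p
  ... | yes p0 = 0 , (λ c0 → p≉0 (∷≋[] c0 p0)) , λ { (suc n) _ → at p0 n }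
  ... | no p≉ with degree p p≉
  ...   | k , nz , z = suc k , nz , λ { (suc n) (s≤s l) → z n l }

  -- From s = q r + ρ follows c + X s = X q r + (c + X ρ). The new remainder can only be too large
  -- at index k, where a multiple a r removes the excess.
  divide : ∀ r k → ¬ coef r k ≈ 0# → (∀ n → k < n → coef r n ≈ 0#) → ∀ s →
           ∃[ q ] ∃[ ρ ] (s ≋ q P.* r P.+ ρ × (∀ n → k ≤ n → coef ρ n ≈ 0#))
  divide r k nz z [] = [] , [] , P.sym (P.trans (P.+-identityʳ _) (P.zeroˡ r)) , λ n _ → refl
  divide r k nz z (c ∷ s) with divide r k nz z s | inverse (coef r k) nz
  ... | q , ρ , s≋ , zρ | i , ri≈1 = C a P.+ X P.* q , (c ∷ ρ) P.- C a P.* r , eq , small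
    where
    a : Carrier
    a = coef (c ∷ ρ) k * i
    eq : c ∷ s ≋ (C a P.+ X P.* q) P.* r P.+ ((c ∷ ρ) P.- C a P.* r)
    eq = P.begin
      c ∷ s                                     P.≈⟨ cons≋ c s ⟩
      C c P.+ X P.* s                           P.≈⟨ P.+-congˡ (P.*-congˡ s≋) ⟩
      C c P.+ X P.* (q P.* r P.+ ρ)             P.≈⟨ P.solve 6 (λ c x q r ρ a → c P.:+ x P.:* (q P.:* r P.:+ ρ) P.:=
          (a P.:+ x P.:* q) P.:* r P.:+ ((c P.:+ x P.:* ρ) P.:- a P.:* r)) P.refl (C c) X q r ρ (C a) ⟩
      (C a P.+ X P.* q) P.* r P.+ ((C c P.+ X P.* ρ) P.- C a P.* r)  P.≈⟨ P.+-congˡ (P.+-congʳ (P.sym (cons≋ c ρ))) ⟩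
      (C a P.+ X P.* q) P.* r P.+ ((c ∷ ρ) P.- C a P.* r)            P.∎
    coef-rem : ∀ n → coef ((c ∷ ρ) P.- C a P.* r) n ≈ coef (c ∷ ρ) n - a * coef r n
    coef-rem n = trans (coef-add (c ∷ ρ) _ n) (+-congˡ (trans (coef-neg (C a P.* r) n) (-‿cong (trans (at (P.sym (scale≋C* a r)) n) (coef-scale a r n)))))
    zcρ : ∀ n → k < n → coef (c ∷ ρ) n ≈ 0#
    zcρ (suc n) (s≤s l) = zρ n l
    small : ∀ n → k ≤ n → coef ((c ∷ ρ) P.- C a P.* r) n ≈ 0#
    small n k≤n with ℕP.m≤n⇒m<n∨m≡n k≤n
    ... | inj₁ k<n = trans (coef-rem n) (trans (+-cong (zcρ n k<n) (trans (-‿cong (trans (*-congˡ (z n k<n)) (zeroʳ a))) -0#≈0#)) (+-identityʳ _))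
    ... | inj₂ ≡.refl = trans (coef-rem k) (trans (+-congˡ (-‿cong (trans (*-assoc _ _ _) (trans (*-congˡ (trans (*-comm i _) ri≈1)) (*-identityʳ _))))) (-‿inverseʳ _))

  -- F[X] is integrally closed: from h = s / r with h² = u and s = q r + ρ one also has h = (u r − q s) / ρ,
  -- so the denominator can be made smaller until r divides s.
  square-root-is-polynomial : ∀ n r s u → (∀ k → n ≤ k → coef r k ≈ 0#) → ¬ r ≋ [] → r P.* r P.* u ≋ s P.* s → ∃[ q ] u ≋ q P.* q
  square-root-is-polynomial zero r s u zr r≉0 e = contradiction (mk≋ λ k → zr k z≤n) r≉0
  square-root-is-polynomial (suc n) r s u zr r≉0 e with degree r r≉0
  ... | k , nz , z with divide r k nz z s
  ...   | q , ρ , s≋ , zρ with zero? ρ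
  ...     | yes ρ0 = q , poly-cancelˡ r r≉0 (poly-cancelˡ r r≉0 (P.begin
    r P.* (r P.* u)              P.≈⟨ P.*-assoc r r u ⟨
    r P.* r P.* u                P.≈⟨ e ⟩
    s P.* s                      P.≈⟨ P.*-cong s≋qr s≋qr ⟩
    (q P.* r) P.* (q P.* r)      P.≈⟨ P.solve 2 (λ q r → (q P.:* r) P.:* (q P.:* r) P.:= r P.:* (r P.:* (q P.:* q))) P.refl q r ⟩
    r P.* (r P.* (q P.* q))      P.∎))
    where
    s≋qr : s ≋ q P.* r
    s≋qr = P.trans s≋ (P.trans (P.+-congˡ ρ0) (P.+-identityʳ _))
  ...     | no ρ≉0 = square-root-is-polynomial n ρ (u P.* r P.- q P.* s) u (λ j n≤j → zρ j (ℕP.≤-trans k≤n n≤j)) ρ≉0 (P.begin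
    ρ P.* ρ P.* u                                                                    P.≈⟨ P.*-congʳ (P.*-cong ρ≋ ρ≋) ⟩
    (s P.- q P.* r) P.* (s P.- q P.* r) P.* u                                        P.≈⟨ P.solve 4 (λ s q r u →
        (s P.:- q P.:* r) P.:* (s P.:- q P.:* r) P.:* u P.:= u P.:* (s P.:* s) P.:- (u P.:* q P.:* r P.:* s P.:+ u P.:* q P.:* r P.:* s) P.:+ q P.:* q P.:* (r P.:* r P.:* u)) P.refl s q r u ⟩
    u P.* (s P.* s) P.- (u P.* q P.* r P.* s P.+ u P.* q P.* r P.* s) P.+ q P.* q P.* (r P.* r P.* u)  P.≈⟨ P.+-cong (P.+-congʳ (P.*-congˡ (P.sym e))) (P.*-congˡ e) ⟩
    u P.* (r P.* r P.* u) P.- (u P.* q P.* r P.* s P.+ u P.* q P.* r P.* s) P.+ q P.* q P.* (s P.* s)  P.≈⟨ P.solve 4 (λ s q r u →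
        u P.:* (r P.:* r P.:* u) P.:- (u P.:* q P.:* r P.:* s P.:+ u P.:* q P.:* r P.:* s) P.:+ q P.:* q P.:* (s P.:* s) P.:= (u P.:* r P.:- q P.:* s) P.:* (u P.:* r P.:- q P.:* s)) P.refl s q r u ⟩
    (u P.* r P.- q P.* s) P.* (u P.* r P.- q P.* s)                                  P.∎)
    where
    k≤n : k ≤ n
    k≤n with k ℕP.≤? n
    ... | yes l = l
    ... | no ¬l = contradiction (zr k (ℕP.≰⇒> ¬l)) nz
    ρ≋ : ρ ≋ s P.- q P.* r
    ρ≋ = P.trans (P.solve 2 (λ a ρ → ρ P.:= (a P.:+ ρ) P.:- a) P.refl (q P.* r) ρ) (P.+-congʳ (P.sym s≋))

-- Underdetermined linear systems

module LinAlg (R : CommutativeRing 0ℓ 0ℓ)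
  (_≟_ : Discrete R)
  (domain : NoZeroDivisors R)
  (1≉0 : Nontrivial R) where
  open Kit R

  module _ {I : Set} (_≟ᴵ_ : (i j : I) → Dec (i ≡ j)) where

    -- Equations are linear functionals on families of unknowns, not matrix rows: Stepanov's
    -- conditions arise as coefficients of polynomials depending linearly on the unknowns.
    Linear : ((I → Carrier) → Carrier) → Set
    Linear φ = ∀ a b c d → φ (λ i → a * c i + b * d i) ≈ a * φ c + b * φ d

    remove : I → List I → List I
    remove i [] = []
    remove i (j ∷ js) with i ≟ᴵ j
    ... | yes _ = js
    ... | no _ = j ∷ remove i js

    length-remove : ∀ i js → length js ≤ suc (length (remove i js))
    length-remove i [] = z≤n
    length-remove i (j ∷ js) with i ≟ᴵ j
    ... | yes _ = ℕP.≤-refl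
    ... | no _ = s≤s (length-remove i js)

    remove-⊆ : ∀ i js {j} → j ∈ remove i js → j ∈ js
    remove-⊆ i (j ∷ js) p with i ≟ᴵ j
    remove-⊆ i (j ∷ js) p | yes _ = there p
    remove-⊆ i (j ∷ js) (here e) | no _ = here e
    remove-⊆ i (j ∷ js) (there p) | no _ = there (remove-⊆ i js p)

    ∉-remove : ∀ i js → Unique js → i ∉ remove i js
    ∉-remove i [] u ()
    ∉-remove i (j ∷ js) u p with i ≟ᴵ j
    ∉-remove i (j ∷ js) u p | yes ≡.refl = Unique[x∷xs]⇒x∉xs u p
    ∉-remove i (j ∷ js) u (here e) | no i≢j = i≢j e
    ∉-remove i (j ∷ js) (_ ∷ u) (there p) | no _ = ∉-remove i js u p

    remove-unique : ∀ i js → Unique js → Unique (remove i js)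
    remove-unique i [] u = []
    remove-unique i (j ∷ js) (n ∷ u) with i ≟ᴵ j
    ... | yes _ = u
    ... | no _ = ¬Any⇒All¬ _ (λ p → All¬⇒¬Any n (remove-⊆ i js p)) ∷ remove-unique i js u

    indicator : I → I → Carrier
    indicator i j with i ≟ᴵ j
    ... | yes _ = 1#
    ... | no _ = 0#

    -- Two solutions of all but one equation, the second vanishing at a coordinate where the first does not,
    -- are combined to satisfy the last equation.
    underdetermined : ∀ {J : Set} (φ : J → (I → Carrier) → Carrier) → (∀ j → Linear (φ j)) →
      ∀ js L → Unique L → length js < length L →
      ∃[ c ] ((∀ i → i ∉ L → c i ≈ 0#) × (∃[ i ] ¬ c i ≈ 0#) × (∀ j → j ∈ js → φ j c ≈ 0#))
    underdetermined φ lin [] (i ∷ L) u l = indicator i , support , (i , nonzero) , λ _ ()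
      where
      support : ∀ k → k ∉ i ∷ L → indicator i k ≈ 0#
      support k k∉ with i ≟ᴵ k
      ... | yes ≡.refl = contradiction (here ≡.refl) k∉
      ... | no _ = refl
      nonzero : ¬ indicator i i ≈ 0#
      nonzero with i ≟ᴵ i
      ... | yes _ = 1≉0
      ... | no i≢i = contradiction ≡.refl i≢i
    underdetermined {J} φ lin (j ∷ js) L u l with underdetermined φ lin js L u (ℕP.<-trans ℕP.≤-refl l)
    ... | c , sc , (i , ci≉0) , zc with underdetermined φ lin js (remove i L) (remove-unique i L u) (ℕP.≤-pred (ℕP.≤-trans l (length-remove i L)))
    ...   | d , sd , (k , dk≉0) , zd with φ j d ≟ 0#
    ...     | yes φd≈0 = d , (λ m m∉ → sd m (λ p → m∉ (remove-⊆ i L p))) , (k , dk≉0) , λ { _ (here ≡.refl) → φd≈0 ; _ (there p) → zd _ p }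
    ...     | no φd≉0 = (λ m → φ j c * d m + - φ j d * c m) , support , (i , nonzero) , zeros
      where
      lc0 : ∀ {x y z w} → y ≈ 0# → w ≈ 0# → x * y + z * w ≈ 0#
      lc0 e f = trans (+-cong (trans (*-congˡ e) (zeroʳ _)) (trans (*-congˡ f) (zeroʳ _))) (+-identityʳ _)
      support : ∀ m → m ∉ L → φ j c * d m + - φ j d * c m ≈ 0#
      support m m∉ = lc0 (sd m (λ p → m∉ (remove-⊆ i L p))) (sc m m∉)
      nonzero : ¬ φ j c * d i + - φ j d * c i ≈ 0#
      nonzero e with domain (φ j d) (c i) (trans (solve 3 (λ a b x → a :* b := x :- (x :+ :- a :* b)) refl (φ j d) (c i) (φ j c * d i))
        (trans (+-cong (trans (*-congˡ (sd i (∉-remove i L u))) (zeroʳ _)) (trans (-‿cong e) -0#≈0#)) (+-identityʳ _)))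
      ... | inj₁ a = φd≉0 a
      ... | inj₂ b = ci≉0 b
      zeros : ∀ k → k ∈ j ∷ js → φ k (λ m → φ j c * d m + - φ j d * c m) ≈ 0#
      zeros _ (here ≡.refl) = trans (lin j _ _ d c) (solve 2 (λ a b → a :* b :+ :- b :* a := con (ℤ.+ 0)) refl (φ j c) (φ j d))
      zeros k (there p) = trans (lin k _ _ d c) (lc0 (zd k p) (zc k p))

-- q-th powers in characteristic q, and Fermat's little theorem

module Frobenius (R : CommutativeRing 0ℓ 0ℓ)
  (domain : NoZeroDivisors R) where
  open Morphism
  open Kit R
  open Poly R

  P-ι : ∀ i → P.ι i ≋ C (ι i)
  P-ι i = P.sym (Hom.ι-hom (C-Hom R) i)

  shift : ℕ → List Carrier → List Carrier
  shift zero p = p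
  shift (suc n) p = 0# ∷ shift n p

  X^*≋shift : ∀ n p → X P.^ n P.* p ≋ shift n p
  X^*≋shift zero p = P.*-identityˡ p
  X^*≋shift (suc n) p = P.trans (P.*-assoc X _ p) (P.trans (P.*-congˡ (X^*≋shift n p)) (X* _))

  length-shift : ∀ n p → length (shift n p) ≡ n ℕ.+ length p
  length-shift zero p = ≡.refl
  length-shift (suc n) p = ≡.cong suc (length-shift n p)

  coef-shift-< : ∀ n p k → k < n → coef (shift n p) k ≈ 0#
  coef-shift-< (suc n) p zero l = refl
  coef-shift-< (suc n) p (suc k) (s≤s l) = coef-shift-< n p k l

  shift≋[] : ∀ n p → shift n p ≋ [] → p ≋ []
  shift≋[] zero p e = e
  shift≋[] (suc n) p e = shift≋[] n p (≋[]⇒tail e)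

  coef0-^ : ∀ p n → coef (p P.^ n) 0 ≈ coef p 0 ^ n
  coef0-^ p zero = refl
  coef0-^ p (suc n) = trans (coef-mul p _ 0) (*-congˡ (coef0-^ p n))

  1^ : ∀ n → 1# ^ n ≈ 1#
  1^ zero = refl
  1^ (suc n) = trans (*-identityˡ _) (1^ n)

  coef-^-beyond : ∀ c n k → n < k → coef ((c ∷ 1# ∷ []) P.^ n) k ≈ 0#
  coef-^-beyond c zero (suc k) l = refl
  coef-^-beyond c (suc n) k l = trans (coef-mul (c ∷ 1# ∷ []) ((c ∷ 1# ∷ []) P.^ n) k) (mul-deg 1 n _ _ (λ { (suc zero) (s≤s ()) ; (suc (suc m)) _ → refl }) (coef-^-beyond c n) k l)

  coef-^-top : ∀ c n → coef ((c ∷ 1# ∷ []) P.^ n) n ≈ 1#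
  coef-^-top c zero = refl
  coef-^-top c (suc n) = trans (coef-mul (c ∷ 1# ∷ []) ((c ∷ 1# ∷ []) P.^ n) (suc n))
    (trans (mul-top 1 n (coef (c ∷ 1# ∷ [])) (coef ((c ∷ 1# ∷ []) P.^ n)) (λ { (suc zero) (s≤s ()) ; (suc (suc m)) _ → refl }) (coef-^-beyond c n)) (trans (*-identityˡ _) (coef-^-top c n)))

  module _ (q q-1 : ℕ) (q≡ : q ≡ suc q-1) (char : ι (+ q) ≈ 0#) (char< : ∀ i → suc i < q → ¬ ι (+ suc i) ≈ 0#) where

    D-^q : ∀ p → D (p P.^ q) ≋ []
    D-^q p = ≡.subst (λ n → D (p P.^ n) ≋ []) (≡.sym q≡) (P.trans (D-^ p q-1) (P.trans (P.*-congʳ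
      (P.trans (P-ι (+ suc q-1)) (P.trans (C-cong (≡.subst (λ n → ι (+ n) ≈ 0#) q≡ char)) C-0))) (P.zeroˡ _)))

    -- Only the exponents divisible by q survive in a q-th power, since its derivative vanishes.
    coef-^q : ∀ p n → suc n < q → coef (p P.^ q) (suc n) ≈ 0#
    coef-^q p n l with domain (ι (+ suc n)) (coef (p P.^ q) (suc n)) (trans (sym (coef-D (p P.^ q) n)) (at (D-^q p) n))
    ... | inj₁ a = contradiction a (char< n l)
    ... | inj₂ b = b

    0^q : 0# ^ q ≈ 0#
    0^q = ≡.subst (λ n → 0# ^ n ≈ 0#) (≡.sym q≡) (zeroˡ _)

    -- Both sides are values of polynomials, (1 + X)^q and 1 + X^q. Strictly between 0 and q the
    -- coefficients of a q-th power vanish, and the two ends are computed directly, so binomial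
    -- coefficients do not enter.
    freshman : ∀ x → (1# + x) ^ q ≈ 1# + x ^ q
    freshman x = begin
      (1# + x) ^ q                              ≈⟨ ^-congˡ q (trans (+-congˡ (sym (trans (*-congˡ (eval-C x 1#)) (*-identityʳ x)))) refl) ⟩
      eval x (1# ∷ 1# ∷ []) ^ q                 ≈⟨ eval-^ x (1# ∷ 1# ∷ []) q ⟨
      eval x ((1# ∷ 1# ∷ []) P.^ q)             ≈⟨ eval-cong x {(1# ∷ 1# ∷ []) P.^ q} {P.1# P.+ X P.^ q} (mk≋ λ n → trans (same n) (sym (coef-add P.1# (X P.^ q) n))) ⟩
      eval x (P.1# P.+ X P.^ q)                 ≈⟨ eval-+ x P.1# _ ⟩
      eval x P.1# + eval x (X P.^ q)            ≈⟨ +-cong (eval-C x 1#) (trans (eval-^ x X q) (^-congˡ q (eval-X x))) ⟩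
      1# + x ^ q                                ∎
      where
      same : ∀ n → coef ((1# ∷ 1# ∷ []) P.^ q) n ≈ coef P.1# n + coef (X P.^ q) n
      same zero = trans (coef0-^ (1# ∷ 1# ∷ []) q) (trans (1^ q) (sym (trans (+-congˡ (trans (coef0-^ X q) 0^q)) (+-identityʳ _))))
      same (suc n) with ℕP.<-cmp (suc n) q
      ... | tri< l _ _ = trans (coef-^q _ n l) (sym (trans (+-identityˡ _) (coef-^q X n l)))
      ... | tri≈ _ ≡.refl _ = trans (coef-^-top 1# (suc n)) (sym (trans (+-identityˡ _) (coef-^-top 0# (suc n))))
      ... | tri> _ _ g = trans (coef-^-beyond 1# q (suc n) g) (sym (trans (+-identityˡ _) (coef-^-beyond 0# q (suc n) g)))

    fermat-ι : ∀ n → ι (+ n) ^ q ≈ ι (+ n)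
    fermat-ι zero = 0^q
    fermat-ι (suc n) = trans (freshman (ι (+ n))) (+-congˡ (fermat-ι n))

-- Stepanov's auxiliary polynomial

module Stepanov (R : CommutativeRing 0ℓ 0ℓ)
  (_≟_ : Discrete R)
  (domain : NoZeroDivisors R)
  (1≉0 : Nontrivial R) where
  open Kit R
  open Poly R
  open Domain R _≟_ domain
  open LinAlg R _≟_ domain 1≉0
  open Frobenius R domain hiding (D-^q; coef-^q; 0^q; freshman; fermat-ι)

  length-cartesianProduct : ∀ {A B : Set} (xs : List A) (ys : List B) → length (cartesianProduct xs ys) ≡ length xs ℕ.* length ys
  length-cartesianProduct [] ys = ≡.refl
  length-cartesianProduct (x ∷ xs) ys = ≡.trans (ListP.length-++ (map (x ,_) ys)) (≡.cong₂ ℕ._+_ (ListP.length-map (x ,_) ys) (length-cartesianProduct xs ys))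

  -- The sum of r_j Y^j over j < J. The auxiliary polynomial takes Y = X^q; at a point with x^q = x
  -- this may be exchanged for Y = X.
  horner : List Carrier → ℕ → (ℕ → List Carrier) → List Carrier
  horner Y zero r = []
  horner Y (suc J) r = r 0 P.+ Y P.* horner Y J (r ∘ suc)

  module _ (Y : List Carrier) where
    horner-cong : ∀ J {r s : ℕ → List Carrier} → (∀ j → r j ≋ s j) → horner Y J r ≋ horner Y J s
    horner-cong zero e = P.refl
    horner-cong (suc J) e = P.+-cong (e 0) (P.*-congˡ (horner-cong J (e ∘ suc)))

    horner-+ : ∀ J (r s : ℕ → List Carrier) → horner Y J (λ j → r j P.+ s j) ≋ horner Y J r P.+ horner Y J s
    horner-+ zero r s = P.sym (P.+-identityˡ _)
    horner-+ (suc J) r s = P.trans (P.+-congˡ (P.*-congˡ (horner-+ J (r ∘ suc) (s ∘ suc))))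
      (P.solve 5 (λ a b y c d → (a P.:+ b) P.:+ y P.:* (c P.:+ d) P.:= (a P.:+ y P.:* c) P.:+ (b P.:+ y P.:* d)) P.refl (r 0) (s 0) Y _ _)

    horner-* : ∀ J w (r : ℕ → List Carrier) → horner Y J (λ j → w P.* r j) ≋ w P.* horner Y J r
    horner-* zero w r = P.sym (P.zeroʳ w)
    horner-* (suc J) w r = P.trans (P.+-congˡ (P.*-congˡ (horner-* J w (r ∘ suc))))
      (P.solve 4 (λ a w y c → w P.:* a P.:+ y P.:* (w P.:* c) P.:= w P.:* (a P.:+ y P.:* c)) P.refl (r 0) w Y _)

    -- A polynomial with zero derivative, such as X^q, is a constant for `D`.
    D-horner : D Y ≋ [] → ∀ J r → D (horner Y J r) ≋ horner Y J (D ∘ r)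
    D-horner DY zero r = P.refl
    D-horner DY (suc J) r = P.trans (D-+ (r 0) _) (P.+-congˡ (P.trans (D-* Y _) (P.trans (P.+-congʳ (P.trans (P.*-congʳ DY) (P.zeroˡ _)))
      (P.trans (P.+-identityˡ _) (P.*-congˡ (D-horner DY J (r ∘ suc)))))))

  eval-horner : ∀ x Y Z → eval x Y ≈ eval x Z → ∀ J r → eval x (horner Y J r) ≈ eval x (horner Z J r)
  eval-horner x Y Z e zero r = refl
  eval-horner x Y Z e (suc J) r = trans (eval-+ x (r 0) _) (trans (+-congˡ (trans (eval-* x Y _) (trans (*-cong e (eval-horner x Y Z e J (r ∘ suc))) (sym (eval-* x Z _)))))
    (sym (eval-+ x (r 0) _)))

  -- The factor 2 is crude: each multiplication by X is charged with both entries of its list.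
  length-hornerX : ∀ l J (r : ℕ → List Carrier) → (∀ j → length (r j) ≤ l) → length (horner X J r) ≤ l ℕ.+ 2 ℕ.* J
  length-hornerX l zero r h = z≤n
  length-hornerX l (suc J) r h = length-add (r 0) _ (ℕP.≤-trans (h 0) (ℕP.m≤m+n l _))
    (ℕP.≤-trans (length-mul X _) (ℕP.≤-trans (s≤s (s≤s (length-hornerX l J (r ∘ suc) (h ∘ suc)))) (ℕP.≤-reflexive (eq l J))))
    where
    eq : ∀ l J → 2 ℕ.+ (l ℕ.+ 2 ℕ.* J) ≡ l ℕ.+ 2 ℕ.* (1 ℕ.+ J)
    eq = solve-∀

  -- The case Y = X^q again, but by shifting lists. The general length bounds would charge X^q with
  -- about 2q entries, and the final count cannot afford that factor.
  horner-shift : ℕ → ℕ → (ℕ → List Carrier) → List Carrier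
  horner-shift q zero r = []
  horner-shift q (suc J) r = r 0 P.+ shift q (horner-shift q J (r ∘ suc))

  horner-shift≋ : ∀ q J r → horner-shift q J r ≋ horner (X P.^ q) J r
  horner-shift≋ q zero r = P.refl
  horner-shift≋ q (suc J) r = P.+-congˡ (P.trans (P.sym (X^*≋shift q _)) (P.*-congˡ (horner-shift≋ q J (r ∘ suc))))

  length-horner-shift : ∀ l q J (r : ℕ → List Carrier) → (∀ j → length (r j) ≤ l) → length (horner-shift q J r) ≤ l ℕ.+ J ℕ.* q
  length-horner-shift l q zero r h = z≤n
  length-horner-shift l q (suc J) r h = length-add (r 0) _ (ℕP.≤-trans (h 0) (ℕP.m≤m+n l _))
    (ℕP.≤-trans (ℕP.≤-reflexive (length-shift q _)) (ℕP.≤-trans (ℕP.+-monoʳ-≤ q (length-horner-shift l q J (r ∘ suc) (h ∘ suc)))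
     (ℕP.≤-reflexive (≡.trans (≡.sym (ℕP.+-assoc q l _)) (≡.trans (≡.cong (ℕ._+ J ℕ.* q) (ℕP.+-comm q l)) (ℕP.+-assoc l q _))))))

  length-^ : ∀ μ p n → length p ≤ μ → length (p P.^ n) ≤ suc (n ℕ.* μ)
  length-^ μ p zero h = s≤s z≤n
  length-^ μ p (suc n) h = ℕP.≤-trans (length-mul p _) (ℕP.≤-trans (ℕP.+-mono-≤ h (length-^ μ p n h)) (ℕP.≤-reflexive (ℕP.+-suc μ _)))

  module Auxiliary (q e : ℕ) (q≡ : q ≡ suc (e ℕ.+ e)) (char : ι (+ q) ≈ 0#) (char< : ∀ i → suc i < q → ¬ ι (+ suc i) ≈ 0#)
    (u : List Carrier) (u₀^q : coef u 0 ^ q ≈ coef u 0)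
    (nonsquare : ∀ r s → r P.* r P.* u ≋ C (coef u 0) P.* (s P.* s) → r ≋ [] × s ≋ [])
    (μ : ℕ) (length-u : length u ≤ μ) (1≤μ : 1 ≤ μ) where

    g : List Carrier
    g = u P.^ e

    private
      u₀ = coef u 0
      Xq = X P.^ q
      D-Xq = Frobenius.D-^q R domain q (e ℕ.+ e) q≡ char char< X

    infix 4 _≡q_
    record _≡q_ (p p′ : List Carrier) : Set where
      constructor mk≡q
      field below : ∀ n → n < q → coef p n ≈ coef p′ n
    open _≡q_

    ≡q-* : ∀ {p p′ r r′} → p ≡q p′ → r ≡q r′ → p P.* r ≡q p′ P.* r′
    ≡q-* {p} {p′} {r} {r′} a b = mk≡q λ n l → trans (coef-mul p r n) (trans
      (mul-cong-≤ n (λ k k≤n → below a k (ℕP.≤-<-trans k≤n l)) (λ k k≤n → below b k (ℕP.≤-<-trans k≤n l)))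
      (sym (coef-mul p′ r′ n)))

    ≡q-refl : ∀ {p} → p ≡q p
    ≡q-refl = mk≡q λ _ _ → refl

    u^q≡q : u P.^ q ≡q C u₀
    u^q≡q = mk≡q λ { zero l → trans (coef0-^ u q) u₀^q ; (suc n) l → Frobenius.coef-^q R domain q (e ℕ.+ e) q≡ char char< u n l }

    +Xq*≡q : ∀ p w → p P.+ Xq P.* w ≡q p
    +Xq*≡q p w = mk≡q λ n l → trans (coef-add p _ n) (trans (+-congˡ (trans (at (X^*≋shift q w) n) (coef-shift-< q w n l))) (+-identityʳ _))

    -- Squaring A = - B g and multiplying by u turns g² u into u^q, because q = 2e + 1. The bound on
    -- L upgrades the resulting congruence for the lowest pair to an equality. Once that pair is
    -- zero, X^q divides the rest and the next pair becomes the lowest.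
    nonvanishing : ∀ L J r s → L ℕ.+ L ℕ.+ μ ≤ q → (∀ j → length (r j) ≤ L) → (∀ j → length (s j) ≤ L) →
      horner Xq J r P.+ horner Xq J s P.* g ≋ [] → ∀ j → j < J → r j ≋ [] × s j ≋ []
    nonvanishing L (suc J) r s Lq lr ls z = λ where
        zero _ → both
        (suc j) (s≤s l) → nonvanishing L J (r ∘ suc) (s ∘ suc) Lq (lr ∘ suc) (ls ∘ suc) rest j l
      where
      A = horner Xq (suc J) r
      B = horner Xq (suc J) s
      A′ = horner Xq J (r ∘ suc)
      B′ = horner Xq J (s ∘ suc)
      A≋ : A ≋ P.- (B P.* g)
      A≋ = P.trans (P.solve 2 (λ a b → a P.:= (a P.:+ b) P.:- b) P.refl A (B P.* g)) (P.trans (P.+-congʳ z) (P.+-identityˡ _))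
      g²u : g P.* g P.* u ≋ u P.^ q
      g²u = ≡.subst (λ n → g P.* g P.* u ≋ u P.^ n) (≡.sym q≡) (P.trans (P.*-congʳ (P.sym (P.^-homo-* u e e))) (P.*-comm _ u))
      A²u : A P.* A P.* u ≋ B P.* B P.* u P.^ q
      A²u = P.begin
        A P.* A P.* u                                       P.≈⟨ P.*-congʳ (P.*-cong A≋ A≋) ⟩
        (P.- (B P.* g)) P.* (P.- (B P.* g)) P.* u           P.≈⟨ P.solve 3 (λ b g u → (P.:- (b P.:* g)) P.:* (P.:- (b P.:* g)) P.:* u P.:= b P.:* b P.:* (g P.:* g P.:* u)) P.refl B g u ⟩
        B P.* B P.* (g P.* g P.* u)                         P.≈⟨ P.*-congˡ g²u ⟩
        B P.* B P.* u P.^ q                                 P.∎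
      small : ∀ n → n < q → coef (r 0 P.* r 0 P.* u) n ≈ coef (C u₀ P.* (s 0 P.* s 0)) n
      small n l = begin
        coef (r 0 P.* r 0 P.* u) n             ≈⟨ below (≡q-* (≡q-* (+Xq*≡q (r 0) A′) (+Xq*≡q (r 0) A′)) (≡q-refl {u})) n l ⟨
        coef (A P.* A P.* u) n                 ≈⟨ at A²u n ⟩
        coef (B P.* B P.* u P.^ q) n           ≈⟨ below (≡q-* (≡q-* (+Xq*≡q (s 0) B′) (+Xq*≡q (s 0) B′)) u^q≡q) n l ⟩
        coef (s 0 P.* s 0 P.* C u₀) n          ≈⟨ at (P.*-comm (s 0 P.* s 0) (C u₀)) n ⟩
        coef (C u₀ P.* (s 0 P.* s 0)) n        ∎
      L2 : ∀ p p′ → length p ≤ L → length p′ ≤ L → length (p P.* p′) ≤ L ℕ.+ L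
      L2 p p′ a b = ℕP.≤-trans (length-mul p p′) (ℕP.+-mono-≤ a b)
      big₁ : length (r 0 P.* r 0 P.* u) ≤ q
      big₁ = ℕP.≤-trans (length-mul (r 0 P.* r 0) u) (ℕP.≤-trans (ℕP.+-mono-≤ (L2 _ _ (lr 0) (lr 0)) length-u) Lq)
      big₂ : length (C u₀ P.* (s 0 P.* s 0)) ≤ q
      big₂ = ℕP.≤-trans (length-mul (C u₀) _) (ℕP.≤-trans (ℕP.+-mono-≤ 1≤μ (L2 _ _ (ls 0) (ls 0))) (ℕP.≤-trans (ℕP.≤-reflexive (ℕP.+-comm μ _)) Lq))
      square : r 0 P.* r 0 P.* u ≋ C u₀ P.* (s 0 P.* s 0)
      square = mk≋ λ n → case n
        where
        case : ∀ n → _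
        case n with n ℕP.<? q
        ... | yes l = small n l
        ... | no ¬l = trans (coef-≥length (r 0 P.* r 0 P.* u) n (ℕP.≤-trans big₁ (ℕP.≮⇒≥ ¬l))) (sym (coef-≥length (C u₀ P.* (s 0 P.* s 0)) n (ℕP.≤-trans big₂ (ℕP.≮⇒≥ ¬l))))
      both : r 0 ≋ [] × s 0 ≋ []
      both = nonsquare (r 0) (s 0) square
      rest : A′ P.+ B′ P.* g ≋ []
      rest = shift≋[] q _ (P.trans (P.sym (X^*≋shift q _)) (P.begin
        Xq P.* (A′ P.+ B′ P.* g)                                      P.≈⟨ P.solve 4 (λ y a b g → y P.:* (a P.:+ b P.:* g) P.:= (P.con (+ 0) P.:+ y P.:* a) P.:+ (P.con (+ 0) P.:+ y P.:* b) P.:* g) P.refl Xq A′ B′ g ⟩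
        ([] P.+ Xq P.* A′) P.+ ([] P.+ Xq P.* B′) P.* g               P.≈⟨ P.+-cong (P.+-congʳ (proj₁ both)) (P.*-congʳ (P.+-congʳ (proj₂ both))) ⟨
        A P.+ B P.* g                                                 P.≈⟨ z ⟩
        []                                                            P.∎))

    -- The operator that differentiation induces on the cofactor of u^k: the derivative of u^k r is
    -- u^(k-1) times `T k r`.
    T : ℕ → List Carrier → List Carrier
    T k r = scale (ι (+ k)) (D u P.* r) P.+ u P.* D r

    T≋ : ∀ k r → T k r ≋ C (ι (+ k)) P.* (D u P.* r) P.+ u P.* D r
    T≋ k r = P.+-congʳ (scale≋C* _ _)

    T-cong : ∀ k {r s} → r ≋ s → T k r ≋ T k s
    T-cong k {r} {s} e = P.trans (T≋ k r) (P.trans (P.+-cong (P.*-congˡ (P.*-congˡ e)) (P.*-congˡ (D-cong e))) (P.sym (T≋ k s)))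

    T-linear : ∀ k a b r s → T k (C a P.* r P.+ C b P.* s) ≋ C a P.* T k r P.+ C b P.* T k s
    T-linear k a b r s = P.begin
      T k (C a P.* r P.+ C b P.* s)                                P.≈⟨ T≋ k _ ⟩
      K P.* (D u P.* (C a P.* r P.+ C b P.* s)) P.+ u P.* D (C a P.* r P.+ C b P.* s)
          P.≈⟨ P.+-congˡ (P.*-congˡ (P.trans (D-+ _ _) (P.+-cong (D-C* a r) (D-C* b s)))) ⟩
      K P.* (D u P.* (C a P.* r P.+ C b P.* s)) P.+ u P.* (C a P.* D r P.+ C b P.* D s)
          P.≈⟨ P.solve 9 (λ k v a r b s u r′ s′ → k P.:* (v P.:* (a P.:* r P.:+ b P.:* s)) P.:+ u P.:* (a P.:* r′ P.:+ b P.:* s′) P.:=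
             a P.:* (k P.:* (v P.:* r) P.:+ u P.:* r′) P.:+ b P.:* (k P.:* (v P.:* s) P.:+ u P.:* s′)) P.refl K (D u) (C a) r (C b) s u (D r) (D s) ⟩
      C a P.* (K P.* (D u P.* r) P.+ u P.* D r) P.+ C b P.* (K P.* (D u P.* s) P.+ u P.* D s)
          P.≈⟨ P.+-cong (P.*-congˡ (T≋ k r)) (P.*-congˡ (T≋ k s)) ⟨
      C a P.* T k r P.+ C b P.* T k s                              P.∎
      where K = C (ι (+ k))

    length-T : ∀ k r → length (T k r) ≤ length r ℕ.+ μ
    length-T k r = length-add (scale _ _) _
      (ℕP.≤-trans (ℕP.≤-reflexive (length-map _ (D u P.* r))) (ℕP.≤-trans (length-mul (D u) r)
        (ℕP.≤-trans (ℕP.≤-reflexive (ℕP.+-comm _ (length r))) (ℕP.+-monoʳ-≤ (length r) (ℕP.≤-trans (length-D u) length-u)))))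
      (ℕP.≤-trans (length-mul u (D r)) (ℕP.≤-trans (ℕP.≤-reflexive (ℕP.+-comm (length u) _)) (ℕP.+-mono-≤ (length-D r) length-u)))

    -- The extra factor u restores the exponent n, so that the formula also makes sense for n = 0.
    u*D-^ : ∀ n → u P.* D (u P.^ n) ≋ C (ι (+ n)) P.* (D u P.* u P.^ n)
    u*D-^ zero = P.trans (P.*-congˡ (D-C 1#)) (P.trans (P.zeroʳ u) (P.sym (P.trans (P.*-congʳ C-0) (P.zeroˡ _))))
    u*D-^ (suc n) = P.trans (P.*-congˡ (P.trans (D-^ u n) (P.*-congʳ (P-ι (+ suc n)))))
      (P.solve 4 (λ u k v w → u P.:* (k P.:* (v P.:* w)) P.:= k P.:* (v P.:* (u P.:* w))) P.refl u (C (ι (+ suc n))) (D u) (u P.^ n))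

    -- The r_j differentiate as cofactors of u^(k+1), the s_j as cofactors of u^(k+1+e). Writing
    -- `suc k + 0` gives both halves the same shape.
    D-step : ∀ J k r s → D (u P.^ suc k P.* (horner Xq J r P.+ horner Xq J s P.* g)) ≋
             u P.^ k P.* (horner Xq J (λ j → T (suc k ℕ.+ 0) (r j)) P.+ horner Xq J (λ j → T (suc k ℕ.+ e) (s j)) P.* g)
    D-step J k r s = P.begin
      D (u P.^ suc k P.* (A P.+ B P.* g))
        P.≈⟨ D-* _ _ ⟩
      D (u P.^ suc k) P.* (A P.+ B P.* g) P.+ u P.^ suc k P.* D (A P.+ B P.* g)
        P.≈⟨ P.+-cong (P.*-congʳ (P.trans (D-^ u k) (P.*-congʳ (P-ι (+ suc k))))) (P.*-congˡ (P.trans (D-+ A _) (P.+-cong (D-horner Xq D-Xq J r) (P.trans (D-* B g) (P.+-congʳ (P.*-congʳ (D-horner Xq D-Xq J s))))))) ⟩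
      K P.* (v P.* w) P.* (A P.+ B P.* g) P.+ (u P.* w) P.* (A′ P.+ (B′ P.* g P.+ B P.* D g))
        P.≈⟨ P.solve 10 (λ K v w A B g u A′ B′ g′ → K P.:* (v P.:* w) P.:* (A P.:+ B P.:* g) P.:+ (u P.:* w) P.:* (A′ P.:+ (B′ P.:* g P.:+ B P.:* g′)) P.:=
            w P.:* ((K P.:* (v P.:* A) P.:+ u P.:* A′) P.:+ ((K P.:* (v P.:* B) P.:+ u P.:* B′) P.:* g P.:+ B P.:* (u P.:* g′)))) P.refl K v w A B g u A′ B′ (D g) ⟩
      w P.* ((K P.* (v P.* A) P.+ u P.* A′) P.+ ((K P.* (v P.* B) P.+ u P.* B′) P.* g P.+ B P.* (u P.* D g)))
        P.≈⟨ P.*-congˡ (P.+-congˡ (P.+-congˡ (P.*-congˡ (u*D-^ e)))) ⟩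
      w P.* ((K P.* (v P.* A) P.+ u P.* A′) P.+ ((K P.* (v P.* B) P.+ u P.* B′) P.* g P.+ B P.* (C (ι (+ e)) P.* (v P.* g))))
        P.≈⟨ P.solve 10 (λ K v w A B g u A′ B′ E → w P.:* ((K P.:* (v P.:* A) P.:+ u P.:* A′) P.:+ ((K P.:* (v P.:* B) P.:+ u P.:* B′) P.:* g P.:+ B P.:* (E P.:* (v P.:* g)))) P.:=
            w P.:* ((K P.:* (v P.:* A) P.:+ u P.:* A′) P.:+ ((K P.:+ E) P.:* (v P.:* B) P.:+ u P.:* B′) P.:* g)) P.refl K v w A B g u A′ B′ (C (ι (+ e))) ⟩
      w P.* ((K P.* (v P.* A) P.+ u P.* A′) P.+ ((K P.+ C (ι (+ e))) P.* (v P.* B) P.+ u P.* B′) P.* g)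
        P.≈⟨ P.*-congˡ (P.+-cong (P.trans (P.+-congʳ (P.*-congʳ (C-cong (reflexive (≡.cong (λ n → ι (+ suc n)) (≡.sym (ℕP.+-identityʳ k))))))) (horner-T (suc k ℕ.+ 0) r))
             (P.*-congʳ (P.trans (P.+-congʳ (P.*-congʳ (P.trans (P.sym (C-+ _ _)) (C-cong (sym (ι-+ (+ suc k) (+ e))))))) (horner-T (suc k ℕ.+ e) s)))) ⟩
      w P.* (horner Xq J (λ j → T (suc k ℕ.+ 0) (r j)) P.+ horner Xq J (λ j → T (suc k ℕ.+ e) (s j)) P.* g) P.∎
      where
      A = horner Xq J r
      B = horner Xq J s
      A′ = horner Xq J (D ∘ r)
      B′ = horner Xq J (D ∘ s)
      K = C (ι (+ suc k))
      v = D u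
      w = u P.^ k
      horner-T : ∀ k r → C (ι (+ k)) P.* (v P.* horner Xq J r) P.+ u P.* horner Xq J (D ∘ r) ≋ horner Xq J (λ j → T k (r j))
      horner-T k r = P.sym (P.trans (horner-cong Xq J (λ j → T≋ k (r j))) (P.trans (horner-+ Xq J _ _)
        (P.+-cong (P.trans (horner-* Xq J _ _) (P.*-congˡ (horner-* Xq J _ _))) (horner-* Xq J _ _))))

    module _ (M : ℕ) where
      -- The offset o is 0 for the r_j and e for the s_j; after i derivatives of a multiple of
      -- u^(M+o) the exponent has come down to M - i + o.
      iter : ℕ → ℕ → List Carrier → List Carrier
      iter o zero r = r
      iter o (suc i) r = T (M ℕ.∸ i ℕ.+ o) (iter o i r)

      iter-cong : ∀ o i {r s} → r ≋ s → iter o i r ≋ iter o i s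
      iter-cong o zero e = e
      iter-cong o (suc i) e = T-cong (M ℕ.∸ i ℕ.+ o) (iter-cong o i e)

      iter-linear : ∀ o i a b r s → iter o i (C a P.* r P.+ C b P.* s) ≋ C a P.* iter o i r P.+ C b P.* iter o i s
      iter-linear o zero a b r s = P.refl
      iter-linear o (suc i) a b r s = P.trans (T-cong (M ℕ.∸ i ℕ.+ o) (iter-linear o i a b r s)) (T-linear (M ℕ.∸ i ℕ.+ o) a b _ _)

      -- Growth by only μ per derivative, thanks to the factor u^M kept outside, is what keeps the
      -- number of conditions close to M L.
      length-iter : ∀ o i r → length (iter o i r) ≤ length r ℕ.+ i ℕ.* μ
      length-iter o zero r = ℕP.m≤m+n _ 0
      length-iter o (suc i) r = ℕP.≤-trans (length-T (M ℕ.∸ i ℕ.+ o) _) (ℕP.≤-trans (ℕP.+-monoˡ-≤ μ (length-iter o i r))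
        (ℕP.≤-reflexive (≡.trans (ℕP.+-assoc (length r) _ _) (≡.cong (length r ℕ.+_) (ℕP.+-comm (i ℕ.* μ) μ)))))

      Dⁿ-aux : ∀ J r s i → i ≤ M → Dⁿ i (u P.^ M P.* (horner Xq J r P.+ horner Xq J s P.* g)) ≋
        u P.^ (M ℕ.∸ i) P.* (horner Xq J (iter 0 i ∘ r) P.+ horner Xq J (iter e i ∘ s) P.* g)
      Dⁿ-aux J r s zero _ = P.refl
      Dⁿ-aux J r s (suc i) i<M = P.trans (D-cong (Dⁿ-aux J r s i (ℕP.<⇒≤ i<M))) (step (M ℕ.∸ i) (M ℕ.∸ suc i) M∸i)
        where
        M∸i : M ℕ.∸ i ≡ suc (M ℕ.∸ suc i)
        M∸i = ℕP.+-∸-assoc 1 i<M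
        step : ∀ k k′ → k ≡ suc k′ → D (u P.^ k P.* (horner Xq J (iter 0 i ∘ r) P.+ horner Xq J (iter e i ∘ s) P.* g)) ≋
          u P.^ k′ P.* (horner Xq J (λ j → T (k ℕ.+ 0) (iter 0 i (r j))) P.+ horner Xq J (λ j → T (k ℕ.+ e) (iter e i (s j))) P.* g)
        step _ k′ ≡.refl = D-step J k′ _ _

      module _ (L J : ℕ) (a : Carrier) where
        Index : Set
        Index = Bool × ℕ × ℕ

        coeffs : Bool → (Index → Carrier) → ℕ → List Carrier
        coeffs b c j = tab L (λ n → c (b , j , n))

        tab-linear : ∀ L a b p q → tab L (λ n → a * p n + b * q n) ≋ C a P.* tab L p P.+ C b P.* tab L q
        tab-linear L a b p q = P.trans (go L p q) (P.+-cong (scale≋C* a _) (scale≋C* b _))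
          where
          go : ∀ L p q → tab L (λ n → a * p n + b * q n) ≋ scale a (tab L p) P.+ scale b (tab L q)
          go zero p q = P.sym (P.+-identityˡ _)
          go (suc L) p q = P.trans (∷-cong refl (go L (tl p) (tl q))) (P.reflexive (≡.sym (add-∷ _ _ _ _)))

        -- At a point with x^q = x and u(x)^e = a, the i-th derivative of the auxiliary polynomial
        -- is u(x)^(M-i) times the value of this polynomial: X^q has become X, and u^e has become a.
        -- Its degree is small, so requiring it to vanish identically costs few equations and serves
        -- all such points at once.
        condition : ℕ → (Index → Carrier) → List Carrier
        condition i c = horner X J (iter 0 i ∘ coeffs false c) P.+ scale a (horner X J (iter e i ∘ coeffs true c))

        horner-linear : ∀ o i bl x y c d → horner X J (iter o i ∘ coeffs bl (λ k → x * c k + y * d k)) ≋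
          C x P.* horner X J (iter o i ∘ coeffs bl c) P.+ C y P.* horner X J (iter o i ∘ coeffs bl d)
        horner-linear o i bl x y c d = P.trans (horner-cong X J (λ j → P.trans (iter-cong o i (tab-linear L x y _ _)) (iter-linear o i x y _ _)))
          (P.trans (horner-+ X J _ _) (P.+-cong (horner-* X J _ _) (horner-* X J _ _)))

        condition-linear : ∀ i x y c d → condition i (λ k → x * c k + y * d k) ≋ C x P.* condition i c P.+ C y P.* condition i d
        condition-linear i x y c d = P.begin
          condition i (λ k → x * c k + y * d k)      P.≈⟨ P.+-cong (horner-linear 0 i false x y c d) (P.trans (scale≋C* a _) (P.*-congˡ (horner-linear e i true x y c d))) ⟩
          (C x P.* R₁ P.+ C y P.* R₂) P.+ C a P.* (C x P.* S₁ P.+ C y P.* S₂)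
             P.≈⟨ P.solve 7 (λ x y a r r′ s s′ → (x P.:* r P.:+ y P.:* r′) P.:+ a P.:* (x P.:* s P.:+ y P.:* s′) P.:= x P.:* (r P.:+ a P.:* s) P.:+ y P.:* (r′ P.:+ a P.:* s′)) P.refl (C x) (C y) (C a) R₁ R₂ S₁ S₂ ⟩
          C x P.* (R₁ P.+ C a P.* S₁) P.+ C y P.* (R₂ P.+ C a P.* S₂)   P.≈⟨ P.+-cong (P.*-congˡ (P.+-congˡ (scale≋C* a S₁))) (P.*-congˡ (P.+-congˡ (scale≋C* a S₂))) ⟨
          C x P.* condition i c P.+ C y P.* condition i d P.∎
          where
          R₁ = horner X J (iter 0 i ∘ coeffs false c)
          R₂ = horner X J (iter 0 i ∘ coeffs false d)
          S₁ = horner X J (iter e i ∘ coeffs true c)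
          S₂ = horner X J (iter e i ∘ coeffs true d)

        E : ℕ
        E = L ℕ.+ M ℕ.* μ ℕ.+ 2 ℕ.* J

        length-condition : ∀ i c → i ≤ M → length (condition i c) ≤ E
        length-condition i c i≤M = length-add _ _ (half 0 false) (ℕP.≤-trans (ℕP.≤-reflexive (length-map _ (horner X J (iter e i ∘ coeffs true c)))) (half e true))
          where
          half : ∀ o b → length (horner X J (iter o i ∘ coeffs b c)) ≤ E
          half o b = length-hornerX (L ℕ.+ M ℕ.* μ) J _ λ j → ℕP.≤-trans (length-iter o i (coeffs b c j))
            (ℕP.+-mono-≤ (ℕP.≤-reflexive (length-tab L _)) (ℕP.*-monoˡ-≤ μ i≤M))

        unknowns : List Index
        unknowns = cartesianProduct (false ∷ true ∷ []) (cartesianProduct (upTo J) (upTo L))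

        equations : List (ℕ × ℕ)
        equations = cartesianProduct (upTo M) (upTo E)

        count : ∀ m n → length (cartesianProduct (upTo m) (upTo n)) ≡ m ℕ.* n
        count m n = ≡.trans (length-cartesianProduct (upTo m) (upTo n)) (≡.cong₂ ℕ._*_ (ListP.length-upTo m) (ListP.length-upTo n))

        functional : ℕ × ℕ → (Index → Carrier) → Carrier
        functional (i , n) c = coef (condition i c) n

        functional-linear : ∀ k → Linear (≡-dec Bool._≟_ (≡-dec ℕP._≟_ ℕP._≟_)) (functional k)
        functional-linear (i , n) x y c d = trans (at (condition-linear i x y c d) n) (trans (coef-add _ _ n)
          (+-cong (trans (sym (at (scale≋C* x _) n)) (coef-scale x (condition i c) n)) (trans (sym (at (scale≋C* y _) n)) (coef-scale y (condition i d) n))))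

        -- The right-hand side bounds the length of the auxiliary polynomial. With as many roots of
        -- order M the polynomial would be zero, hence all r_j and s_j, against the choice of a
        -- nonzero solution of the linear system.
        stepanov : M ≤ q → L ℕ.+ L ℕ.+ μ ≤ q → M ℕ.* E < 2 ℕ.* (J ℕ.* L) →
          ∀ xs → Distinct xs → All (λ x → x ^ q ≈ x × eval x u ^ e ≈ a) xs →
          length xs ℕ.* M < suc (M ℕ.* μ) ℕ.+ (L ℕ.+ J ℕ.* q ℕ.+ suc (e ℕ.* μ))
        stepanov M≤q Lq dims xs ds hs with underdetermined (≡-dec Bool._≟_ (≡-dec ℕP._≟_ ℕP._≟_)) functional functional-linear equations unknowns
          (cartesianProduct⁺ (((λ ()) ∷ []) ∷ [] ∷ []) (cartesianProduct⁺ (upTo⁺ J) (upTo⁺ L)))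
          (≡.subst₂ _<_ (≡.sym (count M E)) (≡.sym (≡.trans (length-cartesianProduct (false ∷ true ∷ []) (cartesianProduct (upTo J) (upTo L))) (≡.cong (2 ℕ.*_) (count J L)))) dims)
        ... | c , support , (k , ck≉0) , zeros = ℕP.≰⇒> λ few → ck≉0 (vanish few k)
          where
          r = coeffs false c
          s = coeffs true c
          aux : List Carrier
          aux = u P.^ M P.* (horner-shift q J r P.+ horner-shift q J s P.* g)
          aux≋ : aux ≋ u P.^ M P.* (horner Xq J r P.+ horner Xq J s P.* g)
          aux≋ = P.*-congˡ (P.+-cong (horner-shift≋ q J r) (P.*-congʳ (horner-shift≋ q J s)))
          length-coeffs : ∀ b j → length (coeffs b c j) ≤ L
          length-coeffs b j = ℕP.≤-reflexive (length-tab L _)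
          length-aux : length aux ≤ suc (M ℕ.* μ) ℕ.+ (L ℕ.+ J ℕ.* q ℕ.+ suc (e ℕ.* μ))
          length-aux = ℕP.≤-trans (length-mul (u P.^ M) _) (ℕP.+-mono-≤ (length-^ μ u M length-u)
            (length-add (horner-shift q J r) _ (ℕP.≤-trans (length-horner-shift L q J r (length-coeffs false)) (ℕP.m≤m+n _ _))
              (ℕP.≤-trans (length-mul (horner-shift q J s) g) (ℕP.+-mono-≤ (length-horner-shift L q J s (length-coeffs true)) (length-^ μ u e length-u)))))
          condition≋[] : ∀ i → i < M → condition i c ≋ []
          condition≋[] i i<M = mk≋ go
            where
            go : ∀ n → coef (condition i c) n ≈ 0#
            go n with n ℕP.<? E
            ... | yes n<E = zeros (i , n) (∈-cartesianProduct⁺ (∈-upTo⁺ i<M) (∈-upTo⁺ n<E))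
            ... | no n≮E = coef-≥length (condition i c) n (ℕP.≤-trans (length-condition i c (ℕP.<⇒≤ i<M)) (ℕP.≮⇒≥ n≮E))
          ord : ∀ {x} → x ^ q ≈ x × eval x u ^ e ≈ a → Ord x M aux
          ord {x} (x^q , χ) i i<M = begin
            eval x (Dⁿ i aux)                       ≈⟨ eval-cong x (Dⁿ-cong i aux≋) ⟩
            eval x (Dⁿ i (u P.^ M P.* (horner Xq J r P.+ horner Xq J s P.* g)))   ≈⟨ eval-cong x (Dⁿ-aux J r s i (ℕP.<⇒≤ i<M)) ⟩
            eval x (w P.* (horner Xq J r′ P.+ horner Xq J s′ P.* g))              ≈⟨ eval-* x w _ ⟩
            eval x w * eval x (horner Xq J r′ P.+ horner Xq J s′ P.* g)           ≈⟨ *-congˡ inner ⟩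
            eval x w * eval x (condition i c)                                     ≈⟨ *-congˡ (eval-≋[] x {condition i c} (condition≋[] i i<M)) ⟩
            eval x w * 0#                                                         ≈⟨ zeroʳ _ ⟩
            0#                                                                    ∎
            where
            r′ = iter 0 i ∘ r
            s′ = iter e i ∘ s
            w = u P.^ (M ℕ.∸ i)
            Xq≈X : eval x Xq ≈ eval x X
            Xq≈X = trans (eval-^ x X q) (trans (^-congˡ q (eval-X x)) (trans x^q (sym (eval-X x))))
            inner : eval x (horner Xq J r′ P.+ horner Xq J s′ P.* g) ≈ eval x (condition i c)
            inner = begin
              eval x (horner Xq J r′ P.+ horner Xq J s′ P.* g)                ≈⟨ trans (eval-+ x (horner Xq J r′) _) (+-congˡ (eval-* x (horner Xq J s′) g)) ⟩
              eval x (horner Xq J r′) + eval x (horner Xq J s′) * eval x g    ≈⟨ +-cong (eval-horner x Xq X Xq≈X J r′) (*-cong (eval-horner x Xq X Xq≈X J s′) (trans (eval-^ x u e) χ)) ⟩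
              eval x (horner X J r′) + eval x (horner X J s′) * a             ≈⟨ +-congˡ (trans (*-comm _ a) (sym (eval-scale x a (horner X J s′)))) ⟩
              eval x (horner X J r′) + eval x (scale a (horner X J s′))       ≈⟨ eval-+ x (horner X J r′) _ ⟨
              eval x (condition i c)                                          ∎
          -- For u = 0 the pair r = 1, s = 0 would violate `nonsquare`.
          u≉[] : ¬ u ≋ []
          u≉[] u0 = 1≉0 (at (proj₁ (nonsquare P.1# [] (P.trans (P.*-congˡ u0) (P.trans (P.zeroʳ _) (P.sym (P.trans (P.*-congˡ (P.zeroʳ [])) (P.zeroʳ _))))))) 0)
          vanish : suc (M ℕ.* μ) ℕ.+ (L ℕ.+ J ℕ.* q ℕ.+ suc (e ℕ.* μ)) ≤ length xs ℕ.* M → ∀ k → c k ≈ 0#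
          vanish few = every
            where
            aux≋[] : aux ≋ []
            aux≋[] = too-many-roots M (λ i l → char< i (ℕP.<-≤-trans l M≤q)) xs aux ds (All.map ord hs) (ℕP.≤-trans length-aux few)
            sum≋[] : horner Xq J r P.+ horner Xq J s P.* g ≋ []
            sum≋[] with poly-domain (u P.^ M) (horner Xq J r P.+ horner Xq J s P.* g) (P.trans (P.sym aux≋) aux≋[])
            ... | inj₁ bad = contradiction bad (poly-^-≉ u M 1≉0 u≉[])
            ... | inj₂ ok = ok
            each : ∀ b j → j < J → coeffs b c j ≋ []
            each false j l = proj₁ (nonvanishing L J r s Lq (length-coeffs false) (length-coeffs true) sum≋[] j l)
            each true j l = proj₂ (nonvanishing L J r s Lq (length-coeffs false) (length-coeffs true) sum≋[] j l)
            every : ∀ k → c k ≈ 0#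
            every (b , j , n) with j ℕP.<? J | n ℕP.<? L
            ... | yes j<J | yes n<L = trans (sym (coef-tab L _ n n<L)) (at (each b j j<J) n)
            ... | no j≮J | _ = support _ λ m → j≮J (∈-upTo⁻ (proj₁ (∈-cartesianProduct⁻ (upTo J) (upTo L) (proj₂ (∈-cartesianProduct⁻ (false ∷ true ∷ []) _ m)))))
            ... | yes _ | no n≮L = support _ λ m → n≮L (∈-upTo⁻ (proj₂ (∈-cartesianProduct⁻ (upTo J) (upTo L) (proj₂ (∈-cartesianProduct⁻ (false ∷ true ∷ []) _ m)))))

-- Residue class rings

module Quotient (R : CommutativeRing 0ℓ 0ℓ) (m : CommutativeRing.Carrier R) where
  open Kit R

  infix 4 _≈ₘ_
  record _≈ₘ_ (a b : Carrier) : Set where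
    constructor mk≈
    field
      quot : Carrier
      difference : a - b ≈ quot * m
  open _≈ₘ_ public

  ≈⇒≈ₘ : ∀ {a b} → a ≈ b → a ≈ₘ b
  ≈⇒≈ₘ e = mk≈ 0# (trans (+-congʳ e) (trans (-‿inverseʳ _) (sym (zeroˡ m))))

  private
    symₘ : ∀ {a b} → a ≈ₘ b → b ≈ₘ a
    symₘ {a} {b} (mk≈ x e) = mk≈ (- x) (trans (solve 2 (λ a b → b :- a := :- (a :- b)) refl a b) (trans (-‿cong e) (-‿distribˡ-* x m)))

    transₘ : ∀ {a b c} → a ≈ₘ b → b ≈ₘ c → a ≈ₘ c
    transₘ {a} {b} {c} (mk≈ x e) (mk≈ y f) = mk≈ (x + y)
      (trans (solve 3 (λ a b c → a :- c := (a :- b) :+ (b :- c)) refl a b c) (trans (+-cong e f) (sym (distribʳ m x y))))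

    +-congₘ : ∀ {a b c d} → a ≈ₘ b → c ≈ₘ d → a + c ≈ₘ b + d
    +-congₘ {a} {b} {c} {d} (mk≈ x e) (mk≈ y f) = mk≈ (x + y)
      (trans (solve 4 (λ a b c d → (a :+ c) :- (b :+ d) := (a :- b) :+ (c :- d)) refl a b c d) (trans (+-cong e f) (sym (distribʳ m x y))))

    neg-congₘ : ∀ {a b} → a ≈ₘ b → - a ≈ₘ - b
    neg-congₘ {a} {b} (mk≈ x e) = mk≈ (- x) (trans (solve 2 (λ a b → (:- a) :- (:- b) := :- (a :- b)) refl a b) (trans (-‿cong e) (-‿distribˡ-* x m)))

    *-congₘ : ∀ {a b c d} → a ≈ₘ b → c ≈ₘ d → a * c ≈ₘ b * d
    *-congₘ {a} {b} {c} {d} (mk≈ x e) (mk≈ y f) = mk≈ (x * c + b * y)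
      (trans (solve 4 (λ a b c d → a :* c :- b :* d := (a :- b) :* c :+ b :* (c :- d)) refl a b c d)
      (trans (+-cong (*-congʳ e) (*-congˡ f)) (solve 5 (λ x m c b y → (x :* m) :* c :+ b :* (y :* m) := (x :* c :+ b :* y) :* m) refl x m c b y)))

  -- Only the equality is coarsened; reduction modulo m is the identity on elements.
  R/m : CommutativeRing 0ℓ 0ℓ
  R/m = record
    { Carrier = Carrier ; _≈_ = _≈ₘ_ ; _+_ = _+_ ; _*_ = _*_ ; -_ = λ a → - a ; 0# = 0# ; 1# = 1#
    ; isCommutativeRing = record
      { isRing = record
        { +-isAbelianGroup = record
          { isGroup = record
            { isMonoid = record
              { isSemigroup = record
                { isMagma = record { isEquivalence = record { refl = ≈⇒≈ₘ refl ; sym = symₘ ; trans = transₘ } ; ∙-cong = +-congₘ }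
                ; assoc = λ a b c → ≈⇒≈ₘ (+-assoc a b c) }
              ; identity = (λ a → ≈⇒≈ₘ (+-identityˡ a)) , (λ a → ≈⇒≈ₘ (+-identityʳ a)) }
            ; inverse = (λ a → ≈⇒≈ₘ (-‿inverseˡ a)) , (λ a → ≈⇒≈ₘ (-‿inverseʳ a))
            ; ⁻¹-cong = neg-congₘ }
          ; comm = λ a b → ≈⇒≈ₘ (+-comm a b) }
        ; *-cong = *-congₘ
        ; *-assoc = λ a b c → ≈⇒≈ₘ (*-assoc a b c)
        ; *-identity = (λ a → ≈⇒≈ₘ (*-identityˡ a)) , (λ a → ≈⇒≈ₘ (*-identityʳ a))
        ; distrib = (λ a b c → ≈⇒≈ₘ (distribˡ a b c)) , (λ a b c → ≈⇒≈ₘ (distribʳ a b c)) }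
      ; *-comm = λ a b → ≈⇒≈ₘ (*-comm a b) } }

-- Prime fields: Fermat, inverses, affine maps, Euler's criterion

module PrimeField (R : CommutativeRing 0ℓ 0ℓ)
  (_≟_ : Discrete R)
  (domain : NoZeroDivisors R)
  (1≉0 : Nontrivial R)
  (k : ℕ) (1≤k : 1 ≤ k)
  (char : CommutativeRing._≈_ R (Kit.ι R (+ suc k)) (CommutativeRing.0# R))
  (char< : (i : ℕ) → suc i < suc k → ¬ CommutativeRing._≈_ R (Kit.ι R (+ suc i)) (CommutativeRing.0# R))
  (natural : (x : CommutativeRing.Carrier R) → ∃[ n ] CommutativeRing._≈_ R x (Kit.ι R (+ n))) where
  open Kit R
  open Poly R
  open Domain R _≟_ domain
  open Frobenius R domain

  fermat : ∀ a → a ^ suc k ≈ a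
  fermat a with natural a
  ... | n , a≈ = trans (^-congˡ (suc k) a≈) (trans (fermat-ι (suc k) k ≡.refl char char< n) (sym a≈))

  cancelˡ : ∀ {a b c} → ¬ a ≈ 0# → a * b ≈ a * c → b ≈ c
  cancelˡ {a} {b} {c} a≉0 e with domain a (b - c) (trans (solve 3 (λ a b c → a :* (b :- c) := a :* b :- a :* c) refl a b c) (trans (+-congʳ e) (-‿inverseʳ _)))
  ... | inj₁ z = contradiction z a≉0
  ... | inj₂ z = x∙y⁻¹≈ε⇒x≈y b c z

  fermat-unit : ∀ {a} → ¬ a ≈ 0# → a ^ k ≈ 1#
  fermat-unit {a} a≉0 = cancelˡ a≉0 (trans (fermat a) (sym (*-identityʳ a)))

  -- By Fermat, a^(k-1) is the inverse.
  inverse : ∀ a → ¬ a ≈ 0# → ∃[ b ] a * b ≈ 1#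
  inverse a a≉0 = go k 1≤k (fermat-unit a≉0)
    where
    go : ∀ n → 1 ≤ n → a ^ n ≈ 1# → ∃[ b ] a * b ≈ 1#
    go (suc n) _ e = a ^ n , e

  affine-cong : ∀ a t {x y} → x ≈ y → a + t * x ≈ a + t * y
  affine-cong a t e = +-congˡ (*-congˡ e)

  affine-solution : ∀ a t b (t≉0 : ¬ t ≈ 0#) → a + t * (proj₁ (inverse t t≉0) * (b - a)) ≈ b
  affine-solution a t b t≉0 = begin
    a + t * (s * (b - a))    ≈⟨ +-congˡ (*-assoc t s (b - a)) ⟨
    a + (t * s) * (b - a)    ≈⟨ +-congˡ (trans (*-congʳ (proj₂ (inverse t t≉0))) (*-identityˡ _)) ⟩
    a + (b - a)              ≈⟨ solve 2 (λ a b → a :+ (b :- a) := b) refl a b ⟩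
    b                        ∎
    where s = proj₁ (inverse t t≉0)

  affine-injective : ∀ a t {x y} → ¬ t ≈ 0# → a + t * x ≈ a + t * y → x ≈ y
  affine-injective a t {x} {y} t≉0 e = cancelˡ t≉0 (trans (strip (t * x)) (trans (+-congˡ e) (sym (strip (t * y)))))
    where
    strip : ∀ z → z ≈ - a + (a + z)
    strip z = solve 2 (λ a z → z := :- a :+ (a :+ z)) refl a z

  module Euler (e : ℕ) (k≡ : k ≡ e ℕ.+ e) where

    sq : ℕ → Carrier
    sq i = ι (+ suc i) * ι (+ suc i)

    square-^ : ∀ y → ¬ y ≈ 0# → (y * y) ^ e ≈ 1#
    square-^ y y≉0 = trans (go e) (≡.subst (λ n → y ^ n ≈ 1#) k≡ (fermat-unit y≉0))
      where
      go : ∀ n → (y * y) ^ n ≈ y ^ (n ℕ.+ n)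
      go zero = refl
      go (suc n) = trans (*-congˡ (go n)) (trans (*-assoc y y _) (reflexive (≡.cong (λ m → y * y ^ m) (≡.sym (ℕP.+-suc n n)))))

    private
      1≤e : 1 ≤ e
      1≤e = go e k≡
        where
        go : ∀ n → k ≡ n ℕ.+ n → 1 ≤ n
        go zero k≡0 = ≡.subst (1 ≤_) k≡0 1≤k
        go (suc _) _ = s≤s z≤n

      e≤k : e ≤ k
      e≤k = ≡.subst (e ≤_) (≡.sym k≡) (ℕP.m≤m+n e e)

      small≉0 : ∀ {i} → i < k → ¬ ι (+ suc i) ≈ 0#
      small≉0 {i} i<k = char< i (s≤s i<k)

      -- For 1 ≤ x < y ≤ e one has y² - x² = (y - x)(y + x), and both factors lie strictly between 0
      -- and the characteristic 2e + 1.
      sq-distinct : ∀ {i j} → i < j → j < e → ¬ sq i ≈ sq j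
      sq-distinct {i} {j} i<j j<e eq with ℕP.m≤n⇒∃[o]m+o≡n i<j
      ... | d , ≡.refl with domain (ι (+ suc d)) (ι (+ suc (suc i ℕ.+ d)) + ι (+ suc i))
        (begin
          ι (+ suc d) * (ι (+ suc (suc i ℕ.+ d)) + ι (+ suc i))                        ≈⟨ *-congˡ (+-congʳ j≈) ⟩
          ι (+ suc d) * ((ι (+ suc d) + ι (+ suc i)) + ι (+ suc i))                    ≈⟨ solve 2 (λ d i → d :* ((d :+ i) :+ i) := (d :+ i) :* (d :+ i) :- i :* i) refl (ι (+ suc d)) (ι (+ suc i)) ⟩
          (ι (+ suc d) + ι (+ suc i)) * (ι (+ suc d) + ι (+ suc i)) - sq i             ≈⟨ +-congʳ (*-cong j≈ j≈) ⟨
          sq (suc i ℕ.+ d) - sq i                                                      ≈⟨ +-congˡ (-‿cong eq) ⟩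
          sq (suc i ℕ.+ d) - sq (suc i ℕ.+ d)                                          ≈⟨ -‿inverseʳ _ ⟩
          0#                                                                           ∎)
        where
        j≈ : ι (+ suc (suc i ℕ.+ d)) ≈ ι (+ suc d) + ι (+ suc i)
        j≈ = trans (reflexive (≡.cong (λ n → ι (+ n)) (≡.trans (≡.cong suc (ℕP.+-comm (suc i) d)) ≡.refl))) (ι-+ (+ suc d) (+ suc i))
      ...   | inj₁ z = small≉0 (ℕP.≤-trans (s≤s (ℕP.m≤n+m d (suc i))) (ℕP.≤-trans j<e e≤k)) z
      ...   | inj₂ z = small≉0 {suc i ℕ.+ d ℕ.+ suc i} (≡.subst (suc (suc i ℕ.+ d) ℕ.+ suc i ≤_) (≡.sym k≡)
                (ℕP.+-mono-≤ j<e (ℕP.≤-trans (s≤s (ℕP.m≤m+n i d)) (ℕP.<⇒≤ j<e)))) (trans (ι-+ (+ suc (suc i ℕ.+ d)) (+ suc i)) z)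

      unity : List Carrier
      unity = shift e (1# ∷ []) P.+ C (- 1#)

      eval-unity : ∀ x → x ^ e ≈ 1# → eval x unity ≈ 0#
      eval-unity x h = begin
        eval x unity                                    ≈⟨ eval-+ x (shift e (1# ∷ [])) _ ⟩
        eval x (shift e (1# ∷ [])) + eval x (C (- 1#))  ≈⟨ +-cong (eval-cong x (P.trans (P.sym (X^*≋shift e _)) (P.*-identityʳ _))) (eval-C x (- 1#)) ⟩
        eval x (X P.^ e) - 1#                           ≈⟨ +-congʳ (trans (eval-^ x X e) (^-congˡ e (eval-X x))) ⟩
        x ^ e - 1#                                      ≈⟨ +-congʳ h ⟩
        1# - 1#                                         ≈⟨ -‿inverseʳ _ ⟩
        0#                                              ∎

      unity≉[] : ¬ unity ≋ []
      unity≉[] z = go e 1≤e z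
        where
        go : ∀ n → 1 ≤ n → ¬ shift n (1# ∷ []) P.+ C (- 1#) ≋ []
        go (suc n) _ z = 1≉0 (begin
          1#                                                   ≈⟨ coef-^-top 0# (suc n) ⟨
          coef (X P.^ suc n) (suc n)                           ≈⟨ at (P.trans (P.sym (P.*-identityʳ (X P.^ suc n))) (X^*≋shift (suc n) (1# ∷ []))) (suc n) ⟩
          coef (shift (suc n) (1# ∷ [])) (suc n)               ≈⟨ +-identityʳ _ ⟨
          coef (shift (suc n) (1# ∷ [])) (suc n) + 0#          ≈⟨ coef-add (shift (suc n) (1# ∷ [])) (C (- 1#)) (suc n) ⟨
          coef (shift (suc n) (1# ∷ []) P.+ C (- 1#)) (suc n)  ≈⟨ at z (suc n) ⟩
          0#                                                   ∎)

    -- Otherwise X^e − 1 would have a as a root besides the e squares 1², …, e².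
    nonresidue-^ : ∀ a → ¬ a ≈ 0# → (∀ i → ¬ a ≈ sq i) → a ^ e ≈ - 1#
    nonresidue-^ a a≉0 ns with domain (a ^ e - 1#) (a ^ e + 1#) (trans (solve 2 (λ x o → (x :- o) :* (x :+ o) := x :* x :- o :* o) refl (a ^ e) 1#)
       (trans (+-cong (trans (sym (^-homo-* a e e)) (≡.subst (λ n → a ^ n ≈ 1#) k≡ (fermat-unit a≉0))) (-‿cong (*-identityˡ 1#))) (-‿inverseʳ _)))
    ... | inj₂ z = trans (solve 2 (λ x o → x := (x :+ o) :- o) refl (a ^ e) 1#) (trans (+-congʳ z) (+-identityˡ _))
    ... | inj₁ z = contradiction (too-many-simple-roots (a ∷ applyUpTo sq e) unity
        (AllP.applyUpTo⁺₂ sq e ns ∷ AllPairsP.applyUpTo⁺₁ sq e sq-distinct)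
        (eval-unity a (x∙y⁻¹≈ε⇒x≈y (a ^ e) 1# z) ∷ AllP.applyUpTo⁺₁ sq e (λ {i} i<e → eval-unity (sq i) (square-^ (ι (+ suc i)) (small≉0 (ℕP.≤-trans i<e e≤k)))))
        (ℕP.≤-trans (length-add (shift e (1# ∷ [])) (C (- 1#)) (ℕP.≤-reflexive (≡.trans (length-shift e _) (ℕP.+-comm e 1))) (s≤s z≤n))
          (ℕP.≤-reflexive (≡.cong suc (≡.sym (ListP.length-applyUpTo sq e))))))
        unity≉[]

-- The integers modulo a prime and the Legendre symbol

module Zmod (k : ℕ) (prime : Prime (suc k)) where
  ℓ : ℕ
  ℓ = suc k

  open Quotient ℤP.+-*-commutativeRing (+ ℓ) renaming (_≈ₘ_ to _≈ℓ_; R/m to ℤmod; ≈⇒≈ₘ to ≡⇒≈) public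
  open Kit ℤmod

  ≈⇒∣ : ∀ {a b} → a ≈ℓ b → ℓ ℕD.∣ ∣ a ℤ.- b ∣
  ≈⇒∣ {a} {b} (mk≈ c e) = ℕD.divides ∣ c ∣ (≡.trans (≡.cong ∣_∣ e) (ℤP.abs-* c (+ ℓ)))

  ∣⇒≈ : ∀ {a b} → ℓ ℕD.∣ ∣ a ℤ.- b ∣ → a ≈ℓ b
  ∣⇒≈ {a} {b} d with ℤD.∣ᵤ⇒∣ {+ ℓ} {a ℤ.- b} d
  ... | ℤD.divides c e = mk≈ c e

  infix 4 _≟_
  _≟_ : ∀ a b → Dec (a ≈ℓ b)
  a ≟ b with ℓ ℕD.∣? ∣ a ℤ.- b ∣
  ... | yes d = yes (∣⇒≈ d)
  ... | no ¬d = no λ e → ¬d (≈⇒∣ e)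

  ≈0⇒∣ : ∀ {a} → a ≈ℓ + 0 → ℓ ℕD.∣ ∣ a ∣
  ≈0⇒∣ {a} e = ≡.subst (λ z → ℓ ℕD.∣ ∣ z ∣) (ℤP.+-identityʳ a) (≈⇒∣ e)

  ∣⇒≈0 : ∀ {a} → ℓ ℕD.∣ ∣ a ∣ → a ≈ℓ + 0
  ∣⇒≈0 {a} d = ∣⇒≈ (≡.subst (λ z → ℓ ℕD.∣ ∣ z ∣) (≡.sym (ℤP.+-identityʳ a)) d)

  domain : ∀ a b → a ℤ.* b ≈ℓ + 0 → a ≈ℓ + 0 ⊎ b ≈ℓ + 0
  domain a b e = Sum.map ∣⇒≈0 ∣⇒≈0 (euclidsLemma ∣ a ∣ ∣ b ∣ prime (≡.subst (ℓ ℕD.∣_) (ℤP.abs-* a b) (≈0⇒∣ e)))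

  -- The difference is a multiple of ℓ with absolute value below ℓ.
  small-≈⇒≡ : ∀ {i j} → i < ℓ → j < ℓ → + i ≈ℓ + j → i ≡ j
  small-≈⇒≡ {i} {j} i<ℓ j<ℓ e with ∣ + i ℤ.- + j ∣ in eq
  ... | zero = ℤP.+-injective (ℤP.i-j≡0⇒i≡j (+ i) (+ j) (ℤP.∣i∣≡0⇒i≡0 eq))
  ... | suc n = contradiction (ℕD.∣⇒≤ (≡.subst (ℓ ℕD.∣_) eq (≈⇒∣ e)))
    (ℕP.<⇒≱ (≡.subst (_< ℓ) (≡.trans (≡.cong ∣_∣ (≡.sym (ℤP.[+m]-[+n]≡m⊖n i j))) eq) (ℕP.≤-<-trans (ℤP.∣m⊝n∣≤m⊔n i j) (ℕP.⊔-lub i<ℓ j<ℓ))))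

  nonTrivial : 1 < ℓ
  nonTrivial = ℕ.nonTrivial⇒n>1 ℓ {{prime⇒nonTrivial prime}}

  1≉0 : ¬ + 1 ≈ℓ + 0
  1≉0 e = ℕP.1+n≢0 (small-≈⇒≡ nonTrivial (s≤s z≤n) e)

  ≈-residue : ∀ a → a ≈ℓ + (a %ℕ ℓ)
  ≈-residue a = mk≈ (a /ℕ ℓ) (≡.trans (≡.cong (ℤ._- r) (a≡a%ℕn+[a/ℕn]*n a ℓ)) (cancel r ((a /ℕ ℓ) ℤ.* + ℓ)))
    where
    r : ℤ
    r = + (a %ℕ ℓ)
    cancel : ∀ x y → x ℤ.+ y ℤ.- x ≡ y
    cancel x y = ≡.trans (≡.cong (ℤ._- x) (ℤP.+-comm x y)) (≡.trans (ℤP.+-assoc y x (ℤ.- x)) (≡.trans (≡.cong (ℤ._+_ y) (ℤP.+-inverseʳ x)) (ℤP.+-identityʳ y)))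

  residue-cong : ∀ {a b} → a ≈ℓ b → a %ℕ ℓ ≡ b %ℕ ℓ
  residue-cong {a} {b} e = small-≈⇒≡ (n%ℕd<d a ℓ) (n%ℕd<d b ℓ) (trans (sym (≈-residue a)) (trans e (≈-residue b)))

  ι≡ : ∀ i → ι i ≡ i
  ι≡ (+ n) = go n
    where
    go : ∀ n → ι (+ n) ≡ + n
    go zero = ≡.refl
    go (suc n) = ≡.cong (ℤ._+_ (+ 1)) (go n)
  ι≡ -[1+ n ] = ≡.cong (λ z → ℤ.- (+ 1 ℤ.+ z)) (ι≡ (+ n))

  char : ι (+ ℓ) ≈ + 0
  char = ∣⇒≈0 (≡.subst (λ z → ℓ ℕD.∣ ∣ z ∣) (≡.sym (ι≡ (+ ℓ))) ℕD.∣-refl)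

  char< : ∀ i → suc i < ℓ → ¬ ι (+ suc i) ≈ + 0
  char< i l e = ℕP.1+n≢0 (small-≈⇒≡ l (s≤s z≤n) (trans (reflexive (≡.sym (ι≡ (+ suc i)))) e))

  1≤k : 1 ≤ k
  1≤k = ℕP.≤-pred nonTrivial

  natural : ∀ a → ∃[ n ] a ≈ ι (+ n)
  natural a = a %ℕ ℓ , trans (≈-residue a) (reflexive (≡.sym (ι≡ (+ (a %ℕ ℓ)))))

  module F = PrimeField ℤmod _≟_ domain 1≉0 k 1≤k char char< natural

  legendre-cong : ∀ {a b} → a ≈ℓ b → legendre ℓ a ≡ legendre ℓ b
  legendre-cong {a} {b} e with a %ℕ ℓ | b %ℕ ℓ | residue-cong e
  ... | r | .r | ≡.refl = ≡.refl

  module Euler (e : ℕ) (k≡ : k ≡ e ℕ.+ e) where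
    open F.Euler e k≡

    -- Indexed by the value of the symbol: matching on `euler a` replaces that value by 0, 1 or -1
    -- and delivers the power a^e along with it.
    data Residue (a : ℤ) : ℤ → Set where
      divisible  : a ≈ + 0 → Residue a (+ 0)
      residue    : a ^ e ≈ + 1 → Residue a (+ 1)
      nonresidue : a ^ e ≈ - + 1 → Residue a (- + 1)

    euler : ∀ a → Residue a (legendre ℓ a)
    euler a with a %ℕ ℓ | ≈-residue a | n%ℕd<d a ℓ
    ... | zero | a≈ | _ = divisible a≈
    ... | suc r | a≈ | r<ℓ with any? (λ y → (y ℕ.* y) ℕ.% suc k ℕP.≟ suc r) (upTo (suc k))
    ...   | yes found = residue (trans (^-congˡ e a≈y²) (square-^ (+ y) y≉0))
      where
      y : ℕ
      y = proj₁ (Any.satisfied found)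
      a≈y² : a ≈ + y * + y
      a≈y² = trans a≈ (trans (reflexive (≡.cong +_ (≡.sym (proj₂ (Any.satisfied found))))) (trans (sym (≈-residue (+ (y ℕ.* y)))) (reflexive (ℤP.pos-* y y))))
      y≉0 : ¬ + y ≈ + 0
      y≉0 z = ℕP.1+n≢0 (small-≈⇒≡ {suc r} {0} r<ℓ (s≤s z≤n) (trans (sym a≈) (trans a≈y² (trans (*-congʳ z) (zeroˡ (+ y))))))
    ...   | no missing = nonresidue (nonresidue-^ a a≉0 nonsquare)
      where
      a≉0 : ¬ a ≈ + 0
      a≉0 z = ℕP.1+n≢0 (small-≈⇒≡ {suc r} {0} r<ℓ (s≤s z≤n) (trans (sym a≈) z))
      nonsquare : ∀ i → ¬ a ≈ sq i
      -- The search in `legendre` runs over residues only, so the root i + 1 is first reduced modulo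
      -- ℓ.
      nonsquare i eq = missing (lose (∈-upTo⁺ {suc k} (n%ℕd<d (+ suc i) ℓ)) (small-≈⇒≡ {_} {suc r} (n%ℕd<d (+ (y ℕ.* y)) ℓ) r<ℓ (begin
          + ((y ℕ.* y) ℕ.% ℓ)      ≈⟨ ≈-residue (+ (y ℕ.* y)) ⟨
          + (y ℕ.* y)              ≈⟨ reflexive (ℤP.pos-* y y) ⟩
          + y * + y                ≈⟨ *-cong (≈-residue (+ suc i)) (≈-residue (+ suc i)) ⟨
          + suc i * + suc i        ≈⟨ *-cong (reflexive (ι≡ (+ suc i))) (reflexive (ι≡ (+ suc i))) ⟨
          sq i                     ≈⟨ eq ⟨
          a                        ≈⟨ a≈ ⟩
          + suc r                  ∎)))
        where
        y : ℕ
        y = (+ suc i) %ℕ ℓ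

-- Character sums in one variable

module OneVar where
  sumL : {A : Set} → List A → (A → ℤ) → ℤ
  sumL xs g = foldr (λ x s → g x ℤ.+ s) (+ 0) xs

  half : ∀ n → ∃[ h ] (n ≡ h ℕ.+ h ⊎ n ≡ suc (h ℕ.+ h))
  half zero = 0 , inj₁ ≡.refl
  half (suc n) with half n
  ... | h , inj₁ ≡.refl = h , inj₂ ≡.refl
  ... | h , inj₂ ≡.refl = suc h , inj₁ (≡.cong suc (≡.sym (ℕP.+-suc h h)))

  -- With the factor 4 built in, M = 2N plays the role of √q, and J ≈ M/2 is N plus a constant.
  half-sqrt : ∀ q → ∃[ N ] (4 ℕ.* (N ℕ.* N) ≤ q × q < 4 ℕ.* (suc N ℕ.* suc N))
  half-sqrt zero = 0 , z≤n , s≤s z≤n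
  half-sqrt (suc q) with half-sqrt q
  ... | N , lo , hi with suc q ℕP.<? 4 ℕ.* (suc N ℕ.* suc N)
  ...   | yes hi′ = N , ℕP.m≤n⇒m≤1+n lo , hi′
  ...   | no ¬hi = suc N , ℕP.≮⇒≥ ¬hi , ℕP.≤-<-trans hi (ℕP.*-monoʳ-< 4 (ℕP.*-mono-< (ℕP.n<1+n (suc N)) (ℕP.n<1+n (suc N))))

  module _ {A : Set} (f : A → ℤ) (f-sign : ∀ x → f x ≡ + 0 ⊎ f x ≡ + 1 ⊎ f x ≡ -[1+ 0 ]) where
    level : ℤ → List A → List A
    level c = filter (λ x → f x ℤ.≟ c)

    sum-signs : ∀ xs → sumL xs f ≡ length (level (+ 1) xs) ℤ.⊖ length (level -[1+ 0 ] xs) ×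
                length (level (+ 0) xs) ℕ.+ (length (level (+ 1) xs) ℕ.+ length (level -[1+ 0 ] xs)) ≡ length xs
    sum-signs [] = ≡.refl , ≡.refl
    sum-signs (x ∷ xs) with sum-signs xs | f x | f-sign x
    ... | s , t | _ | inj₁ ≡.refl = ≡.trans (ℤP.+-identityˡ _) s , ≡.cong suc t
    ... | s , t | _ | inj₂ (inj₁ ≡.refl) = ≡.trans (≡.cong (ℤ._+_ (+ 1)) s) (ℤP.distribʳ-⊖-+-pos 1 (length (level (+ 1) xs)) (length (level -[1+ 0 ] xs))) , ≡.trans (ℕP.+-suc _ _) (≡.cong suc t)
    ... | s , t | _ | inj₂ (inj₂ ≡.refl) = ≡.trans (≡.cong (ℤ._+_ -[1+ 0 ]) s) (ℤP.distribʳ-⊖-+-neg 0 (length (level (+ 1) xs)) (length (level -[1+ 0 ] xs))) ,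
            ≡.trans (≡.cong (length (level (+ 0) xs) ℕ.+_) (ℕP.+-suc _ _)) (≡.trans (ℕP.+-suc _ _) (≡.cong suc t))

  *∣⊖∣-≤ : ∀ N m n K → N ℕ.* m ≤ N ℕ.* n ℕ.+ K → N ℕ.* n ≤ N ℕ.* m ℕ.+ K → N ℕ.* ∣ m ℤ.⊖ n ∣ ≤ K
  *∣⊖∣-≤ N m n K h₁ h₂ with ℕP.≤-total m n
  ... | inj₁ m≤n = ≡.subst (λ z → N ℕ.* z ≤ K) (≡.sym (ℤP.∣⊖∣-≤ m≤n)) (≡.subst (_≤ K) (≡.sym (ℕP.*-distribˡ-∸ N n m)) (ℕP.m≤n+o⇒m∸n≤o (N ℕ.* n) (N ℕ.* m) h₂))
  ... | inj₂ n≤m = ≡.subst (λ z → N ℕ.* z ≤ K) (≡.sym (≡.trans (ℤP.∣m⊖n∣≡∣n⊖m∣ m n) (ℤP.∣⊖∣-≤ n≤m))) (≡.subst (_≤ K) (≡.sym (ℕP.*-distribˡ-∸ N m n)) (ℕP.m≤n+o⇒m∸n≤o (N ℕ.* m) (N ℕ.* n) h₁))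

  -- With these choices there are more unknowns than conditions, while deg R / M stays at q/2 + O(√q).
  module Parameters (q μ N L : ℕ) (4N²≤q : 4 ℕ.* (N ℕ.* N) ≤ q) (48≤q : 48 ≤ q) (4μ≤q : 4 ℕ.* suc μ ≤ q) (q≤ : q ≤ L ℕ.+ L ℕ.+ suc μ) where
    c J M : ℕ
    c = 2 ℕ.* μ ℕ.+ 3
    J = N ℕ.+ c
    M = 2 ℕ.* N

    open ℕP.≤-Reasoning

    -- For N ≥ 4 this follows from 16N ≤ 4N²; the remaining N ≤ 3 are the origin of the hypothesis
    -- 48 ≤ q.
    16N≤q : 16 ℕ.* N ≤ q
    16N≤q with 4 ℕP.≤? N
    ... | yes 4≤N = begin
      16 ℕ.* N               ≡⟨ ℕP.*-assoc 4 4 N ⟩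
      4 ℕ.* (4 ℕ.* N)        ≤⟨ ℕP.*-monoʳ-≤ 4 (ℕP.*-monoˡ-≤ N 4≤N) ⟩
      4 ℕ.* (N ℕ.* N)        ≤⟨ 4N²≤q ⟩
      q                      ∎
    ... | no 4≰N = ℕP.≤-trans (ℕP.*-monoʳ-≤ 16 (ℕP.≤-pred (ℕP.≰⇒> 4≰N))) 48≤q

    M≤q : M ≤ q
    M≤q = ℕP.≤-trans (ℕP.*-monoˡ-≤ N (s≤s (s≤s (z≤n {14})))) 16N≤q

    -- Four times the number of conditions is 8NL + 16N²(μ + 1) + 16Nc, which is at most 8NL + 4q(μ
    -- + 1) + cq. Four times the number of unknowns is 8NL + 8cL, and the lower bound for L makes it
    -- at least 8NL + 3cq. The comparison asks for c > 2(μ + 1), and 2μ + 3 is the least such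
    -- integer.
    dimensions : M ℕ.* (L ℕ.+ M ℕ.* μ ℕ.+ 2 ℕ.* J) < 2 ℕ.* (J ℕ.* L)
    dimensions = ℕP.*-cancelˡ-< 4 _ _ (ℕP.+-cancelʳ-< (c ℕ.* q) _ _ (begin-strict
      4 ℕ.* (M ℕ.* (L ℕ.+ M ℕ.* μ ℕ.+ 2 ℕ.* J)) ℕ.+ c ℕ.* q
        ≡⟨ solve-expand N L μ c q ⟩
      8 ℕ.* (N ℕ.* L) ℕ.+ (4 ℕ.* (4 ℕ.* (N ℕ.* N)) ℕ.* suc μ ℕ.+ c ℕ.* (16 ℕ.* N) ℕ.+ c ℕ.* q)
        ≤⟨ ℕP.+-monoʳ-≤ (8 ℕ.* (N ℕ.* L)) (ℕP.+-monoˡ-≤ (c ℕ.* q) (ℕP.+-mono-≤ (ℕP.*-monoˡ-≤ (suc μ) (ℕP.*-monoʳ-≤ 4 4N²≤q)) (ℕP.*-monoʳ-≤ c 16N≤q))) ⟩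
      8 ℕ.* (N ℕ.* L) ℕ.+ (4 ℕ.* q ℕ.* suc μ ℕ.+ c ℕ.* q ℕ.+ c ℕ.* q)
        <⟨ ℕP.+-monoʳ-< (8 ℕ.* (N ℕ.* L)) (≡.subst (4 ℕ.* q ℕ.* suc μ ℕ.+ c ℕ.* q ℕ.+ c ℕ.* q <_) (solve-slack q μ) (ℕP.m<m+n _ (ℕP.≤-trans (s≤s z≤n) (ℕP.≤-trans 48≤q (ℕP.m≤m+n q q))))) ⟩
      8 ℕ.* (N ℕ.* L) ℕ.+ 4 ℕ.* (c ℕ.* q)
        ≤⟨ ℕP.+-monoʳ-≤ (8 ℕ.* (N ℕ.* L)) (ℕP.*-monoʳ-≤ 4 (ℕP.*-monoʳ-≤ c q≤)) ⟩
      8 ℕ.* (N ℕ.* L) ℕ.+ 4 ℕ.* (c ℕ.* (L ℕ.+ L ℕ.+ suc μ))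
        ≡⟨ solve-collect N L μ c ⟩
      4 ℕ.* (2 ℕ.* (J ℕ.* L)) ℕ.+ c ℕ.* (4 ℕ.* suc μ)
        ≤⟨ ℕP.+-monoʳ-≤ (4 ℕ.* (2 ℕ.* (J ℕ.* L))) (ℕP.*-monoʳ-≤ c 4μ≤q) ⟩
      4 ℕ.* (2 ℕ.* (J ℕ.* L)) ℕ.+ c ℕ.* q
        ∎))
      where
      solve-expand : ∀ N L μ c q → 4 ℕ.* (2 ℕ.* N ℕ.* (L ℕ.+ 2 ℕ.* N ℕ.* μ ℕ.+ 2 ℕ.* (N ℕ.+ c))) ℕ.+ c ℕ.* q ≡
        8 ℕ.* (N ℕ.* L) ℕ.+ (4 ℕ.* (4 ℕ.* (N ℕ.* N)) ℕ.* (1 ℕ.+ μ) ℕ.+ c ℕ.* (16 ℕ.* N) ℕ.+ c ℕ.* q)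
      solve-expand = solve-∀
      solve-slack : ∀ q μ → 4 ℕ.* q ℕ.* (1 ℕ.+ μ) ℕ.+ (2 ℕ.* μ ℕ.+ 3) ℕ.* q ℕ.+ (2 ℕ.* μ ℕ.+ 3) ℕ.* q ℕ.+ (q ℕ.+ q) ≡ 4 ℕ.* ((2 ℕ.* μ ℕ.+ 3) ℕ.* q)
      solve-slack = solve-∀
      solve-collect : ∀ N L μ c → 8 ℕ.* (N ℕ.* L) ℕ.+ 4 ℕ.* (c ℕ.* (L ℕ.+ L ℕ.+ (1 ℕ.+ μ))) ≡ 4 ℕ.* (2 ℕ.* ((N ℕ.+ c) ℕ.* L)) ℕ.+ c ℕ.* (4 ℕ.* (1 ℕ.+ μ))
      solve-collect = solve-∀

    weil-constant : ℕ
    weil-constant = 6 ℕ.* μ ℕ.+ 6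

    -- As M = 2N, Stepanov's inequality reads 2N n₁ ≤ Nq + O(q). Writing q in Nq as n₀ + n₁ + n₂ and
    -- cancelling N n₁ compares n₁ with n₂. Lower order terms cost (4μ + 6)q and the n₀ zeros of u
    -- another 2μq, whence `weil-constant`.
    one-sided : ∀ e → L ≤ q → e ≤ q → ∀ n₀ n₁ n₂ → n₀ ≤ μ → n₀ ℕ.+ (n₁ ℕ.+ n₂) ≡ q →
      n₁ ℕ.* M < suc (M ℕ.* μ) ℕ.+ (L ℕ.+ J ℕ.* q ℕ.+ suc (e ℕ.* μ)) → N ℕ.* n₁ ≤ N ℕ.* n₂ ℕ.+ weil-constant ℕ.* q
    one-sided e L≤q e≤q n₀ n₁ n₂ n₀≤μ total h = ℕP.+-cancelˡ-≤ (N ℕ.* n₁) _ _ (begin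
      N ℕ.* n₁ ℕ.+ N ℕ.* n₁                               ≡⟨ eq₁ N n₁ ⟩
      n₁ ℕ.* M                                            ≤⟨ ℕP.<⇒≤ h ⟩
      suc (M ℕ.* μ) ℕ.+ (L ℕ.+ J ℕ.* q ℕ.+ suc (e ℕ.* μ)) ≡⟨ eq₂ N L μ q e ⟩
      N ℕ.* q ℕ.+ (2 ℕ.+ M ℕ.* μ ℕ.+ L ℕ.+ e ℕ.* μ ℕ.+ c ℕ.* q)    ≤⟨ ℕP.+-monoʳ-≤ (N ℕ.* q) (ℕP.+-monoˡ-≤ (c ℕ.* q) (ℕP.+-mono-≤ (ℕP.+-mono-≤ (ℕP.+-mono-≤ 2≤2q (ℕP.*-monoˡ-≤ μ M≤q)) L≤q) (ℕP.*-monoˡ-≤ μ e≤q))) ⟩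
      N ℕ.* q ℕ.+ (2 ℕ.* q ℕ.+ q ℕ.* μ ℕ.+ q ℕ.+ q ℕ.* μ ℕ.+ c ℕ.* q)    ≡⟨ ≡.cong (λ z → N ℕ.* z ℕ.+ (2 ℕ.* q ℕ.+ q ℕ.* μ ℕ.+ q ℕ.+ q ℕ.* μ ℕ.+ c ℕ.* q)) (≡.sym total) ⟩
      N ℕ.* (n₀ ℕ.+ (n₁ ℕ.+ n₂)) ℕ.+ (2 ℕ.* q ℕ.+ q ℕ.* μ ℕ.+ q ℕ.+ q ℕ.* μ ℕ.+ c ℕ.* q)  ≡⟨ eq₃ N n₀ n₁ n₂ q μ ⟩
      N ℕ.* n₁ ℕ.+ (N ℕ.* n₂ ℕ.+ (N ℕ.* n₀ ℕ.+ (4 ℕ.* μ ℕ.+ 6) ℕ.* q))   ≤⟨ ℕP.+-monoʳ-≤ (N ℕ.* n₁) (ℕP.+-monoʳ-≤ (N ℕ.* n₂) (ℕP.+-monoˡ-≤ _ (ℕP.*-mono-≤ N≤2q n₀≤μ))) ⟩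
      N ℕ.* n₁ ℕ.+ (N ℕ.* n₂ ℕ.+ (2 ℕ.* q ℕ.* μ ℕ.+ (4 ℕ.* μ ℕ.+ 6) ℕ.* q)) ≡⟨ eq₄ N n₁ n₂ q μ ⟩
      N ℕ.* n₁ ℕ.+ (N ℕ.* n₂ ℕ.+ weil-constant ℕ.* q)     ∎)
      where
      2≤2q : 2 ≤ 2 ℕ.* q
      2≤2q = ℕP.≤-trans (s≤s (s≤s (z≤n {46}))) (ℕP.≤-trans 48≤q (ℕP.m≤m+n q (q ℕ.+ 0)))
      N≤2q : N ≤ 2 ℕ.* q
      N≤2q = ℕP.≤-trans (ℕP.m≤m+n N _) (ℕP.≤-trans 16N≤q (ℕP.m≤m+n q _))
      eq₁ : ∀ N n → N ℕ.* n ℕ.+ N ℕ.* n ≡ n ℕ.* (2 ℕ.* N)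
      eq₁ = solve-∀
      eq₂ : ∀ N L μ q e → suc (2 ℕ.* N ℕ.* μ) ℕ.+ (L ℕ.+ (N ℕ.+ (2 ℕ.* μ ℕ.+ 3)) ℕ.* q ℕ.+ suc (e ℕ.* μ)) ≡
        N ℕ.* q ℕ.+ (2 ℕ.+ 2 ℕ.* N ℕ.* μ ℕ.+ L ℕ.+ e ℕ.* μ ℕ.+ (2 ℕ.* μ ℕ.+ 3) ℕ.* q)
      eq₂ = solve-∀
      eq₃ : ∀ N n₀ n₁ n₂ q μ → N ℕ.* (n₀ ℕ.+ (n₁ ℕ.+ n₂)) ℕ.+ (2 ℕ.* q ℕ.+ q ℕ.* μ ℕ.+ q ℕ.+ q ℕ.* μ ℕ.+ (2 ℕ.* μ ℕ.+ 3) ℕ.* q) ≡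
        N ℕ.* n₁ ℕ.+ (N ℕ.* n₂ ℕ.+ (N ℕ.* n₀ ℕ.+ (4 ℕ.* μ ℕ.+ 6) ℕ.* q))
      eq₃ = solve-∀
      eq₄ : ∀ N n₁ n₂ q μ → N ℕ.* n₁ ℕ.+ (N ℕ.* n₂ ℕ.+ (2 ℕ.* q ℕ.* μ ℕ.+ (4 ℕ.* μ ℕ.+ 6) ℕ.* q)) ≡ N ℕ.* n₁ ℕ.+ (N ℕ.* n₂ ℕ.+ (6 ℕ.* μ ℕ.+ 6) ℕ.* q)
      eq₄ = solve-∀

  module _ (k : ℕ) (prime : Prime (suc k)) (e : ℕ) (k≡ : k ≡ e ℕ.+ e) where
    open Zmod k prime
    open Euler e k≡
    open Kit ℤmod using (_≈_; _^_)
    open Poly ℤmod using (eval; coef; C; _≋_; at; module P)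
    open Domain ℤmod _≟_ domain using (Distinct; too-many-simple-roots)

    module _ (u : List ℤ) (μ : ℕ) (length-u : length u ≤ μ) (1≤μ : 1 ≤ μ)
      (nonsquare : ∀ r s → r P.* r P.* u ≋ C (coef u 0) P.* (s P.* s) → r ≋ [] × s ≋ [])
      (48≤ℓ : 48 ≤ ℓ) (4μ≤ℓ : 4 ℕ.* suc μ ≤ ℓ) where

      private
        χ : ℕ → ℤ
        χ t = legendre ℓ (eval (+ t) u)

        χ-sign : ∀ t → χ t ≡ + 0 ⊎ χ t ≡ + 1 ⊎ χ t ≡ -[1+ 0 ]
        χ-sign t with legendre ℓ (eval (+ t) u) | euler (eval (+ t) u)
        ... | _ | divisible _ = inj₁ ≡.refl
        ... | _ | residue _ = inj₂ (inj₁ ≡.refl)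
        ... | _ | nonresidue _ = inj₂ (inj₂ ≡.refl)

        level-set : ℤ → List ℕ
        level-set c = filter (λ t → χ t ℤ.≟ c) (upTo ℓ)

        pts : ℤ → List ℤ
        pts c = map +_ (level-set c)

        pts-distinct : ∀ c → Distinct (pts c)
        pts-distinct c = AllPairsP.map⁺ (AllPairsP.filter⁺ (λ t → χ t ℤ.≟ c)
          (AllPairsP.applyUpTo⁺₁ (λ t → t) ℓ (λ i<j j<ℓ eq → ℕP.<⇒≢ i<j (small-≈⇒≡ (ℕP.<-trans i<j j<ℓ) j<ℓ eq))))

        length-pts : ∀ c → length (pts c) ≡ length (level-set c)
        length-pts c = ListP.length-map +_ (level-set c)

        all-pts : ∀ c → All (λ x → legendre ℓ (eval x u) ≡ c) (pts c)
        all-pts c = AllP.map⁺ (AllP.all-filter (λ t → χ t ℤ.≟ c) (upTo ℓ))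

        value₁ : ∀ {x} → legendre ℓ (eval x u) ≡ + 1 → eval x u ^ e ≈ + 1
        value₁ {x} eq with legendre ℓ (eval x u) | euler (eval x u)
        value₁ eq | _ | residue h = h
        value₁ () | _ | divisible _
        value₁ () | _ | nonresidue _

        value₂ : ∀ {x} → legendre ℓ (eval x u) ≡ -[1+ 0 ] → eval x u ^ e ≈ -[1+ 0 ]
        value₂ {x} eq with legendre ℓ (eval x u) | euler (eval x u)
        value₂ eq | _ | nonresidue h = h
        value₂ () | _ | divisible _
        value₂ () | _ | residue _

        value₀ : ∀ {x} → legendre ℓ (eval x u) ≡ + 0 → eval x u ≈ + 0
        value₀ {x} eq with legendre ℓ (eval x u) | euler (eval x u)
        value₀ eq | _ | divisible h = h
        value₀ () | _ | residue _
        value₀ () | _ | nonresidue _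

        module S = Stepanov ℤmod _≟_ domain 1≉0
        module A = S.Auxiliary ℓ e (≡.cong suc k≡) char char< u (F.fermat (coef u 0)) nonsquare μ length-u 1≤μ

        zeros-few : length (level-set (+ 0)) ≤ μ
        zeros-few with length (level-set (+ 0)) ℕP.≤? μ
        ... | yes l = l
        ... | no ¬l = contradiction (at (proj₁ (nonsquare P.1# [] (P.trans (P.*-congˡ u≋[]) (P.trans (P.zeroʳ _) (P.sym (P.trans (P.*-congˡ (P.zeroʳ [])) (P.zeroʳ _))))))) 0) 1≉0
          where
          u≋[] : u ≋ []
          u≋[] = too-many-simple-roots (pts (+ 0)) u (pts-distinct (+ 0)) (All.map value₀ (all-pts (+ 0)))
            (ℕP.≤-trans length-u (ℕP.≤-trans (ℕP.<⇒≤ (ℕP.≰⇒> ¬l)) (ℕP.≤-reflexive (≡.sym (length-pts (+ 0))))))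

      -- The one-sided estimate for both signs bounds the difference of the two counts, which is the
      -- sum. Taking N of the order of √ℓ yields O(√ℓ).
      weil : ∀ N → 4 ℕ.* (N ℕ.* N) ≤ ℓ → N ℕ.* ∣ sumL (upTo ℓ) (λ t → legendre ℓ (eval (+ t) u)) ∣ ≤ (6 ℕ.* μ ℕ.+ 6) ℕ.* ℓ
      weil N 4N²≤ℓ = ≡.subst (λ z → N ℕ.* ∣ z ∣ ≤ weil-constant ℕ.* ℓ) (≡.sym (proj₁ signs))
        (*∣⊖∣-≤ N (length (level-set (+ 1))) (length (level-set -[1+ 0 ])) (weil-constant ℕ.* ℓ)
          (one-sided e L≤ℓ e≤ℓ _ _ _ zeros-few total (bound (+ 1) (All.map (λ h → F.fermat _ , value₁ h) (all-pts (+ 1)))))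
          (one-sided e L≤ℓ e≤ℓ _ _ _ zeros-few (≡.trans (≡.cong (length (level-set (+ 0)) ℕ.+_) (ℕP.+-comm (length (level-set -[1+ 0 ])) _)) total)
            (bound -[1+ 0 ] (All.map (λ h → F.fermat _ , value₂ h) (all-pts -[1+ 0 ])))))
        where
        signs = sum-signs χ χ-sign (upTo ℓ)
        total : length (level-set (+ 0)) ℕ.+ (length (level-set (+ 1)) ℕ.+ length (level-set -[1+ 0 ])) ≡ ℓ
        total = ≡.trans (proj₂ signs) (ListP.length-upTo ℓ)
        μ≤ℓ : μ ≤ ℓ
        μ≤ℓ = ℕP.≤-trans (ℕP.n≤1+n μ) (ℕP.≤-trans (ℕP.m≤m+n (suc μ) _) 4μ≤ℓ)
        -- The largest L with 2L + μ ≤ ℓ: `nonvanishing` allows no more, and the count of unknowns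
        -- needs almost all of it.
        L : ℕ
        L = proj₁ (half (ℓ ℕ.∸ μ))
        2L+μ≤ℓ : L ℕ.+ L ℕ.+ μ ≤ ℓ
        2L+μ≤ℓ with half (ℓ ℕ.∸ μ)
        ... | h , inj₁ eq = ℕP.≤-reflexive (≡.trans (≡.cong (ℕ._+ μ) (≡.sym eq)) (ℕP.m∸n+n≡m μ≤ℓ))
        ... | h , inj₂ eq = ℕP.≤-trans (ℕP.n≤1+n _) (ℕP.≤-reflexive (≡.trans (≡.cong (ℕ._+ μ) (≡.sym eq)) (ℕP.m∸n+n≡m μ≤ℓ)))
        ℓ≤2L+μ+1 : ℓ ≤ L ℕ.+ L ℕ.+ suc μ
        ℓ≤2L+μ+1 with half (ℓ ℕ.∸ μ)
        ... | h , inj₁ eq = ℕP.≤-trans (ℕP.≤-reflexive (≡.trans (≡.sym (ℕP.m∸n+n≡m μ≤ℓ)) (≡.cong (ℕ._+ μ) eq))) (ℕP.+-monoʳ-≤ (h ℕ.+ h) (ℕP.n≤1+n μ))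
        ... | h , inj₂ eq = ℕP.≤-reflexive (≡.trans (≡.sym (ℕP.m∸n+n≡m μ≤ℓ)) (≡.trans (≡.cong (ℕ._+ μ) eq) (≡.sym (ℕP.+-suc (h ℕ.+ h) μ))))
        L≤ℓ : L ≤ ℓ
        L≤ℓ = ℕP.≤-trans (ℕP.m≤m+n L L) (ℕP.≤-trans (ℕP.m≤m+n _ μ) 2L+μ≤ℓ)
        e≤ℓ : e ≤ ℓ
        e≤ℓ = ℕP.≤-trans (ℕP.m≤m+n e e) (ℕP.≤-trans (ℕP.≤-reflexive (≡.sym k≡)) (ℕP.n≤1+n k))
        open Parameters ℓ μ N L 4N²≤ℓ 48≤ℓ 4μ≤ℓ ℓ≤2L+μ+1
        bound : ∀ c → All (λ x → x ^ ℓ ≈ x × eval x u ^ e ≈ c) (pts c) →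
          length (level-set c) ℕ.* M < suc (M ℕ.* μ) ℕ.+ (L ℕ.+ J ℕ.* ℓ ℕ.+ suc (e ℕ.* μ))
        bound c h = ≡.subst (λ n → n ℕ.* M < suc (M ℕ.* μ) ℕ.+ (L ℕ.+ J ℕ.* ℓ ℕ.+ suc (e ℕ.* μ))) (length-pts c)
          (A.stepanov M L J c M≤q 2L+μ≤ℓ dimensions (pts c) (pts-distinct c) h)

-- The universal square root series

module Sqrt (R : CommutativeRing 0ℓ 0ℓ) where
  open Kit R
  open Poly R

  -- With δ = 4 u₀ the square root of u(δ t) / u₀ is 1 + 2 t β(t), where β + t β² = γ and γₙ = δⁿ uₙ₊₁;
  -- so the coefficients of β are integer polynomials in those of u.
  δ : Seq → Carrier
  δ u = ι (+ 4) * u 0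

  γ : Seq → Seq
  γ u n = δ u ^ n * u (suc n)

  -- The equation β = γ - t β² as a recursion: coefficient n + 1 of the right-hand side involves β
  -- only up to index n.
  Φ : Seq → Seq → Seq
  Φ u b zero = γ u 0
  Φ u b (suc n) = γ u (suc n) - mul b b n

  -- The i-th iterate is correct in its first i coefficients. As a finite ring expression it lets
  -- homomorphisms, degrees and norms be followed by induction on i.
  sqrt : Seq → ℕ → Seq
  sqrt u zero = λ _ → 0#
  sqrt u (suc i) = Φ u (sqrt u i)

  Φ-agree : ∀ u N {b c : Seq} → (∀ k → k < N → b k ≈ c k) → ∀ k → k < suc N → Φ u b k ≈ Φ u c k
  Φ-agree u N e zero l = refl
  Φ-agree u N e (suc k) (s≤s k<N) = +-congˡ (-‿cong (mul-cong-≤ k (λ j j≤k → e j (ℕP.≤-<-trans j≤k k<N)) (λ j j≤k → e j (ℕP.≤-<-trans j≤k k<N))))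

  sqrt-stable : ∀ u N k → k < N → sqrt u N k ≈ Φ u (sqrt u N) k
  sqrt-stable u (suc N) = Φ-agree u N (sqrt-stable u N)

  sqrt-unique : ∀ u (b : Seq) → (∀ k → b k ≈ Φ u b k) → ∀ N k → k < N → b k ≈ sqrt u N k
  sqrt-unique u b fix (suc N) k l = trans (fix k) (Φ-agree u N (sqrt-unique u b fix N) k l)

  mul-rescale : ∀ a d (p q : Seq) n → mul (λ k → a * d ^ k * p k) (λ k → a * d ^ k * q k) n ≈ a * a * d ^ n * mul p q n
  mul-rescale a d p q n = go a a p q n
    where
    go : ∀ a b p q n → mul (λ k → a * d ^ k * p k) (λ k → b * d ^ k * q k) n ≈ a * b * d ^ n * mul p q n
    go a b p q zero = trans (solve 5 (λ a b o p q → (a :* o :* p) :* (b :* o :* q) := a :* b :* (o :* o) :* (p :* q)) refl a b 1# (p 0) (q 0))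
      (*-congʳ (*-congˡ (*-identityˡ 1#)))
    go a b p q (suc n) = begin
      (a * 1# * p 0) * (b * (d * d ^ n) * q (suc n)) + mul (λ k → a * (d * d ^ k) * p (suc k)) (λ k → b * d ^ k * q k) n
        ≈⟨ +-cong (*-congʳ (*-congʳ (*-identityʳ a))) (mul-cong {q = λ k → b * d ^ k * q k} (λ k → *-congʳ (sym (*-assoc a d (d ^ k)))) (λ _ → refl) n) ⟩
      (a * p 0) * (b * (d * d ^ n) * q (suc n)) + mul (λ k → a * d * d ^ k * p (suc k)) (λ k → b * d ^ k * q k) n
        ≈⟨ +-congˡ (go (a * d) b (tl p) q n) ⟩
      (a * p 0) * (b * (d * d ^ n) * q (suc n)) + a * d * b * d ^ n * mul (tl p) q n
        ≈⟨ solve 7 (λ a b d e p q r → (a :* p) :* (b :* (d :* e) :* q) :+ a :* d :* b :* e :* r := a :* b :* (d :* e) :* (p :* q :+ r)) refl a b d (d ^ n) (p 0) (q (suc n)) (mul (tl p) q n) ⟩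
      a * b * (d * d ^ n) * (p 0 * q (suc n) + mul (tl p) q n) ∎

  -- The root of u(δ t)/u₀ is q(δ t) = 1 + 2 t β(t), so β_k is half of δ^(k+1) q_(k+1); since δ = 4
  -- u₀, half of δ is 2 u₀ and no division is left.
  sqrt-of-square : ∀ (u q : Seq) → (∀ n → u n ≈ u 0 * mul q q n) → q 0 ≈ 1# → ∀ N k → k < N → ι (+ 2) * u 0 * δ u ^ k * q (suc k) ≈ sqrt u N k
  sqrt-of-square u q sq q0 = sqrt-unique u b fix
    where
    b : Seq
    b k = ι (+ 2) * u 0 * δ u ^ k * tl q k
    double : ∀ n → mul q q (suc n) ≈ (q (suc n) + mul (tl q) q n)
    double n = +-congʳ (trans (*-congʳ q0) (*-identityˡ _))
    fix : ∀ k → b k ≈ Φ u b k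
    fix zero = sym (begin
      1# * u 1                        ≈⟨ trans (*-identityˡ _) (sq 1) ⟩
      u 0 * mul q q 1                 ≈⟨ *-congˡ (trans (double 0) (+-congˡ (trans (*-congˡ q0) (*-identityʳ _)))) ⟩
      u 0 * (q 1 + q 1)               ≈⟨ solve 2 (λ u q → u :* (q :+ q) := con (+ 2) :* u :* q) refl (u 0) (q 1) ⟩
      ι (+ 2) * u 0 * q 1             ≈⟨ *-congʳ (*-identityʳ _) ⟨
      b 0                             ∎)
    fix (suc n) = sym (begin
      δ u ^ suc n * u (suc (suc n)) - mul b b n
        ≈⟨ +-cong (*-congˡ (trans (sq (suc (suc n))) (*-congˡ (trans (double (suc n)) (+-congˡ (trans (mul-sucʳ (tl q) q n) (+-congʳ (trans (*-congˡ q0) (*-identityʳ _)))))))))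
               (-‿cong (mul-rescale (ι (+ 2) * u 0) (δ u) (tl q) (tl q) n)) ⟩
      δ u * δ u ^ n * (u 0 * (q (suc (suc n)) + (q (suc (suc n)) + w))) - ι (+ 2) * u 0 * (ι (+ 2) * u 0) * δ u ^ n * w
        ≈⟨ solve 4 (λ u d q w → (con (+ 4) :* u) :* d :* (u :* (q :+ (q :+ w))) :- con (+ 2) :* u :* (con (+ 2) :* u) :* d :* w := con (+ 2) :* u :* ((con (+ 4) :* u) :* d) :* q) refl (u 0) (δ u ^ n) (q (suc (suc n))) w ⟩
      b (suc n) ∎)
      where w = mul (tl q) (tl q) n

  rescale : Carrier → List Carrier → List Carrier
  rescale d [] = []
  rescale d (c ∷ p) = c ∷ scale d (rescale d p)

  coef-rescale : ∀ d p n → coef (rescale d p) n ≈ d ^ n * coef p n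
  coef-rescale d [] n = sym (zeroʳ _)
  coef-rescale d (c ∷ p) zero = sym (*-identityˡ c)
  coef-rescale d (c ∷ p) (suc n) = trans (coef-scale d (rescale d p) n) (trans (*-congˡ (coef-rescale d p n)) (sym (*-assoc _ _ _)))

  eval-rescale : ∀ d z p → eval z (rescale d p) ≈ eval (z * d) p
  eval-rescale d z [] = refl
  eval-rescale d z (c ∷ p) = +-congˡ (trans (*-congˡ (trans (eval-scale z d (rescale d p)) (*-congˡ (eval-rescale d z p)))) (sym (*-assoc _ _ _)))

  -- 1 + 2 t β(t) truncated at degree h.
  root : Seq → ℕ → ℕ → List Carrier
  root w m h = 1# ∷ scale (ι (+ 2)) (tab h (sqrt w m))

  module _ (u : List Carrier) (m h : ℕ) (length-u : length u ≤ suc m) (2h≤m : h ℕ.+ h ≤ m)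
    (small : ∀ k → h ≤ k → k < m → sqrt (coef u) m k ≈ 0#) where
    private
      β = sqrt (coef u) m
      T = tab h β
      u₀ = coef u 0
      d = δ (coef u)

      h≤m : h ≤ m
      h≤m = ℕP.≤-trans (ℕP.m≤m+n h h) 2h≤m

    private
      T≈β : ∀ k → k < m → coef T k ≈ β k
      T≈β k k<m with k ℕP.<? h
      ... | yes k<h = coef-tab h β k k<h
      ... | no k≮h = trans (coef-tab-≥ h β k (ℕP.≮⇒≥ k≮h)) (sym (small k (ℕP.≮⇒≥ k≮h) k<m))

      TT-beyond : ∀ n → m ≤ suc n → mul (coef T) (coef T) n ≈ 0#
      TT-beyond n m≤ = go h 2h≤m
        where
        go : ∀ h → h ℕ.+ h ≤ m → mul (coef (tab h β)) (coef (tab h β)) n ≈ 0#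
        go zero _ = mul-zeroˡ _ (coef []) n (λ _ _ → refl)
        go (suc h) l = mul-deg h h _ _ (λ k h<k → coef-tab-≥ (suc h) β k h<k) (λ k h<k → coef-tab-≥ (suc h) β k h<k) n
          (ℕP.≤-pred (ℕP.≤-trans (ℕP.≤-reflexive (≡.sym (≡.cong suc (ℕP.+-suc h h)))) (ℕP.≤-trans l m≤)))

      -- Below m this is the fixed point equation, truncation being harmless by `small`. From m on
      -- both sides are zero: the right one since u has degree at most m, the left one since T and X
      -- T² have degree below 2h ≤ m.
      γ≈ : ∀ n → coef (T P.+ X P.* (T P.* T)) n ≈ γ (coef u) n
      γ≈ n = trans (coef-add T _ n) (trans (+-congˡ (at (X* (T P.* T)) n)) (go n))
        where
        go : ∀ n → coef T n + coef (0# ∷ (T P.* T)) n ≈ γ (coef u) n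
        go n with n ℕP.<? m
        go zero | yes n<m = trans (+-identityʳ _) (trans (T≈β 0 n<m) (sqrt-stable (coef u) m 0 n<m))
        go (suc n) | yes n<m = begin
          coef T (suc n) + coef (T P.* T) n              ≈⟨ +-cong (trans (T≈β (suc n) n<m) (sqrt-stable (coef u) m (suc n) n<m)) (trans (coef-mul T T n) (mul-cong-≤ n below below)) ⟩
          (γ (coef u) (suc n) - mul β β n) + mul β β n   ≈⟨ solve 2 (λ g x → (g :- x) :+ x := g) refl _ _ ⟩
          γ (coef u) (suc n)                             ∎
          where
          below : ∀ k → k ≤ n → coef T k ≈ β k
          below k k≤n = T≈β k (ℕP.<-trans (s≤s k≤n) n<m)
        go n | no n≮m = trans (+-cong (coef-tab-≥ h β n (ℕP.≤-trans h≤m (ℕP.≮⇒≥ n≮m))) (tail n (ℕP.≮⇒≥ n≮m)))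
          (trans (+-identityʳ _) (sym (trans (*-congˡ (coef-≥length u (suc n) (ℕP.≤-trans length-u (s≤s (ℕP.≮⇒≥ n≮m))))) (zeroʳ _))))
          where
          tail : ∀ n → m ≤ n → coef (0# ∷ (T P.* T)) n ≈ 0#
          tail zero _ = refl
          tail (suc n) l = trans (coef-mul T T n) (TT-beyond n l)

      ρ : List Carrier
      ρ = root (coef u) m h

      root² : ρ P.* ρ ≋ P.1# P.+ X P.* (C (ι (+ 4)) P.* (T P.+ X P.* (T P.* T)))
      root² = P.begin
        ρ P.* ρ                                                  P.≈⟨ P.*-cong root≋ root≋ ⟩
        (P.1# P.+ X P.* (two P.* T)) P.* (P.1# P.+ X P.* (two P.* T))  P.≈⟨ P.solve 4 (λ o x t T → (o P.:+ x P.:* (t P.:* T)) P.:* (o P.:+ x P.:* (t P.:* T)) P.:=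
             o P.:* o P.:+ x P.:* ((o P.:* t P.:+ o P.:* t) P.:* T P.:+ (t P.:* t) P.:* (x P.:* (T P.:* T)))) P.refl P.1# X two T ⟩
        P.1# P.* P.1# P.+ X P.* ((P.1# P.* two P.+ P.1# P.* two) P.* T P.+ (two P.* two) P.* (X P.* (T P.* T)))
            P.≈⟨ P.+-cong (P.*-identityˡ _) (P.*-congˡ (P.+-cong (P.*-congʳ (P.trans (P.+-cong (P.*-identityˡ _) (P.*-identityˡ _)) (P.trans (P.sym (C-+ _ _)) (C-cong (sym (ι-+ (+ 2) (+ 2)))))))
                 (P.*-congʳ (P.trans (P.sym (C-* _ _)) (C-cong (sym (ι-* (+ 2) (+ 2)))))))) ⟩
        P.1# P.+ X P.* (C (ι (+ 4)) P.* T P.+ C (ι (+ 4)) P.* (X P.* (T P.* T)))   P.≈⟨ P.+-congˡ (P.*-congˡ (P.sym (P.distribˡ (C (ι (+ 4))) _ _))) ⟩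
        P.1# P.+ X P.* (C (ι (+ 4)) P.* (T P.+ X P.* (T P.* T))) P.∎
        where
        two = C (ι (+ 2))
        root≋ : ρ ≋ P.1# P.+ X P.* (two P.* T)
        root≋ = P.trans (cons≋ 1# _) (P.+-congˡ (P.*-congˡ (scale≋C* (ι (+ 2)) T)))

      rescale≋ : rescale d u ≋ C u₀ P.* (ρ P.* ρ)
      rescale≋ = P.trans (mk≋ λ n → trans (coef-rescale d u n) (sym (trans (coef-scale u₀ W n) (go n)))) (P.trans (scale≋C* u₀ W) (P.*-congˡ (P.sym root²)))
        where
        V = T P.+ X P.* (T P.* T)
        W = P.1# P.+ X P.* (C (ι (+ 4)) P.* V)
        coef-W : ∀ n → coef W n ≈ coef P.1# n + coef (0# ∷ scale (ι (+ 4)) V) n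
        coef-W n = trans (coef-add P.1# _ n) (+-congˡ (at (P.trans (X* _) (∷-cong refl (P.sym (scale≋C* (ι (+ 4)) V)))) n))
        go : ∀ n → u₀ * coef W n ≈ d ^ n * coef u n
        go zero = trans (*-congˡ (trans (coef-W 0) (+-identityʳ _))) (trans (*-identityʳ _) (sym (*-identityˡ _)))
        go (suc n) = begin
          u₀ * coef W (suc n)                             ≈⟨ *-congˡ (trans (coef-W (suc n)) (trans (+-identityˡ _) (trans (coef-scale (ι (+ 4)) V n) (*-congˡ (γ≈ n))))) ⟩
          u₀ * (ι (+ 4) * (d ^ n * coef u (suc n)))       ≈⟨ solve 4 (λ u f e c → u :* (f :* (e :* c)) := f :* u :* e :* c) refl u₀ (ι (+ 4)) (d ^ n) _ ⟩
          d * d ^ n * coef u (suc n)                      ∎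

    -- The identity u(δ t) = u₀ ρ(t)² is read at t = z = 1/δ, which undoes the rescaling.
    eval-square : ∀ z → z * δ (coef u) ≈ 1# → eval 1# u ≈ coef u 0 * (eval z (root (coef u) m h) * eval z (root (coef u) m h))
    eval-square z zd = begin
      eval 1# u                            ≈⟨ eval-point u (sym zd) ⟩
      eval (z * d) u                       ≈⟨ eval-rescale d z u ⟨
      eval z (rescale d u)                 ≈⟨ eval-cong z rescale≋ ⟩
      eval z (C u₀ P.* (ρ P.* ρ))    ≈⟨ trans (eval-* z (C u₀) _) (*-cong (eval-C z u₀) (eval-* z ρ ρ)) ⟩
      u₀ * (eval z ρ * eval z ρ)           ∎

-- Certificates that u is not u(0) times a square

module Certificate (R : CommutativeRing 0ℓ 0ℓ)
  (_≟_ : Discrete R)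
  (domain : NoZeroDivisors R)
  (inverse : HasInverses R) where
  open Kit R
  open Poly R
  open Domain R _≟_ domain
  open Field R _≟_ domain inverse
  open Sqrt R

  cancel : ∀ {a b c} → ¬ a ≈ 0# → a * b ≈ a * c → b ≈ c
  cancel {a} {b} {c} a≉0 e with domain a (b - c) (trans (solve 3 (λ a b c → a :* (b :- c) := a :* b :- a :* c) refl a b c) (trans (+-congʳ e) (-‿inverseʳ _)))
  ... | inj₁ z = contradiction z a≉0
  ... | inj₂ z = x∙y⁻¹≈ε⇒x≈y b c z

  module _ (u : List Carrier) (m h : ℕ) (length-u : length u ≤ suc m) (m≤2h+1 : m ≤ suc (h ℕ.+ h)) (u₀≉0 : ¬ coef u 0 ≈ 0#) where
    private
      u₀ = coef u 0

    module _ (q : List Carrier) (u≋ : u ≋ C u₀ P.* (q P.* q)) where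
      coef-u : ∀ n → coef u n ≈ u₀ * mul (coef q) (coef q) n
      coef-u n = trans (at u≋ n) (trans (sym (at (scale≋C* u₀ _) n)) (trans (coef-scale u₀ (q P.* q) n) (*-congˡ (coef-mul q q n))))

      q≉[] : ¬ q ≋ []
      q≉[] z = u₀≉0 (trans (coef-u 0) (trans (*-congˡ (trans (*-congʳ (at z 0)) (zeroˡ _))) (zeroʳ _)))

      -- If q had degree j > h, then u would have the nonzero coefficient u₀ q_j² at index 2j ≥ 2h +
      -- 2 > m.
      coef-q-beyond : ∀ k → h < k → coef q k ≈ 0#
      coef-q-beyond k h<k with degree q q≉[]
      ... | j , nz , z with k ℕP.≤? j
      ...   | no k≰j = z k (ℕP.≰⇒> k≰j)
      ...   | yes k≤j = contradiction sq nz
        where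
        m<2j : suc m ≤ j ℕ.+ j
        m<2j = ℕP.≤-trans (s≤s m≤2h+1) (ℕP.≤-trans (ℕP.≤-reflexive (≡.sym (≡.cong suc (ℕP.+-suc h h)))) (ℕP.+-mono-≤ (ℕP.≤-trans h<k k≤j) (ℕP.≤-trans h<k k≤j)))
        sq : coef q j ≈ 0#
        sq with domain u₀ _ (trans (sym (coef-u (j ℕ.+ j))) (coef-≥length u (j ℕ.+ j) (ℕP.≤-trans length-u m<2j)))
        ... | inj₁ bad = contradiction bad u₀≉0
        ... | inj₂ e with domain (coef q j) (coef q j) (trans (sym (mul-top j j (coef q) (coef q) z z)) e)
        ...   | inj₁ e′ = e′
        ...   | inj₂ e′ = e′

      vanish : coef q 0 ≈ 1# → ∀ k → h ≤ k → k < m → sqrt (coef u) m k ≈ 0#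
      vanish q0 k h≤k k<m = trans (sym (sqrt-of-square (coef u) (coef q) coef-u q0 m k k<m)) (trans (*-congˡ (coef-q-beyond (suc k) (s≤s h≤k))) (zeroʳ _))

      q₀² : coef q 0 * coef q 0 ≈ 1#
      q₀² = cancel u₀≉0 (trans (sym (coef-u 0)) (sym (*-identityʳ _)))

    -- The series belongs to the root with constant term 1. As q(0)² = 1, either q or -q is that
    -- root.
    square⇒sqrt-vanishes : ∀ q → u ≋ C u₀ P.* (q P.* q) → ∀ k → h ≤ k → k < m → sqrt (coef u) m k ≈ 0#
    square⇒sqrt-vanishes q u≋ with domain (coef q 0 - 1#) (coef q 0 + 1#)
      (trans (solve 2 (λ x o → (x :- o) :* (x :+ o) := x :* x :- o :* o) refl (coef q 0) 1#) (trans (+-cong (q₀² q u≋) (-‿cong (*-identityˡ 1#))) (-‿inverseʳ _)))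
    ... | inj₁ z = vanish q u≋ (x∙y⁻¹≈ε⇒x≈y _ _ z)
    ... | inj₂ z = vanish (P.- q) (P.trans u≋ (P.*-congˡ (P.solve 1 (λ q → q P.:* q P.:= (P.:- q) P.:* (P.:- q)) P.refl q)))
       (trans (coef-neg q 0) (trans (solve 2 (λ x o → :- x := o :- (x :+ o)) refl (coef q 0) 1#) (trans (+-congˡ (trans (-‿cong z) -0#≈0#)) (+-identityʳ _))))

    -- A relation with r ≠ 0 gives r² (u₀ u) = (u₀ s)². By integral closure u₀ u = q² with a
    -- polynomial q, so u = u₀ (q/u₀)², and all these coefficients would vanish.
    certificate : ∀ n → h ≤ n → n < m → ¬ sqrt (coef u) m n ≈ 0# →
      ∀ r s → r P.* r P.* u ≋ C u₀ P.* (s P.* s) → r ≋ [] × s ≋ []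
    certificate n h≤n n<m nz r s e with zero? r
    ... | yes r≋[] = r≋[] , s≋[]
      where
      zero-product : C u₀ P.* (s P.* s) ≋ []
      zero-product = P.trans (P.sym e) (P.trans (P.*-congʳ (P.trans (P.*-congʳ r≋[]) (P.zeroˡ r))) (P.zeroˡ u))
      s≋[] : s ≋ []
      s≋[] with poly-domain (C u₀) (s P.* s) zero-product
      ... | inj₁ z = contradiction (at z 0) u₀≉0
      ... | inj₂ z with poly-domain s s z
      ...   | inj₁ z′ = z′
      ...   | inj₂ z′ = z′
    ... | no r≉[] with inverse u₀ u₀≉0 | square-root-is-polynomial (length r) r (C u₀ P.* s) (C u₀ P.* u) (coef-≥length r) r≉[]
          (P.trans (P.solve 3 (λ r c u → r P.:* r P.:* (c P.:* u) P.:= c P.:* (r P.:* r P.:* u)) P.refl r (C u₀) u)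
            (P.trans (P.*-congˡ e) (P.solve 2 (λ c s → c P.:* (c P.:* (s P.:* s)) P.:= (c P.:* s) P.:* (c P.:* s)) P.refl (C u₀) s)))
    ...   | i , u₀i≈1 | q , sq = contradiction (square⇒sqrt-vanishes (C i P.* q) u≋ n h≤n n<m) nz
      where
      ci≋1 : C u₀ P.* C i ≋ P.1#
      ci≋1 = P.trans (P.sym (C-* u₀ i)) (C-cong u₀i≈1)
      u≋ : u ≋ C u₀ P.* ((C i P.* q) P.* (C i P.* q))
      u≋ = P.sym (P.begin
        C u₀ P.* ((C i P.* q) P.* (C i P.* q))        P.≈⟨ P.solve 3 (λ c i q → c P.:* ((i P.:* q) P.:* (i P.:* q)) P.:= (c P.:* i) P.:* i P.:* (q P.:* q)) P.refl (C u₀) (C i) q ⟩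
        (C u₀ P.* C i) P.* C i P.* (q P.* q)          P.≈⟨ P.*-congˡ (P.sym sq) ⟩
        (C u₀ P.* C i) P.* C i P.* (C u₀ P.* u)       P.≈⟨ P.solve 3 (λ c i u → (c P.:* i) P.:* i P.:* (c P.:* u) P.:= (c P.:* i) P.:* (c P.:* i) P.:* u) P.refl (C u₀) (C i) u ⟩
        (C u₀ P.* C i) P.* (C u₀ P.* C i) P.* u       P.≈⟨ P.*-congʳ (P.*-cong ci≋1 ci≋1) ⟩
        P.1# P.* P.1# P.* u                           P.≈⟨ P.trans (P.*-congʳ (P.*-identityˡ _)) (P.*-identityˡ u) ⟩
        u                                             P.∎)

-- Degree bounds in one variable and in the inner variable of R[s][t]

module Degree (R : CommutativeRing 0ℓ 0ℓ) where
  open Morphism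
  open Kit R
  open Poly R

  -- List lengths grow with every operation and overestimate the degree. `Deg` bounds the true
  -- degree, and `truncate` turns the bound back into a length.
  record Deg (N : ℕ) (p : List Carrier) : Set where
    constructor mkDeg
    field beyond : ∀ n → N < n → coef p n ≈ 0#
  open Deg public

  Deg-≋ : ∀ {N p q} → p ≋ q → Deg N p → Deg N q
  Deg-≋ e d = mkDeg λ n l → trans (sym (at e n)) (beyond d n l)

  Deg-mono : ∀ {M N p} → M ≤ N → Deg M p → Deg N p
  Deg-mono M≤N d = mkDeg λ n l → beyond d n (ℕP.≤-<-trans M≤N l)

  Deg-[] : ∀ {N} → Deg N []
  Deg-[] = mkDeg λ _ _ → refl

  Deg-C : ∀ {N} c → Deg N (C c)
  Deg-C c = mkDeg λ { (suc n) _ → refl }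

  Deg-linear : ∀ c d → Deg 1 (c ∷ d ∷ [])
  Deg-linear c d = mkDeg λ { (suc zero) (s≤s ()) ; (suc (suc n)) _ → refl }

  Deg-+ : ∀ {N p q} → Deg N p → Deg N q → Deg N (p P.+ q)
  Deg-+ {_} {p} {q} a b = mkDeg λ n l → trans (coef-add p q n) (trans (+-cong (beyond a n l) (beyond b n l)) (+-identityʳ 0#))

  Deg-neg : ∀ {N p} → Deg N p → Deg N (P.- p)
  Deg-neg {_} {p} a = mkDeg λ n l → trans (coef-neg p n) (trans (-‿cong (beyond a n l)) -0#≈0#)

  Deg-* : ∀ {M N p q} → Deg M p → Deg N q → Deg (M ℕ.+ N) (p P.* q)
  Deg-* {M} {N} {p} {q} a b = mkDeg λ n l → trans (coef-mul p q n) (mul-deg M N (coef p) (coef q) (beyond a) (beyond b) n l)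

  Deg-ι : ∀ {N} i → Deg N (P.ι i)
  Deg-ι i = Deg-≋ (Hom.ι-hom (C-Hom R) i) (Deg-C (ι i))

  Deg-^ : ∀ {N p} → Deg N p → ∀ n → Deg (n ℕ.* N) (p P.^ n)
  Deg-^ a zero = Deg-C 1#
  Deg-^ a (suc n) = Deg-* a (Deg-^ a n)

  truncate : ℕ → List Carrier → List Carrier
  truncate N p = tab (suc N) (coef p)

  length-truncate : ∀ N p → length (truncate N p) ≡ suc N
  length-truncate N p = length-tab (suc N) (coef p)

  truncate≋ : ∀ N p → Deg N p → truncate N p ≋ p
  truncate≋ N p a = mk≋ go
    where
    go : ∀ n → coef (truncate N p) n ≈ coef p n
    go n with n ℕP.<? suc N
    ... | yes l = coef-tab (suc N) (coef p) n l
    ... | no ¬l = trans (coef-tab-≥ (suc N) (coef p) n (ℕP.≮⇒≥ ¬l)) (sym (beyond a n (ℕP.≮⇒≥ ¬l)))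

  private
    module PP = Poly PolyRing
    module PS = Sqrt PolyRing

  -- For u in R[s][t], a common bound on the degrees in s of the coefficients of the powers of t.
  record EntryDeg (N : ℕ) (u : List (List Carrier)) : Set where
    constructor mkEntryDeg
    field entry : ∀ n → Deg N (PP.coef u n)
  open EntryDeg public

  mul-Deg : ∀ {M N} (p q : ℕ → List Carrier) n → (∀ k → k ≤ n → Deg M (p k)) → (∀ k → k ≤ n → Deg N (q k)) → Deg (M ℕ.+ N) (PP.mul p q n)
  mul-Deg p q zero a b = Deg-* (a 0 z≤n) (b 0 z≤n)
  mul-Deg p q (suc n) a b = Deg-+ (Deg-* (a 0 z≤n) (b (suc n) ℕP.≤-refl))
    (mul-Deg (PP.tl p) q n (λ k l → a (suc k) (s≤s l)) (λ k l → b k (ℕP.m≤n⇒m≤1+n l)))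

  EntryDeg-≋ : ∀ {N u v} → u PP.≋ v → EntryDeg N u → EntryDeg N v
  EntryDeg-≋ e a = mkEntryDeg λ n → Deg-≋ (PP.at e n) (entry a n)

  EntryDeg-+ : ∀ {N u v} → EntryDeg N u → EntryDeg N v → EntryDeg N (u PP.P.+ v)
  EntryDeg-+ {_} {u} {v} a b = mkEntryDeg λ n → Deg-≋ (P.sym (PP.coef-add u v n)) (Deg-+ (entry a n) (entry b n))

  EntryDeg-* : ∀ {M N u v} → EntryDeg M u → EntryDeg N v → EntryDeg (M ℕ.+ N) (u PP.P.* v)
  EntryDeg-* {_} {_} {u} {v} a b = mkEntryDeg λ n → Deg-≋ (P.sym (PP.coef-mul u v n)) (mul-Deg (PP.coef u) (PP.coef v) n (λ k _ → entry a k) (λ k _ → entry b k))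

  EntryDeg-C : ∀ {N c} → Deg N c → EntryDeg N (PP.C c)
  EntryDeg-C a = mkEntryDeg λ { zero → a ; (suc n) → Deg-[] }

  EntryDeg-∷ : ∀ {N c u} → Deg N c → EntryDeg N u → EntryDeg N (c ∷ u)
  EntryDeg-∷ a b = mkEntryDeg λ { zero → a ; (suc n) → entry b n }

  EntryDeg-ι : ∀ {N} i → EntryDeg N (PP.P.ι i)
  EntryDeg-ι i = EntryDeg-≋ (Hom.ι-hom (C-Hom PolyRing) i) (EntryDeg-C (Deg-ι i))

  -- The bound m a + a belongs to γ, and squaring the previous iterate doubles its degree. The
  -- growth is exponential in i but depends on no coefficient.
  sqrt-bound : ℕ → ℕ → ℕ → ℕ
  sqrt-bound a m zero = 0
  sqrt-bound a m (suc i) = (m ℕ.* a ℕ.+ a) ℕ.+ (sqrt-bound a m i ℕ.+ sqrt-bound a m i)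

  Deg-sqrt : ∀ a m (u : ℕ → List Carrier) → (∀ n → Deg a (u n)) → ∀ i k → k < m → Deg (sqrt-bound a m i) (PS.sqrt u i k)
  Deg-sqrt a m u du zero k l = Deg-[]
  Deg-sqrt a m u du (suc i) k l = go k l
    where
    Deg-γ : ∀ k → k < m → Deg (m ℕ.* a ℕ.+ a) (PS.γ u k)
    Deg-γ k k<m = Deg-mono (ℕP.+-monoˡ-≤ a (ℕP.*-monoˡ-≤ a (ℕP.<⇒≤ k<m))) (Deg-* (Deg-^ (Deg-* {0} (Deg-ι (+ 4)) (du 0)) k) (du (suc k)))
    go : ∀ k → k < m → Deg (sqrt-bound a m (suc i)) (PS.Φ u (PS.sqrt u i) k)
    go zero k<m = Deg-mono (ℕP.m≤m+n _ _) (Deg-γ 0 k<m)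
    go (suc k) k<m = Deg-+ (Deg-mono (ℕP.m≤m+n _ _) (Deg-γ (suc k) k<m))
      (Deg-neg (Deg-mono (ℕP.m≤n+m _ (m ℕ.* a ℕ.+ a)) (mul-Deg _ _ k below below)))
      where
      below : ∀ j → j ≤ k → Deg (sqrt-bound a m i) (PS.sqrt u i j)
      below j j≤k = Deg-sqrt a m u du i j (ℕP.<-trans (s≤s j≤k) k<m)

-- Evaluation of f in arbitrary rings and restriction to lines

module Lines where
  open Morphism

  module Ev (S : CommutativeRing 0ℓ 0ℓ) where
    open Kit S

    mono : ∀ {d} → Vec Carrier d → Mono d → Carrier
    mono [] [] = 1#
    mono (x ∷ xs) (e ∷ es) = x ^ e * mono xs es

    ev : ∀ {d} → PolyZ d → Vec Carrier d → Carrier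
    ev [] x = 0#
    ev ((c , e) ∷ f) x = ι c * mono x e + ev f x

    mono-cong : ∀ {d} {x y : Vec Carrier d} → Pointwise _≈_ x y → ∀ e → mono x e ≈ mono y e
    mono-cong [] [] = refl
    mono-cong (p ∷ ps) (e ∷ es) = *-cong (^-congˡ e p) (mono-cong ps es)

    ev-cong : ∀ {d} (f : PolyZ d) {x y} → Pointwise _≈_ x y → ev f x ≈ ev f y
    ev-cong [] ps = refl
    ev-cong ((c , e) ∷ f) ps = +-cong (*-congˡ (mono-cong ps e)) (ev-cong f ps)

    -- One induction over the terms of f serves two filtrations: the degree in t, and the degree in
    -- s of polynomials in t.
    module Graded (Q : ℕ → Carrier → Set)
      (Q-mono : ∀ {m n x} → m ≤ n → Q m x → Q n x) (Q-+ : ∀ {n x y} → Q n x → Q n y → Q n (x + y))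
      (Q-* : ∀ {m n x y} → Q m x → Q n y → Q (m ℕ.+ n) (x * y)) (Q-ι : ∀ {n} i → Q n (ι i)) (Q-0 : ∀ {n} → Q n 0#) (Q-1 : Q 0 1#) where

      Q-^ : ∀ {x} → Q 1 x → ∀ n → Q n (x ^ n)
      Q-^ q zero = Q-1
      Q-^ q (suc n) = Q-* q (Q-^ q n)

      Q-monomial : ∀ {d} {x : Vec Carrier d} → VAll.All (Q 1) x → ∀ e → Q (totalDeg e) (mono x e)
      Q-monomial VAll.[] [] = Q-1
      Q-monomial (q VAll.∷ qs) (e ∷ es) = Q-* (Q-^ q e) (Q-monomial qs es)

      Q-ev : ∀ {d D} {f : PolyZ d} {x} → All (λ t → totalDeg (proj₂ t) ≤ D) f → VAll.All (Q 1) x → Q D (ev f x)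
      Q-ev [] qs = Q-0
      Q-ev {f = (c , e) ∷ f} (l ∷ ls) qs = Q-+ (Q-* {0} (Q-ι c) (Q-mono l (Q-monomial qs e))) (Q-ev ls qs)

  module _ {S T : CommutativeRing 0ℓ 0ℓ} (φ : Hom S T) where
    open Hom φ
    private
      module S = Kit S
      module T = Kit T
      module PS = Poly S
      module PT = Poly T
      module QS = Sqrt S
      module QT = Sqrt T

    mono-hom : ∀ {d} (x : Vec S.Carrier d) e → ⟦ Ev.mono S x e ⟧ T.≈ Ev.mono T (Vec.map ⟦_⟧ x) e
    mono-hom [] [] = 1-hom
    mono-hom (x ∷ xs) (e ∷ es) = T.trans (*-hom _ _) (T.*-cong (^-hom x e) (mono-hom xs es))

    ev-hom : ∀ {d} (f : PolyZ d) x → ⟦ Ev.ev S f x ⟧ T.≈ Ev.ev T f (Vec.map ⟦_⟧ x)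
    ev-hom [] x = 0-hom
    ev-hom ((c , e) ∷ f) x = T.trans (+-hom _ _) (T.+-cong (T.trans (*-hom _ _) (T.*-cong (ι-hom c) (mono-hom x e))) (ev-hom f x))

    γ-hom : ∀ (u : ℕ → S.Carrier) (w : ℕ → T.Carrier) → (∀ n → ⟦ u n ⟧ T.≈ w n) → ∀ n → ⟦ QS.γ u n ⟧ T.≈ QT.γ w n
    γ-hom u w e n = T.trans (*-hom _ _) (T.*-cong (T.trans (^-hom _ n) (T.^-congˡ n (T.trans (*-hom _ _) (T.*-cong (ι-hom (+ 4)) (e 0))))) (e (suc n)))

    sqrt-hom : ∀ (u : ℕ → S.Carrier) (w : ℕ → T.Carrier) → (∀ n → ⟦ u n ⟧ T.≈ w n) → ∀ i k → ⟦ QS.sqrt u i k ⟧ T.≈ QT.sqrt w i k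
    sqrt-hom u w e zero k = 0-hom
    sqrt-hom u w e (suc i) zero = γ-hom u w e 0
    sqrt-hom u w e (suc i) (suc k) = T.trans (+-hom _ _) (T.+-cong (γ-hom u w e (suc k)) (T.trans (neg-hom _)
      (T.-‿cong (T.trans (mul-hom φ (QS.sqrt u i) (QS.sqrt u i) k) (PT.mul-cong (sqrt-hom u w e i) (sqrt-hom u w e i) k)))))

    tab-hom : ∀ h (u : ℕ → S.Carrier) (w : ℕ → T.Carrier) → (∀ n → ⟦ u n ⟧ T.≈ w n) → map ⟦_⟧ (PS.tab h u) PT.≋ PT.tab h w
    tab-hom zero u w e = PT.P.refl
    tab-hom (suc h) u w e = PT.∷-cong (e 0) (tab-hom h (u ∘ suc) (w ∘ suc) (e ∘ suc))

    scale-hom : ∀ c c′ p q → ⟦ c ⟧ T.≈ c′ → map ⟦_⟧ p PT.≋ q → map ⟦_⟧ (PS.scale c p) PT.≋ PT.scale c′ q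
    scale-hom c c′ p q e f = PT.P.trans (go p) (PT.P.trans (PT.scale≋C* ⟦ c ⟧ (map ⟦_⟧ p)) (PT.P.trans (PT.P.*-cong (PT.C-cong e) f) (PT.P.sym (PT.scale≋C* c′ q))))
      where
      go : ∀ p → map ⟦_⟧ (PS.scale c p) PT.≋ PT.scale ⟦ c ⟧ (map ⟦_⟧ p)
      go [] = PT.P.refl
      go (x ∷ p) = PT.∷-cong (*-hom c x) (go p)

    root-hom : ∀ (u : ℕ → S.Carrier) (w : ℕ → T.Carrier) → (∀ n → ⟦ u n ⟧ T.≈ w n) → ∀ m h → map ⟦_⟧ (QS.root u m h) PT.≋ QT.root w m h
    root-hom u w e m h = PT.∷-cong 1-hom (scale-hom _ _ (PS.tab h (QS.sqrt u m)) (PT.tab h (QT.sqrt w m)) (ι-hom (+ 2)) (tab-hom h _ _ (sqrt-hom u w e m)))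

    eval-hom : ∀ z p → ⟦ PS.eval z p ⟧ T.≈ PT.eval ⟦ z ⟧ (map ⟦_⟧ p)
    eval-hom z [] = 0-hom
    eval-hom z (c ∷ p) = T.trans (+-hom _ _) (T.+-congˡ (T.trans (*-hom _ _) (T.*-congˡ (eval-hom z p))))

  id-Hom : ∀ S → Hom S S
  id-Hom S = record { ⟦_⟧ = λ x → x ; cong = λ e → e ; +-hom = λ _ _ → refl ; *-hom = λ _ _ → refl ; 1-hom = refl }
    where open CommutativeRing S using (refl)

  lin : {A : Set} → A → A → List A
  lin a v = a ∷ v ∷ []

  module Line (R : CommutativeRing 0ℓ 0ℓ) where
    open Kit R
    open Poly R
    open Degree R
    open Ev R

    -- The polynomial f(a + t v), obtained by evaluating f in R[t]; degree bounds and base change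
    -- thus become instances of facts about evaluation.
    restrict : ∀ {d} → PolyZ d → Vec Carrier d → Vec Carrier d → List Carrier
    restrict f a v = Ev.ev PolyRing f (Vec.zipWith lin a v)

    along : ∀ {d} → Carrier → Vec Carrier d → Vec Carrier d → Vec Carrier d
    along t = Vec.zipWith (λ a v → a + t * v)

    -- A coefficient of the square root series along the line. D iterations settle all indices below
    -- D.
    cert : ∀ {d} → ℕ → PolyZ d → Vec Carrier d → Vec Carrier d → ℕ → Carrier
    cert D f a v = Sqrt.sqrt R (coef (restrict f a v)) D

    Pointwise-lin : ∀ {d} {a b v w : Vec Carrier d} → Pointwise _≈_ a b → Pointwise _≈_ v w → Pointwise _≋_ (Vec.zipWith lin a v) (Vec.zipWith lin b w)
    Pointwise-lin [] [] = []
    Pointwise-lin (p ∷ ps) (q ∷ qs) = ∷-cong p (∷-cong q P.refl) ∷ Pointwise-lin ps qs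

    eval-lin : ∀ {d} t (a v : Vec Carrier d) → Pointwise _≈_ (Vec.map (eval t) (Vec.zipWith lin a v)) (along t a v)
    eval-lin t [] [] = []
    eval-lin t (a ∷ as) (v ∷ vs) = +-congˡ (*-congˡ (eval-C t v)) ∷ eval-lin t as vs

    restrict-cong : ∀ {d} (f : PolyZ d) {a b v w} → Pointwise _≈_ a b → Pointwise _≈_ v w → restrict f a v ≋ restrict f b w
    restrict-cong f p q = Ev.ev-cong PolyRing f (Pointwise-lin p q)

    eval-restrict : ∀ {d} (f : PolyZ d) t a v → eval t (restrict f a v) ≈ ev f (along t a v)
    eval-restrict f t a v = trans (ev-hom (eval-Hom R t) f _) (ev-cong f (eval-lin t a v))

    cert-cong : ∀ {d} D (f : PolyZ d) {a b v w} → Pointwise _≈_ a b → Pointwise _≈_ v w → ∀ k → cert D f a v k ≈ cert D f b w k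
    cert-cong D f {a} {b} {v} {w} p q = sqrt-hom (id-Hom R) (coef (restrict f a v)) (coef (restrict f b w)) (at (restrict-cong f p q)) D

    Deg-restrict : ∀ {d D} {f : PolyZ d} → All (λ t → totalDeg (proj₂ t) ≤ D) f → ∀ a v → Deg D (restrict f a v)
    Deg-restrict {f = f} l a v = Ev.Graded.Q-ev PolyRing Deg Deg-mono Deg-+ Deg-* Deg-ι Deg-[] (Deg-C 1#) l (linear a v)
      where
      linear : ∀ {d} (a v : Vec Carrier d) → VAll.All (Deg 1) (Vec.zipWith lin a v)
      linear [] [] = VAll.[]
      linear (a ∷ as) (v ∷ vs) = Deg-linear a v VAll.∷ linear as vs

    along-0 : ∀ {d} (a v : Vec Carrier d) → Pointwise _≈_ (along 0# a v) a
    along-0 [] [] = []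
    along-0 (a ∷ as) (v ∷ vs) = trans (+-congˡ (zeroˡ v)) (+-identityʳ a) ∷ along-0 as vs

    coef0≈eval0 : ∀ p → coef p 0 ≈ eval 0# p
    coef0≈eval0 [] = refl
    coef0≈eval0 (c ∷ p) = sym (trans (+-congˡ (zeroˡ _)) (+-identityʳ c))

    -- The list `restrict f a v` may end in zeros. `section` is the same polynomial with exactly D +
    -- 1 entries, as required where list lengths are counted.
    module Truncated {d : ℕ} (D : ℕ) (f : PolyZ d) (low : All (λ t → totalDeg (proj₂ t) ≤ D) f) (a v : Vec Carrier d) where
      section : List Carrier
      section = truncate D (restrict f a v)

      length-section : length section ≡ suc D
      length-section = length-truncate D (restrict f a v)

      section≋ : section ≋ restrict f a v
      section≋ = truncate≋ D (restrict f a v) (Deg-restrict low a v)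

      eval-section : ∀ t → eval t section ≈ ev f (along t a v)
      eval-section t = trans (eval-cong t section≋) (eval-restrict f t a v)

      section-0 : coef section 0 ≈ ev f a
      section-0 = trans (coef0≈eval0 section) (trans (eval-section 0#) (ev-cong f (along-0 a v)))

      sqrt-section : ∀ k → Sqrt.sqrt R (coef section) D k ≈ cert D f a v k
      sqrt-section = sqrt-hom (id-Hom R) (coef section) (coef (restrict f a v)) (at section≋) D

  module _ {R S : CommutativeRing 0ℓ 0ℓ} (φ : Hom R S) where
    open Hom φ
    private
      module R = Kit R
      module S = Kit S
      module PS = Poly S

    map-lin : ∀ {d} (a v : Vec R.Carrier d) → Vec.map (map ⟦_⟧) (Vec.zipWith lin a v) ≡ Vec.zipWith lin (Vec.map ⟦_⟧ a) (Vec.map ⟦_⟧ v)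
    map-lin [] [] = ≡.refl
    map-lin (a ∷ as) (v ∷ vs) = ≡.cong (_ ∷_) (map-lin as vs)

    restrict-hom : ∀ {d} (f : PolyZ d) a v → map ⟦_⟧ (Line.restrict R f a v) PS.≋ Line.restrict S f (Vec.map ⟦_⟧ a) (Vec.map ⟦_⟧ v)
    restrict-hom f a v = PS.P.trans (ev-hom (map-Hom φ) f _) (PS.P.reflexive (≡.cong (Ev.ev PS.PolyRing f) (map-lin a v)))

    cert-hom : ∀ {d} D (f : PolyZ d) a v k → ⟦ Line.cert R D f a v k ⟧ S.≈ Line.cert S D f (Vec.map ⟦_⟧ a) (Vec.map ⟦_⟧ v) k
    cert-hom D f a v = sqrt-hom φ _ _ (λ n → S.trans (S.sym (coef-mapHom φ (Line.restrict R f a v) n)) (PS.at (restrict-hom f a v) n)) D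

  module CertLine (R : CommutativeRing 0ℓ 0ℓ) where
    open Kit R
    open Poly R
    open Degree R
    open Line R
    private
      module PP = Poly PolyRing
      module PL = Line PolyRing

    cert-degree : ℕ → ℕ
    cert-degree D = sqrt-bound D D D

    -- The certificate is formed over R[s] for the direction v + s w. There it is a polynomial in s,
    -- of degree controlled by the s-degrees of the coefficients of f(a + t (v + s w)), and
    -- evaluation at s is a homomorphism.
    cert-along : ∀ {d} D (f : PolyZ d) → All (λ t → totalDeg (proj₂ t) ≤ D) f → ∀ (a v w : Vec Carrier d) k → k < D →
      ∃[ p ] (length p ≡ suc (cert-degree D) × (∀ s → eval s p ≈ cert D f a (along s v w) k))
    cert-along D f l a v w k k<D = truncate (cert-degree D) q , length-truncate (cert-degree D) q ,
        λ s → trans (eval-cong s (truncate≋ _ q Deg-q)) (trans (cert-hom (eval-Hom R s) D f (Vec.map C a) (Vec.zipWith lin v w) k) (cert-cong D f (eval-C⁎ s a) (eval-lin s v w) k))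
      where
      q : List Carrier
      q = PL.cert D f (Vec.map C a) (Vec.zipWith lin v w) k
      eval-C⁎ : ∀ {d} s (a : Vec Carrier d) → Pointwise _≈_ (Vec.map (eval s) (Vec.map C a)) a
      eval-C⁎ s [] = []
      eval-C⁎ s (a ∷ as) = eval-C s a ∷ eval-C⁎ s as
      linear : ∀ {d} (a v w : Vec Carrier d) → VAll.All (EntryDeg 1) (Vec.zipWith lin (Vec.map C a) (Vec.zipWith lin v w))
      linear [] [] [] = VAll.[]
      linear (a ∷ as) (v ∷ vs) (w ∷ ws) = EntryDeg-∷ (Deg-C a) (EntryDeg-∷ (Deg-linear v w) (mkEntryDeg λ _ → Deg-[])) VAll.∷ linear as vs ws
      entries : EntryDeg D (PL.restrict f (Vec.map C a) (Vec.zipWith lin v w))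
      entries = Ev.Graded.Q-ev PP.PolyRing EntryDeg (λ l a → mkEntryDeg λ n → Deg-mono l (entry a n)) EntryDeg-+ EntryDeg-* EntryDeg-ι
        (mkEntryDeg λ _ → Deg-[]) (EntryDeg-C (Deg-C 1#)) l (linear a v w)
      Deg-q : Deg (cert-degree D) q
      Deg-q = Deg-sqrt D D _ (entry entries) D k k<D

-- Finite sums and averaging over lines

module CharSum where
  open OneVar
  open Lines

  sumL-cong : {A : Set} (xs : List A) {g h : A → ℤ} → (∀ x → g x ≡ h x) → sumL xs g ≡ sumL xs h
  sumL-cong [] e = ≡.refl
  sumL-cong (x ∷ xs) e = ≡.cong₂ ℤ._+_ (e x) (sumL-cong xs e)

  sumL-cong-∈ : {A : Set} (xs : List A) {g h : A → ℤ} → (∀ x → x ∈ xs → g x ≡ h x) → sumL xs g ≡ sumL xs h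
  sumL-cong-∈ [] e = ≡.refl
  sumL-cong-∈ (x ∷ xs) e = ≡.cong₂ ℤ._+_ (e x (here ≡.refl)) (sumL-cong-∈ xs λ y p → e y (there p))

  sumL-++ : {A : Set} (xs ys : List A) (g : A → ℤ) → sumL (xs ++ ys) g ≡ sumL xs g ℤ.+ sumL ys g
  sumL-++ [] ys g = ≡.sym (ℤP.+-identityˡ _)
  sumL-++ (x ∷ xs) ys g = ≡.trans (≡.cong (ℤ._+_ (g x)) (sumL-++ xs ys g)) (≡.sym (ℤP.+-assoc (g x) _ _))

  sumL-map : {A B : Set} (f : A → B) (xs : List A) (g : B → ℤ) → sumL (map f xs) g ≡ sumL xs (g ∘ f)
  sumL-map f [] g = ≡.refl
  sumL-map f (x ∷ xs) g = ≡.cong (ℤ._+_ (g (f x))) (sumL-map f xs g)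

  sumL-concatMap : {A B : Set} (f : A → List B) (xs : List A) (g : B → ℤ) → sumL (concatMap f xs) g ≡ sumL xs (λ x → sumL (f x) g)
  sumL-concatMap f [] g = ≡.refl
  sumL-concatMap f (x ∷ xs) g = ≡.trans (sumL-++ (f x) (concatMap f xs) g) (≡.cong (ℤ._+_ (sumL (f x) g)) (sumL-concatMap f xs g))

  sumL-+ : {A : Set} (xs : List A) (g h : A → ℤ) → sumL xs (λ x → g x ℤ.+ h x) ≡ sumL xs g ℤ.+ sumL xs h
  sumL-+ [] g h = ≡.refl
  sumL-+ (x ∷ xs) g h = ≡.trans (≡.cong (ℤ._+_ (g x ℤ.+ h x)) (sumL-+ xs g h)) (interchange (g x) (h x) _ _)
    where
    interchange : ∀ a b c d → (a ℤ.+ b) ℤ.+ (c ℤ.+ d) ≡ (a ℤ.+ c) ℤ.+ (b ℤ.+ d)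
    interchange a b c d = ≡.trans (ℤP.+-assoc a b _) (≡.trans (≡.cong (ℤ._+_ a) (≡.trans (≡.sym (ℤP.+-assoc b c d)) (≡.trans (≡.cong (ℤ._+ d) (ℤP.+-comm b c)) (ℤP.+-assoc c b d)))) (≡.sym (ℤP.+-assoc a c _)))

  sumL-zero : {A : Set} (xs : List A) → sumL xs (λ _ → + 0) ≡ + 0
  sumL-zero [] = ≡.refl
  sumL-zero (x ∷ xs) = ≡.trans (ℤP.+-identityˡ _) (sumL-zero xs)

  sumL-swap : {A B : Set} (xs : List A) (ys : List B) (g : A → B → ℤ) → sumL xs (λ x → sumL ys (g x)) ≡ sumL ys (λ y → sumL xs (λ x → g x y))
  sumL-swap [] ys g = ≡.sym (sumL-zero ys)
  sumL-swap (x ∷ xs) ys g = ≡.trans (≡.cong (ℤ._+_ (sumL ys (g x))) (sumL-swap xs ys g)) (≡.sym (sumL-+ ys (g x) _))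

  sumL-const : {A : Set} (xs : List A) (c : ℤ) → sumL xs (λ _ → c) ≡ + length xs ℤ.* c
  sumL-const [] c = ≡.sym (ℤP.*-zeroˡ c)
  sumL-const (x ∷ xs) c = ≡.trans (≡.cong (ℤ._+_ c) (sumL-const xs c)) (≡.sym (≡.trans (ℤP.*-distribʳ-+ c (+ 1) (+ length xs)) (≡.cong (ℤ._+ + length xs ℤ.* c) (ℤP.*-identityˡ c))))

  sumL-single : {A : Set} {xs : List A} {r : A} (g : A → ℤ) → Unique xs → r ∈ xs → (∀ x → x ∈ xs → x ≢ r → g x ≡ + 0) → sumL xs g ≡ g r
  sumL-single {xs = x ∷ xs} g (x≢ ∷ u) (here ≡.refl) z = ≡.trans (≡.cong (ℤ._+_ (g x))
    (≡.trans (sumL-cong-∈ xs (λ y p → z y (there p) (λ e → All.lookup x≢ p (≡.sym e)))) (sumL-zero xs))) (ℤP.+-identityʳ _)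
  sumL-single {xs = x ∷ xs} g (x≢ ∷ u) (there p) z = ≡.trans (≡.cong₂ ℤ._+_ (z x (here ≡.refl) (All.lookup x≢ p)) (sumL-single g u p (λ y q → z y (there q)))) (ℤP.+-identityˡ _)

  sumℕ : {A : Set} → List A → (A → ℕ) → ℕ
  sumℕ xs g = foldr (λ x s → g x ℕ.+ s) 0 xs

  abs-sumL : {A : Set} (xs : List A) (g : A → ℤ) → ∣ sumL xs g ∣ ≤ sumℕ xs (∣_∣ ∘ g)
  abs-sumL [] g = z≤n
  abs-sumL (x ∷ xs) g = ℕP.≤-trans (ℤP.∣i+j∣≤∣i∣+∣j∣ (g x) _) (ℕP.+-monoʳ-≤ ∣ g x ∣ (abs-sumL xs g))

  sumℕ-mono : {A : Set} (xs : List A) {g h : A → ℕ} → (∀ x → g x ≤ h x) → sumℕ xs g ≤ sumℕ xs h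
  sumℕ-mono [] l = z≤n
  sumℕ-mono (x ∷ xs) l = ℕP.+-mono-≤ (l x) (sumℕ-mono xs l)

  sumℕ-const : {A : Set} (xs : List A) (c : ℕ) → sumℕ xs (λ _ → c) ≡ length xs ℕ.* c
  sumℕ-const [] c = ≡.refl
  sumℕ-const (x ∷ xs) c = ≡.cong (c ℕ.+_) (sumℕ-const xs c)

  sumℕ-linear : {A : Set} (xs : List A) (c b : ℕ) (g : A → ℕ) → sumℕ xs (λ x → c ℕ.+ g x ℕ.* b) ≡ length xs ℕ.* c ℕ.+ sumℕ xs g ℕ.* b
  sumℕ-linear [] c b g = ≡.refl
  sumℕ-linear (x ∷ xs) c b g = ≡.trans (≡.cong ((c ℕ.+ g x ℕ.* b) ℕ.+_) (sumℕ-linear xs c b g)) (eq c (g x) b (length xs ℕ.* c) (sumℕ xs g))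
    where
    eq : ∀ c y b l s → (c ℕ.+ y ℕ.* b) ℕ.+ (l ℕ.+ s ℕ.* b) ≡ (c ℕ.+ l) ℕ.+ (y ℕ.+ s) ℕ.* b
    eq = solve-∀

  sumℕ-* : {A : Set} (xs : List A) (c : ℕ) (g : A → ℕ) → c ℕ.* sumℕ xs g ≡ sumℕ xs (λ x → c ℕ.* g x)
  sumℕ-* [] c g = ℕP.*-zeroʳ c
  sumℕ-* (x ∷ xs) c g = ≡.trans (ℕP.*-distribˡ-+ c (g x) _) (≡.cong (c ℕ.* g x ℕ.+_) (sumℕ-* xs c g))

  sumL-pos : {A : Set} (xs : List A) (g : A → ℕ) → sumL xs (+_ ∘ g) ≡ + sumℕ xs g
  sumL-pos [] g = ≡.refl
  sumL-pos (x ∷ xs) g = ≡.cong (ℤ._+_ (+ g x)) (sumL-pos xs g)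

  length-points : ∀ ℓ d → length (points ℓ d) ≡ ℓ ℕ.^ d
  length-points ℓ zero = ≡.refl
  length-points ℓ (suc d) = ≡.trans (go (points ℓ d)) (≡.trans (≡.cong (ℕ._* ℓ) (length-points ℓ d)) (ℕP.*-comm _ ℓ))
    where
    go : ∀ (xs : List (Vec ℤ d)) → length (concatMap (λ v → map (λ i → (+ i) ∷ v) (upTo ℓ)) xs) ≡ length xs ℕ.* ℓ
    go [] = ≡.refl
    go (v ∷ xs) = ≡.trans (ListP.length-++ (map (λ i → (+ i) ∷ v) (upTo ℓ))) (≡.cong₂ ℕ._+_ (≡.trans (ListP.length-map _ (upTo ℓ)) (ListP.length-upTo ℓ)) (go xs))

  sumL-points : ∀ ℓ d (G : Vec ℤ (suc d) → ℤ) → sumL (points ℓ (suc d)) G ≡ sumL (points ℓ d) (λ v → sumL (upTo ℓ) (λ i → G (+ i ∷ v)))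
  sumL-points ℓ d G = ≡.trans (sumL-concatMap _ (points ℓ d) G) (sumL-cong (points ℓ d) λ v → sumL-map (λ i → (+ i) ∷ v) (upTo ℓ) G)

  private
    module E = ≡.≡-Reasoning

  module Affine (k : ℕ) (prime : Prime (suc k)) where
    open Zmod k prime
    open Kit ℤmod
    open Line ℤmod using (along)

    -- In place of a permutation of the summands: each value is expanded into a sum over residues j
    -- supported at one j, the two sums are exchanged, and each j is hit by exactly one i.
    sum-affine₁ : ∀ (g : ℤ → ℤ) → (∀ {x y} → x ≈ y → g x ≡ g y) → ∀ a t → ¬ t ≈ + 0 →
      sumL (upTo ℓ) (λ i → g (a + t * + i)) ≡ sumL (upTo ℓ) (g ∘ +_)
    sum-affine₁ g g-cong a t t≉0 = ≡.trans (sumL-cong (upTo ℓ) (λ i → ≡.sym (expand (a + t * + i))))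
      (≡.trans (sumL-swap (upTo ℓ) (upTo ℓ) (λ i j → δ (a + t * + i) j)) (sumL-cong (upTo ℓ) collapse))
      where
      δ : ℤ → ℕ → ℤ
      δ z j with z ≟ + j
      ... | yes _ = g (+ j)
      ... | no _ = + 0
      δ-yes : ∀ z j → z ≈ + j → δ z j ≡ g (+ j)
      δ-yes z j e with z ≟ + j
      ... | yes _ = ≡.refl
      ... | no ¬e = contradiction e ¬e
      δ-no : ∀ z j → ¬ z ≈ + j → δ z j ≡ + 0
      δ-no z j ¬e with z ≟ + j
      ... | yes e = contradiction e ¬e
      ... | no _ = ≡.refl
      expand : ∀ z → sumL (upTo ℓ) (δ z) ≡ g z
      expand z = ≡.trans (sumL-single (δ z) (upTo⁺ ℓ) (∈-upTo⁺ (n%ℕd<d z ℓ)) (λ j j∈ ¬e → δ-no z j λ e → ¬e (small-≈⇒≡ (∈-upTo⁻ j∈) (n%ℕd<d z ℓ) (trans (sym e) (≈-residue z)))))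
        (≡.trans (δ-yes z (z %ℕ ℓ) (≈-residue z)) (g-cong (sym (≈-residue z))))
      s : ℤ
      s = proj₁ (F.inverse t t≉0)
      collapse : ∀ j → sumL (upTo ℓ) (λ i → δ (a + t * + i) j) ≡ g (+ j)
      collapse j = ≡.trans (sumL-single (λ i → δ (a + t * + i) j) (upTo⁺ ℓ) (∈-upTo⁺ (n%ℕd<d (s * (+ j - a)) ℓ)) (λ i i∈ ¬e → δ-no _ j λ e → ¬e (only i (∈-upTo⁻ i∈) e))) (δ-yes _ j hit)
        where
        i₀ : ℕ
        i₀ = (s * (+ j - a)) %ℕ ℓ
        hit : a + t * + i₀ ≈ + j
        hit = trans (F.affine-cong a t (sym (≈-residue (s * (+ j - a))))) (F.affine-solution a t (+ j) t≉0)
        only : ∀ i → i < ℓ → a + t * + i ≈ + j → i ≡ i₀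
        only i i<ℓ e = small-≈⇒≡ i<ℓ (n%ℕd<d (s * (+ j - a)) ℓ) (F.affine-injective a t {+ i} {+ i₀} t≉0 (trans e (sym hit)))

    ≈-refl : ∀ {d} (v : Vec ℤ d) → Pointwise _≈_ v v
    ≈-refl [] = []
    ≈-refl (x ∷ v) = refl ∷ ≈-refl v

    sum-affine : ∀ {d} (G : Vec ℤ d → ℤ) → (∀ {x y} → Pointwise _≈_ x y → G x ≡ G y) → ∀ t (a : Vec ℤ d) → ¬ t ≈ + 0 →
      sumL (points ℓ d) (λ w → G (along t a w)) ≡ sumL (points ℓ d) G
    sum-affine {zero} G G-cong t [] t≉0 = ≡.refl
    sum-affine {suc d} G G-cong t (a ∷ as) t≉0 = E.begin
      sumL (points ℓ (suc d)) (λ w → G (along t (a ∷ as) w))                                E.≡⟨ sumL-points ℓ d (λ w → G (along t (a ∷ as) w)) ⟩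
      sumL (points ℓ d) (λ w → sumL (upTo ℓ) (λ i → G ((a + t * + i) ∷ along t as w)))      E.≡⟨ sumL-cong (points ℓ d) (λ w → sum-affine₁ (λ z → G (z ∷ along t as w)) (λ e → G-cong (e ∷ ≈-refl _)) a t t≉0) ⟩
      sumL (points ℓ d) (λ w → sumL (upTo ℓ) (λ i → G (+ i ∷ along t as w)))                E.≡⟨ sumL-swap (points ℓ d) (upTo ℓ) (λ w i → G (+ i ∷ along t as w)) ⟩
      sumL (upTo ℓ) (λ i → sumL (points ℓ d) (λ w → G (+ i ∷ along t as w)))                E.≡⟨ sumL-cong (upTo ℓ) (λ i → sum-affine (λ v → G (+ i ∷ v)) (λ e → G-cong (refl ∷ e)) t as t≉0) ⟩
      sumL (upTo ℓ) (λ i → sumL (points ℓ d) (λ w → G (+ i ∷ w)))                           E.≡⟨ sumL-swap (points ℓ d) (upTo ℓ) (λ w i → G (+ i ∷ w)) ⟨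
      sumL (points ℓ d) (λ w → sumL (upTo ℓ) (λ i → G (+ i ∷ w)))                           E.≡⟨ sumL-points ℓ d G ⟨
      sumL (points ℓ (suc d)) G                                                             E.∎

    -- For t ≠ 0 the map from w to a + t w permutes residue vectors, so every t contributes the
    -- whole sum. The identity is used twice: for the character values, and for the indicator of the
    -- bad directions.
    sum-lines : ∀ {d} (G : Vec ℤ d → ℤ) → (∀ {x y} → Pointwise _≈_ x y → G x ≡ G y) → ∀ (a : Vec ℤ d) →
      + k ℤ.* sumL (points ℓ d) G ≡ sumL (points ℓ d) (λ w → sumL (upTo k) (λ t → G (along (+ suc t) a w)))
    sum-lines {d} G G-cong a = E.begin
      + k ℤ.* sumL (points ℓ d) G                                                      E.≡⟨ ≡.cong (λ n → + n ℤ.* sumL (points ℓ d) G) (ListP.length-upTo k) ⟨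
      + length (upTo k) ℤ.* sumL (points ℓ d) G                                        E.≡⟨ sumL-const (upTo k) (sumL (points ℓ d) G) ⟨
      sumL (upTo k) (λ _ → sumL (points ℓ d) G)                                        E.≡⟨ sumL-cong-∈ (upTo k) (λ t t∈ → ≡.sym (sum-affine G G-cong (+ suc t) a (unit t (∈-upTo⁻ t∈)))) ⟩
      sumL (upTo k) (λ t → sumL (points ℓ d) (λ w → G (along (+ suc t) a w)))          E.≡⟨ sumL-swap (upTo k) (points ℓ d) (λ t w → G (along (+ suc t) a w)) ⟩
      sumL (points ℓ d) (λ w → sumL (upTo k) (λ t → G (along (+ suc t) a w)))          E.∎
      where
      unit : ∀ t → t < k → ¬ + suc t ≈ + 0
      unit t t<k e = ℕP.1+n≢0 (small-≈⇒≡ (s≤s t<k) (s≤s z≤n) e)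

-- From sums over lines to the full sum

module Bound where
  open OneVar
  open Lines
  open CharSum

  private
    module L = ℕP.≤-Reasoning

  bit : {P : Set} → Dec P → ℕ
  bit (yes _) = 1
  bit (no _) = 0

  bit-cong : {P Q : Set} → (P → Q) → (Q → P) → (p : Dec P) (q : Dec Q) → bit p ≡ bit q
  bit-cong f g (yes _) (yes _) = ≡.refl
  bit-cong f g (no _) (no _) = ≡.refl
  bit-cong f g (yes x) (no ¬y) = contradiction (f x) ¬y
  bit-cong f g (no ¬x) (yes y) = contradiction (g y) ¬x

  sum-bit : {A : Set} {P : A → Set} (P? : ∀ x → Dec (P x)) (xs : List A) → sumℕ xs (λ x → bit (P? x)) ≡ length (filter P? xs)
  sum-bit P? [] = ≡.refl
  sum-bit P? (x ∷ xs) with P? x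
  ... | yes _ = ≡.cong suc (sum-bit P? xs)
  ... | no _ = sum-bit P? xs

  module LineSums (k : ℕ) (prime : Prime (suc k)) (e : ℕ) (k≡ : k ≡ e ℕ.+ e) where
    open Zmod k prime
    open Euler e k≡
    open Affine k prime
    open Kit ℤmod
    open Poly ℤmod using (eval; coef)
    open Domain ℤmod _≟_ domain using (Distinct; too-many-simple-roots)
    open Degree ℤmod
    open Line ℤmod
    open Ev ℤmod
    open CertLine ℤmod

    module _ {d : ℕ} (D h : ℕ) (2h≤ : D ≤ suc (h ℕ.+ h)) (f : PolyZ d) (low : All (λ t → totalDeg (proj₂ t) ≤ D) f)
      (a v₀ : Vec ℤ d) (n : ℕ) (h≤n : h ≤ n) (n<D : n < D) (fa≉0 : ¬ ev f a ≈ + 0) (cert≉0 : ¬ cert D f a v₀ n ≈ + 0)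
      (48≤ℓ : 48 ≤ ℓ) (4μ≤ℓ : 4 ℕ.* suc (suc D) ≤ ℓ) where

      χf : Vec ℤ d → ℤ
      χf x = legendre ℓ (ev f x)

      χf-cong : ∀ {x y} → Pointwise _≈_ x y → χf x ≡ χf y
      χf-cong p = legendre-cong (ev-cong f p)

      ∣χ∣≤1 : ∀ x → ∣ legendre ℓ x ∣ ≤ 1
      ∣χ∣≤1 x with legendre ℓ x | euler x
      ... | _ | divisible _ = z≤n
      ... | _ | residue _ = s≤s z≤n
      ... | _ | nonresidue _ = s≤s z≤n

      bad : Vec ℤ d → ℕ
      bad v = bit (cert D f a v n ≟ + 0)

      bad-cong : ∀ {v w} → Pointwise _≈_ v w → bad v ≡ bad w
      bad-cong {v} {w} p = bit-cong (trans (sym vw)) (trans vw) (cert D f a v n ≟ + 0) (cert D f a w n ≟ + 0)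
        where
        vw : cert D f a v n ≈ cert D f a w n
        vw = cert-cong D f (≈-refl a) p n

      lineSum : Vec ℤ d → ℤ
      lineSum v = sumL (upTo ℓ) (λ t → χf (along (+ t) a v))

      open Truncated D f low a

      section₀≉0 : ∀ v → ¬ coef (section v) 0 ≈ + 0
      section₀≉0 v z = fa≉0 (trans (sym (section-0 v)) z)

      W : ℕ
      W = 6 ℕ.* suc D ℕ.+ 6

      lineSum≡ : ∀ v → lineSum v ≡ sumL (upTo ℓ) (λ t → legendre ℓ (eval (+ t) (section v)))
      lineSum≡ v = sumL-cong (upTo ℓ) λ t → legendre-cong (sym (eval-section v (+ t)))

      good-line : ∀ N → 4 ℕ.* (N ℕ.* N) ≤ ℓ → ∀ v → ¬ cert D f a v n ≈ + 0 → N ℕ.* ∣ lineSum v ∣ ≤ W ℕ.* ℓ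
      good-line N 4N²≤ℓ v good = ≡.subst (λ z → N ℕ.* ∣ z ∣ ≤ W ℕ.* ℓ) (≡.sym (lineSum≡ v))
          (weil k prime e k≡ (section v) (suc D) (ℕP.≤-reflexive (length-section v)) (s≤s z≤n)
            (Certificate.certificate ℤmod _≟_ domain F.inverse (section v) D h (ℕP.≤-reflexive (length-section v)) 2h≤ (section₀≉0 v) n h≤n n<D
              (λ z → good (trans (sym (sqrt-section v n)) z)))
            48≤ℓ 4μ≤ℓ N 4N²≤ℓ)

      -- Bad directions are charged with the trivial bound ℓ; they are rare enough to bear it.
      line-bound : ∀ N → 4 ℕ.* (N ℕ.* N) ≤ ℓ → ∀ v → N ℕ.* ∣ lineSum v ∣ ≤ W ℕ.* ℓ ℕ.+ bad v ℕ.* (N ℕ.* ℓ)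
      line-bound N 4N²≤ℓ v = case (cert D f a v n ≟ + 0)
        where
        trivial : ∣ lineSum v ∣ ≤ ℓ
        trivial = ℕP.≤-trans (abs-sumL (upTo ℓ) (λ t → χf (along (+ t) a v))) (ℕP.≤-trans (sumℕ-mono (upTo ℓ) (λ t → ∣χ∣≤1 (ev f (along (+ t) a v))))
          (ℕP.≤-reflexive (≡.trans (sumℕ-const (upTo ℓ) 1) (≡.trans (ℕP.*-identityʳ _) (ListP.length-upTo ℓ)))))

        case : (dec : Dec (cert D f a v n ≈ + 0)) → N ℕ.* ∣ lineSum v ∣ ≤ W ℕ.* ℓ ℕ.+ bit dec ℕ.* (N ℕ.* ℓ)
        case (no good) = ℕP.≤-trans (good-line N 4N²≤ℓ v good) (ℕP.m≤m+n _ _)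
        case (yes _) = ℕP.≤-trans (ℕP.*-monoʳ-≤ N trivial) (ℕP.≤-trans (ℕP.≤-reflexive (≡.sym (ℕP.+-identityʳ (N ℕ.* ℓ)))) (ℕP.m≤n+m (N ℕ.* ℓ ℕ.+ 0) (W ℕ.* ℓ)))

      K : ℕ
      K = cert-degree D

      -- Along v₀ + s w the certificate is a polynomial in s of degree at most K. Its value at s = 0
      -- is the nonzero certificate of v₀, so it cannot have more than K roots.
      bad-on-line : ∀ w → sumℕ (upTo k) (λ t → bad (along (+ suc t) v₀ w)) ≤ K
      bad-on-line w = ≡.subst (_≤ K) (≡.sym (sum-bit P? (upTo k))) few
        where
        P? : ∀ t → Dec (cert D f a (along (+ suc t) v₀ w) n ≈ + 0)
        P? t = cert D f a (along (+ suc t) v₀ w) n ≟ + 0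
        polynomial = cert-along D f low a v₀ w n n<D
        p : List ℤ
        p = proj₁ polynomial
        p≈ : ∀ s → eval s p ≈ cert D f a (along s v₀ w) n
        p≈ = proj₂ (proj₂ polynomial)
        zs : List ℤ
        zs = map (λ t → + suc t) (filter P? (upTo k))
        distinct : Distinct zs
        distinct = AllPairsP.map⁺ (AllPairsP.filter⁺ P? (AllPairsP.applyUpTo⁺₁ (λ t → t) k (λ i<j j<k eq → ℕP.<⇒≢ i<j (ℕP.suc-injective (small-≈⇒≡ (s≤s (ℕP.<-trans i<j j<k)) (s≤s j<k) eq)))))
        zeros : All (λ s → eval s p ≈ + 0) zs
        zeros = AllP.map⁺ (All.map (λ {t} z → trans (p≈ (+ suc t)) z) (AllP.all-filter P? (upTo k)))
        few : length (filter P? (upTo k)) ≤ K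
        few = ℕP.≮⇒≥ λ l → cert≉0 (trans (cert-cong D f (≈-refl a) (PW.sym sym (along-0 v₀ w)) n) (trans (sym (p≈ (+ 0))) (Poly.eval-≋[] ℤmod (+ 0) {p}
          (too-many-simple-roots zs p distinct zeros (ℕP.≤-trans (ℕP.≤-reflexive (proj₁ (proj₂ polynomial))) (ℕP.≤-trans l (ℕP.≤-reflexive (≡.sym (ListP.length-map _ (filter P? (upTo k)))))))))))

      -- Averaging over lines again, now through v₀ in the space of directions: k times the number
      -- of bad directions counts their incidences with these lines.
      few-bad : k ℕ.* sumℕ (points ℓ d) bad ≤ ℓ ℕ.^ d ℕ.* K
      few-bad = ℕP.≤-trans (ℕP.≤-reflexive eq) (ℕP.≤-trans (sumℕ-mono (points ℓ d) bad-on-line) (ℕP.≤-reflexive (≡.trans (sumℕ-const (points ℓ d) K) (≡.cong (ℕ._* K) (length-points ℓ d)))))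
        where
        eq : k ℕ.* sumℕ (points ℓ d) bad ≡ sumℕ (points ℓ d) (λ w → sumℕ (upTo k) (λ t → bad (along (+ suc t) v₀ w)))
        eq = ℤP.+-injective (≡.trans (ℤP.pos-* k _) (≡.trans (≡.cong (ℤ._*_ (+ k)) (≡.sym (sumL-pos (points ℓ d) bad)))
          (≡.trans (sum-lines (+_ ∘ bad) (λ p → ≡.cong +_ (bad-cong p)) v₀)
          (≡.trans (sumL-cong (points ℓ d) (λ w → sumL-pos (upTo k) _)) (sumL-pos (points ℓ d) _)))))

      S : ℤ
      S = sumL (points ℓ d) χf

      punctured : ∀ v → ∣ sumL (upTo k) (λ t → χf (along (+ suc t) a v)) ∣ ≤ 1 ℕ.+ ∣ lineSum v ∣
      punctured v = ≡.subst (λ z → ∣ z ∣ ≤ 1 ℕ.+ ∣ lineSum v ∣) (≡.sym eq) (ℕP.≤-trans (ℤP.∣i-j∣≤∣i∣+∣j∣ (lineSum v) (g 0)) (ℕP.≤-trans (ℕP.≤-reflexive (ℕP.+-comm ∣ lineSum v ∣ _)) (ℕP.+-monoˡ-≤ ∣ lineSum v ∣ (∣χ∣≤1 (ev f (along (+ 0) a v))))))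
        where
        g : ℕ → ℤ
        g t = χf (along (+ t) a v)
        tail : sumL (applyUpTo suc k) g ≡ sumL (upTo k) (g ∘ suc)
        tail = ≡.trans (≡.cong (λ xs → sumL xs g) (≡.sym (ListP.map-upTo suc k))) (sumL-map suc (upTo k) g)
        cancel : ∀ x y → y ≡ x ℤ.+ y ℤ.- x
        cancel x y = ≡.sym (≡.trans (≡.cong (ℤ._- x) (ℤP.+-comm x y)) (≡.trans (ℤP.+-assoc y x (ℤ.- x)) (≡.trans (≡.cong (ℤ._+_ y) (ℤP.+-inverseʳ x)) (ℤP.+-identityʳ y))))
        eq : sumL (upTo k) (g ∘ suc) ≡ lineSum v ℤ.- g 0
        eq = ≡.trans (≡.sym tail) (cancel (g 0) (sumL (applyUpTo suc k) g))

      k*∣S∣ : ∀ N → 4 ℕ.* (N ℕ.* N) ≤ ℓ → N ℕ.* (k ℕ.* ∣ S ∣) ≤ ℓ ℕ.^ d ℕ.* (N ℕ.+ W ℕ.* ℓ) ℕ.+ sumℕ (points ℓ d) bad ℕ.* (N ℕ.* ℓ)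
      k*∣S∣ N 4N²≤ℓ = L.begin
        N ℕ.* (k ℕ.* ∣ S ∣)                         L.≡⟨ ≡.cong (N ℕ.*_) (≡.trans (≡.sym (ℤP.abs-* (+ k) S)) (≡.cong ∣_∣ (sum-lines χf χf-cong a))) ⟩
        N ℕ.* ∣ sumL (points ℓ d) T ∣               L.≤⟨ ℕP.*-monoʳ-≤ N (abs-sumL (points ℓ d) T) ⟩
        N ℕ.* sumℕ (points ℓ d) (∣_∣ ∘ T)           L.≡⟨ sumℕ-* (points ℓ d) N _ ⟩
        sumℕ (points ℓ d) (λ v → N ℕ.* ∣ T v ∣)     L.≤⟨ sumℕ-mono (points ℓ d) each ⟩
        sumℕ (points ℓ d) (λ v → (N ℕ.+ W ℕ.* ℓ) ℕ.+ bad v ℕ.* (N ℕ.* ℓ))   L.≡⟨ sumℕ-linear (points ℓ d) _ _ bad ⟩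
        length (points ℓ d) ℕ.* (N ℕ.+ W ℕ.* ℓ) ℕ.+ sumℕ (points ℓ d) bad ℕ.* (N ℕ.* ℓ)  L.≡⟨ ≡.cong (λ z → z ℕ.* (N ℕ.+ W ℕ.* ℓ) ℕ.+ sumℕ (points ℓ d) bad ℕ.* (N ℕ.* ℓ)) (length-points ℓ d) ⟩
        ℓ ℕ.^ d ℕ.* (N ℕ.+ W ℕ.* ℓ) ℕ.+ sumℕ (points ℓ d) bad ℕ.* (N ℕ.* ℓ)  L.∎
        where
        T : Vec ℤ d → ℤ
        T v = sumL (upTo k) (λ t → χf (along (+ suc t) a v))
        each : ∀ v → N ℕ.* ∣ T v ∣ ≤ (N ℕ.+ W ℕ.* ℓ) ℕ.+ bad v ℕ.* (N ℕ.* ℓ)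
        each v = ℕP.≤-trans (ℕP.*-monoʳ-≤ N (punctured v)) (ℕP.≤-trans (ℕP.≤-reflexive (ℕP.*-distribˡ-+ N 1 _))
          (ℕP.≤-trans (ℕP.+-mono-≤ (ℕP.≤-reflexive (ℕP.*-identityʳ N)) (line-bound N 4N²≤ℓ v)) (ℕP.≤-reflexive (≡.sym (ℕP.+-assoc N _ _)))))

      -- Two factors k = ℓ - 1 have to be divided out, one from the averaging and one from the count
      -- of bad directions. Multiplying by ℓ² ≤ 4k² handles both at once.
      main-bound : ∀ N → 4 ℕ.* (N ℕ.* N) ≤ ℓ → N ≤ ℓ → N ℕ.* ∣ S ∣ ≤ 4 ℕ.* (1 ℕ.+ W ℕ.+ K) ℕ.* ℓ ℕ.^ d
      main-bound N 4N²≤ℓ N≤ℓ = ℕP.*-cancelˡ-≤ (ℓ ℕ.* ℓ) (L.begin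
        ℓ ℕ.* ℓ ℕ.* (N ℕ.* ∣ S ∣)                   L.≤⟨ ℕP.*-monoˡ-≤ (N ℕ.* ∣ S ∣) (ℕP.*-mono-≤ ℓ≤2k ℓ≤2k) ⟩
        2 ℕ.* k ℕ.* (2 ℕ.* k) ℕ.* (N ℕ.* ∣ S ∣)     L.≡⟨ eq₁ k N ∣ S ∣ ⟩
        4 ℕ.* (k ℕ.* (N ℕ.* (k ℕ.* ∣ S ∣)))         L.≤⟨ ℕP.*-monoʳ-≤ 4 (ℕP.*-monoʳ-≤ k (k*∣S∣ N 4N²≤ℓ)) ⟩
        4 ℕ.* (k ℕ.* (Q ℕ.* (N ℕ.+ W ℕ.* ℓ) ℕ.+ B ℕ.* (N ℕ.* ℓ)))  L.≡⟨ eq₂ k Q N W ℓ B ⟩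
        4 ℕ.* (Q ℕ.* (k ℕ.* N ℕ.+ k ℕ.* (W ℕ.* ℓ)) ℕ.+ k ℕ.* B ℕ.* (N ℕ.* ℓ))  L.≤⟨ ℕP.*-monoʳ-≤ 4 (ℕP.+-mono-≤ (ℕP.*-monoʳ-≤ Q (ℕP.+-mono-≤ (ℕP.*-mono-≤ k≤ℓ N≤ℓ) (ℕP.*-monoˡ-≤ (W ℕ.* ℓ) k≤ℓ))) (ℕP.*-mono-≤ few-bad (ℕP.*-monoˡ-≤ ℓ N≤ℓ))) ⟩
        4 ℕ.* (Q ℕ.* (ℓ ℕ.* ℓ ℕ.+ ℓ ℕ.* (W ℕ.* ℓ)) ℕ.+ Q ℕ.* K ℕ.* (ℓ ℕ.* ℓ))  L.≡⟨ eq₃ Q ℓ W K ⟩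
        ℓ ℕ.* ℓ ℕ.* (4 ℕ.* (1 ℕ.+ W ℕ.+ K) ℕ.* Q)   L.∎)
        where
        Q = ℓ ℕ.^ d
        B = sumℕ (points ℓ d) bad
        k≤ℓ : k ≤ ℓ
        k≤ℓ = ℕP.n≤1+n k
        ℓ≤2k : ℓ ≤ 2 ℕ.* k
        ℓ≤2k = ℕP.≤-trans (ℕP.+-monoˡ-≤ k 1≤k) (ℕP.≤-reflexive (≡.cong (k ℕ.+_) (≡.sym (ℕP.+-identityʳ k))))
        eq₁ : ∀ k N s → 2 ℕ.* k ℕ.* (2 ℕ.* k) ℕ.* (N ℕ.* s) ≡ 4 ℕ.* (k ℕ.* (N ℕ.* (k ℕ.* s)))
        eq₁ = solve-∀
        eq₂ : ∀ k Q N W l B → 4 ℕ.* (k ℕ.* (Q ℕ.* (N ℕ.+ W ℕ.* l) ℕ.+ B ℕ.* (N ℕ.* l))) ≡ 4 ℕ.* (Q ℕ.* (k ℕ.* N ℕ.+ k ℕ.* (W ℕ.* l)) ℕ.+ k ℕ.* B ℕ.* (N ℕ.* l))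
        eq₂ = solve-∀
        eq₃ : ∀ Q l W K → 4 ℕ.* (Q ℕ.* (l ℕ.* l ℕ.+ l ℕ.* (W ℕ.* l)) ℕ.+ Q ℕ.* K ℕ.* (l ℕ.* l)) ≡ l ℕ.* l ℕ.* (4 ℕ.* (1 ℕ.+ W ℕ.+ K) ℕ.* Q)
        eq₃ = solve-∀

-- A normal form of f, and values as functions of the coefficients

module Normal where
  open Lines using (module Ev)

  -- Serves both as a set of exponents and as a grid of sample points.
  box : ∀ d → ℕ → List (Vec ℕ d)
  box zero m = [] ∷ []
  box (suc d) m = cartesianProductWith _∷_ (upTo (suc m)) (box d m)

  box-unique : ∀ d m → Unique (box d m)
  box-unique zero m = [] ∷ []
  box-unique (suc d) m = cartesianProductWith⁺ _∷_ VecP.∷-injective (upTo⁺ (suc m)) (box-unique d m)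

  ∈-box : ∀ {d m} {e : Vec ℕ d} → VAll.All (_≤ m) e → e ∈ box d m
  ∈-box VAll.[] = here ≡.refl
  ∈-box (l VAll.∷ ls) = ∈-cartesianProductWith⁺ _∷_ (∈-upTo⁺ (s≤s l)) (∈-box ls)

  ∈-box⁻ : ∀ {d m} {e : Vec ℕ d} → e ∈ box d m → VAll.All (_≤ m) e
  ∈-box⁻ {zero} {m} {[]} _ = VAll.[]
  ∈-box⁻ {suc d} {m} p with ∈-cartesianProductWith⁻ _∷_ (upTo (suc m)) (box d m) p
  ... | n , e , n∈ , e∈ , ≡.refl = ℕP.≤-pred (∈-upTo⁻ n∈) VAll.∷ ∈-box⁻ e∈

  entries≤totalDeg : ∀ {d m} (e : Vec ℕ d) → totalDeg e ≤ m → VAll.All (_≤ m) e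
  entries≤totalDeg [] l = VAll.[]
  entries≤totalDeg (n ∷ e) l = ℕP.≤-trans (ℕP.m≤m+n n _) l VAll.∷ entries≤totalDeg e (ℕP.≤-trans (ℕP.m≤n+m _ n) l)

  totalDeg-box : ∀ {d m} {e : Vec ℕ d} → VAll.All (_≤ m) e → totalDeg e ≤ d ℕ.* m
  totalDeg-box VAll.[] = z≤n
  totalDeg-box (l VAll.∷ ls) = ℕP.+-mono-≤ l (totalDeg-box ls)

  -- f may contain cancelling terms of arbitrarily high degree.
  normal : ∀ {d} → ℕ → PolyZ d → PolyZ d
  normal {d} m f = map (λ e → coeffZ f e , e) (box d m)

  coeffZ-∉ : ∀ {d} (φ : Mono d → ℤ) E e → e ∉ E → coeffZ (map (λ e → φ e , e) E) e ≡ + 0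
  coeffZ-∉ φ [] e e∉ = ≡.refl
  coeffZ-∉ φ (x ∷ E) e e∉ with x ≟m e
  ... | yes x≡e = contradiction (here (≡.sym x≡e)) e∉
  ... | no _ = coeffZ-∉ φ E e (λ p → e∉ (there p))

  coeffZ-∈ : ∀ {d} (φ : Mono d → ℤ) E e → Unique E → e ∈ E → coeffZ (map (λ e → φ e , e) E) e ≡ φ e
  coeffZ-∈ φ (x ∷ E) e (x≢ ∷ u) p with x ≟m e
  coeffZ-∈ φ (x ∷ E) e (x≢ ∷ u) p | yes ≡.refl = ≡.trans (≡.cong (ℤ._+_ (φ x)) (coeffZ-∉ φ E e (λ q → All.lookup x≢ q ≡.refl))) (ℤP.+-identityʳ _)
  coeffZ-∈ φ (x ∷ E) e (x≢ ∷ u) (here e≡x) | no x≢e = contradiction (≡.sym e≡x) x≢e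
  coeffZ-∈ φ (x ∷ E) e (x≢ ∷ u) (there p) | no x≢e = coeffZ-∈ φ E e u p

  _∈?_ : ∀ {d} (e : Vec ℕ d) E → Dec (e ∈ E)
  e ∈? E = any? (λ x → e ≟m x) E

  coeffZ-normal : ∀ {d} m (f : PolyZ d) → (∀ e → coeffZ f e ≢ + 0 → totalDeg e ≤ m) → ∀ e → coeffZ (normal m f) e ≡ coeffZ f e
  coeffZ-normal {d} m f low e with e ∈? box d m
  ... | yes e∈ = coeffZ-∈ (coeffZ f) (box d m) e (box-unique d m) e∈
  ... | no e∉ with coeffZ f e ℤ.≟ + 0
  ...   | yes z = ≡.trans (coeffZ-∉ (coeffZ f) (box d m) e e∉) (≡.sym z)
  ...   | no nz = contradiction (∈-box (entries≤totalDeg e (low e nz))) e∉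

  -- The whole box of exponents is listed, including zero terms of total degree above m; hence d m
  -- takes over as the degree bound.
  normal-low : ∀ {d} m (f : PolyZ d) → All (λ t → totalDeg (proj₂ t) ≤ d ℕ.* m) (normal m f)
  normal-low {d} m f = AllP.map⁺ (All.tabulate λ e∈ → totalDeg-box (∈-box⁻ e∈))

  module _ (S : CommutativeRing 0ℓ 0ℓ) where
    open Kit S
    open Ev S

    private
      rest : ∀ {d} → Mono d → PolyZ d → PolyZ d
      rest e [] = []
      rest e ((c , e′) ∷ f) with e′ ≟m e
      ... | yes _ = rest e f
      ... | no _ = (c , e′) ∷ rest e f

      length-rest : ∀ {d} (e : Mono d) f → length (rest e f) ≤ length f
      length-rest e [] = z≤n
      length-rest e ((c , e′) ∷ f) with e′ ≟m e
      ... | yes _ = ℕP.m≤n⇒m≤1+n (length-rest e f)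
      ... | no _ = s≤s (length-rest e f)

      coeffZ-rest : ∀ {d} (e : Mono d) f → (∀ e′ → coeffZ f e′ ≡ + 0) → ∀ e′ → coeffZ (rest e f) e′ ≡ + 0
      coeffZ-rest e f z e′ with e ≟m e′
      ... | yes ≡.refl = same f
        where
        same : ∀ f → coeffZ (rest e f) e ≡ + 0
        same [] = ≡.refl
        same ((c , x) ∷ f) with x ≟m e
        ... | yes _ = same f
        ... | no x≢e with x ≟m e
        ...   | yes x≡e = contradiction x≡e x≢e
        ...   | no _ = same f
      ... | no e≢e′ = ≡.trans (other f) (z e′)
        where
        other : ∀ f → coeffZ (rest e f) e′ ≡ coeffZ f e′
        other [] = ≡.refl
        other ((c , x) ∷ f) with x ≟m e
        other ((c , x) ∷ f) | yes ≡.refl with x ≟m e′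
        ... | yes x≡e′ = contradiction x≡e′ e≢e′
        ... | no _ = other f
        other ((c , x) ∷ f) | no _ with x ≟m e′
        ... | yes _ = ≡.cong (ℤ._+_ c) (other f)
        ... | no _ = other f

      ev-rest : ∀ {d} (e : Mono d) f x → ev f x ≈ ι (coeffZ f e) * mono x e + ev (rest e f) x
      ev-rest e [] x = sym (trans (+-identityʳ _) (zeroˡ _))
      ev-rest e ((c , e′) ∷ f) x with e′ ≟m e
      ... | yes ≡.refl = trans (+-congˡ (ev-rest e f x)) (trans (sym (+-assoc _ _ _)) (+-congʳ (trans (sym (distribʳ _ _ _)) (*-congʳ (sym (ι-+ c (coeffZ f e)))))))
      ... | no _ = trans (+-congˡ (ev-rest e f x)) (trans (sym (+-assoc _ _ _)) (trans (+-congʳ (+-comm _ _)) (+-assoc _ _ _)))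

      -- All terms sharing the first exponent are collected into one, whose coefficient is zero, and
      -- removed. What remains is shorter but no subterm, so n bounds the recursion.
      zero-ev : ∀ n {d} (f : PolyZ d) → length f ≤ n → (∀ e → coeffZ f e ≡ + 0) → ∀ x → ev f x ≈ 0#
      zero-ev n [] l z x = refl
      zero-ev (suc n) ((c , e) ∷ f) (s≤s l) z x = trans (ev-rest e ((c , e) ∷ f) x) (trans (+-cong
        (trans (*-congʳ (reflexive (≡.cong ι (z e)))) (zeroˡ _))
        (zero-ev n (rest e ((c , e) ∷ f)) (shorter l) (coeffZ-rest e ((c , e) ∷ f) z) x)) (+-identityʳ _))
        where
        shorter : length f ≤ n → length (rest e ((c , e) ∷ f)) ≤ n
        shorter l with e ≟m e
        ... | yes _ = ℕP.≤-trans (length-rest e f) l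
        ... | no e≢e = contradiction ≡.refl e≢e

      negate : ∀ {d} → PolyZ d → PolyZ d
      negate = map (λ t → ℤ.- proj₁ t , proj₂ t)

      ev-++ : ∀ {d} (f g : PolyZ d) x → ev (f ++ g) x ≈ ev f x + ev g x
      ev-++ [] g x = sym (+-identityˡ _)
      ev-++ (t ∷ f) g x = trans (+-congˡ (ev-++ f g x)) (sym (+-assoc _ _ _))

      ev-negate : ∀ {d} (f : PolyZ d) x → ev (negate f) x ≈ - ev f x
      ev-negate [] x = sym -0#≈0#
      ev-negate ((c , e) ∷ f) x = trans (+-cong (trans (*-congʳ (ι-neg c)) (sym (-‿distribˡ-* _ _))) (ev-negate f x)) (-‿+-comm _ _)

      coeffZ-++ : ∀ {d} (f g : PolyZ d) e → coeffZ (f ++ g) e ≡ coeffZ f e ℤ.+ coeffZ g e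
      coeffZ-++ [] g e = ≡.sym (ℤP.+-identityˡ _)
      coeffZ-++ ((c , e′) ∷ f) g e with e′ ≟m e
      ... | yes _ = ≡.trans (≡.cong (ℤ._+_ c) (coeffZ-++ f g e)) (≡.sym (ℤP.+-assoc c _ _))
      ... | no _ = coeffZ-++ f g e

      coeffZ-negate : ∀ {d} (f : PolyZ d) e → coeffZ (negate f) e ≡ ℤ.- coeffZ f e
      coeffZ-negate [] e = ≡.refl
      coeffZ-negate ((c , e′) ∷ f) e with e′ ≟m e
      ... | yes _ = ≡.trans (≡.cong (ℤ._+_ (ℤ.- c)) (coeffZ-negate f e)) (≡.sym (ℤP.neg-distrib-+ c _))
      ... | no _ = coeffZ-negate f e

    ev-ext : ∀ {d} (f g : PolyZ d) → (∀ e → coeffZ f e ≡ coeffZ g e) → ∀ x → ev f x ≈ ev g x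
    ev-ext f g eq x = x∙y⁻¹≈ε⇒x≈y _ _ (trans (sym (trans (ev-++ f (negate g) x) (+-congˡ (ev-negate g x))))
      (zero-ev _ (f ++ negate g) ℕP.≤-refl (λ e → ≡.trans (coeffZ-++ f (negate g) e) (≡.trans (≡.cong₂ ℤ._+_ (eq e) (coeffZ-negate g e)) (ℤP.+-inverseʳ (coeffZ g e)))) x))

-- Polynomials in several variables as lists of terms

module Terms (R : CommutativeRing 0ℓ 0ℓ) where
  open Morphism
  open Kit R
  open Lines.Ev R using (mono)

  Terms : ℕ → Set
  Terms d = List (Carrier × Mono d)

  evT : ∀ {d} → Terms d → Vec Carrier d → Carrier
  evT [] x = 0#
  evT ((c , e) ∷ p) x = c * mono x e + evT p x

  coeffT : ∀ {d} → Terms d → Mono d → Carrier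
  coeffT [] e = 0#
  coeffT ((c , e′) ∷ p) e with e′ ≟m e
  ... | yes _ = c + coeffT p e
  ... | no _ = coeffT p e

  mulTerm : ∀ {d} → Carrier × Mono d → Terms d → Terms d
  mulTerm (a , e) = map (λ { (b , e′) → a * b , addMono e e′ })

  mulT : ∀ {d} → Terms d → Terms d → Terms d
  mulT p q = concatMap (λ t → mulTerm t q) p

  scaleT : ∀ {d} → Carrier → Terms d → Terms d
  scaleT a = map (λ { (b , e) → a * b , e })

  constT : ∀ {d} → Carrier → Terms d
  constT c = (c , Vec.replicate _ 0) ∷ []

  varT : ∀ {d} → Fin d → Terms d
  varT i = (1# , Vec.replicate _ 0 Vec.[ i ]≔ 1) ∷ []

  evT-++ : ∀ {d} (p q : Terms d) x → evT (p ++ q) x ≈ evT p x + evT q x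
  evT-++ [] q x = sym (+-identityˡ _)
  evT-++ (t ∷ p) q x = trans (+-congˡ (evT-++ p q x)) (sym (+-assoc _ _ _))

  evT-scale : ∀ {d} a (p : Terms d) x → evT (scaleT a p) x ≈ a * evT p x
  evT-scale a [] x = sym (zeroʳ a)
  evT-scale a ((b , e) ∷ p) x = trans (+-cong (*-assoc _ _ _) (evT-scale a p x)) (sym (distribˡ _ _ _))

  mono-addMono : ∀ {d} (x : Vec Carrier d) e e′ → mono x (addMono e e′) ≈ mono x e * mono x e′
  mono-addMono [] [] [] = sym (*-identityˡ _)
  mono-addMono (x ∷ xs) (e ∷ es) (e′ ∷ es′) = trans (*-cong (^-homo-* x e e′) (mono-addMono xs es es′))
    (solve 4 (λ a b c d → (a :* b) :* (c :* d) := (a :* c) :* (b :* d)) refl _ _ _ _)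

  evT-mulTerm : ∀ {d} a e (q : Terms d) x → evT (mulTerm (a , e) q) x ≈ a * mono x e * evT q x
  evT-mulTerm a e [] x = sym (zeroʳ _)
  evT-mulTerm a e ((b , e′) ∷ q) x = trans (+-cong (*-congˡ (mono-addMono x e e′)) (evT-mulTerm a e q x))
    (solve 5 (λ a b m n r → a :* b :* (m :* n) :+ a :* m :* r := a :* m :* (b :* n :+ r)) refl _ _ _ _ _)

  evT-mul : ∀ {d} (p q : Terms d) x → evT (mulT p q) x ≈ evT p x * evT q x
  evT-mul [] q x = sym (zeroˡ _)
  evT-mul ((a , e) ∷ p) q x = trans (evT-++ (mulTerm (a , e) q) _ x) (trans (+-cong (evT-mulTerm a e q x) (evT-mul p q x)) (sym (distribʳ _ _ _)))

  mono-0 : ∀ {d} (x : Vec Carrier d) → mono x (Vec.replicate d 0) ≈ 1#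
  mono-0 [] = refl
  mono-0 (x ∷ xs) = trans (*-identityˡ _) (mono-0 xs)

  evT-const : ∀ {d} c (x : Vec Carrier d) → evT (constT c) x ≈ c
  evT-const c x = trans (+-identityʳ _) (trans (*-congˡ (mono-0 x)) (*-identityʳ c))

  evT-var : ∀ {d} (i : Fin d) x → evT (varT i) x ≈ Vec.lookup x i
  evT-var i x = trans (+-identityʳ _) (trans (*-identityˡ _) (go i x))
    where
    go : ∀ {d} (i : Fin d) (x : Vec Carrier d) → mono x (Vec.replicate d 0 Vec.[ i ]≔ 1) ≈ Vec.lookup x i
    go Fin.zero (x ∷ xs) = trans (*-cong (*-identityʳ x) (mono-0 xs)) (*-identityʳ x)
    go (Fin.suc i) (x ∷ xs) = trans (*-identityˡ _) (go i xs)

  -- Polynomials up to equality of the functions they define: evaluation makes every ring axiom immediate.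
  infix 4 _≈ᶠ_
  record _≈ᶠ_ {d} (p q : Terms d) : Set where
    constructor mk≈ᶠ
    field at-point : ∀ x → evT p x ≈ evT q x
  open _≈ᶠ_ public

  module _ (d : ℕ) where
    private
      by : ∀ {p q : Terms d} → (∀ x → evT p x ≈ evT q x) → p ≈ᶠ q
      by = mk≈ᶠ

      neg : Terms d → Terms d
      neg = scaleT (- 1#)

      evT-neg : ∀ p x → evT (neg p) x ≈ - evT p x
      evT-neg p x = trans (evT-scale (- 1#) p x) (trans (sym (-‿distribˡ-* 1# _)) (-‿cong (*-identityˡ _)))

    TermsRing : CommutativeRing 0ℓ 0ℓ
    TermsRing = record
      { Carrier = Terms d ; _≈_ = _≈ᶠ_ ; _+_ = _++_ ; _*_ = mulT ; -_ = neg ; 0# = [] ; 1# = constT 1#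
      ; isCommutativeRing = record
        { isRing = record
          { +-isAbelianGroup = record
            { isGroup = record
              { isMonoid = record
                { isSemigroup = record
                  { isMagma = record
                    { isEquivalence = record { refl = by λ x → refl ; sym = λ e → by λ x → sym (at-point e x) ; trans = λ e f → by λ x → trans (at-point e x) (at-point f x) }
                    ; ∙-cong = λ {p} {q} {r} {s} e f → by λ x → trans (evT-++ p r x) (trans (+-cong (at-point e x) (at-point f x)) (sym (evT-++ q s x))) }
                  ; assoc = λ p q r → by λ x → reflexive (≡.cong (λ t → evT t x) (ListP.++-assoc p q r)) }
                ; identity = (λ p → by λ x → refl) , (λ p → by λ x → trans (evT-++ p [] x) (+-identityʳ _)) }
              ; inverse = (λ p → by λ x → trans (evT-++ (neg p) p x) (trans (+-congʳ (evT-neg p x)) (-‿inverseˡ _))) ,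
                          (λ p → by λ x → trans (evT-++ p (neg p) x) (trans (+-congˡ (evT-neg p x)) (-‿inverseʳ _)))
              ; ⁻¹-cong = λ {p} {q} e → by λ x → trans (evT-neg p x) (trans (-‿cong (at-point e x)) (sym (evT-neg q x))) }
            ; comm = λ p q → by λ x → trans (evT-++ p q x) (trans (+-comm _ _) (sym (evT-++ q p x))) }
          ; *-cong = λ {p} {q} {r} {s} e f → by λ x → trans (evT-mul p r x) (trans (*-cong (at-point e x) (at-point f x)) (sym (evT-mul q s x)))
          ; *-assoc = λ p q r → by λ x → trans (evT-mul (mulT p q) r x) (trans (*-congʳ (evT-mul p q x)) (trans (*-assoc _ _ _) (sym (trans (evT-mul p (mulT q r) x) (*-congˡ (evT-mul q r x))))))
          ; *-identity = (λ p → by λ x → trans (evT-mul (constT 1#) p x) (trans (*-congʳ (evT-const 1# x)) (*-identityˡ _))) ,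
                         (λ p → by λ x → trans (evT-mul p (constT 1#) x) (trans (*-congˡ (evT-const 1# x)) (*-identityʳ _)))
          ; distrib = (λ p q r → by λ x → trans (evT-mul p (q ++ r) x) (trans (*-congˡ (evT-++ q r x)) (trans (distribˡ _ _ _) (sym (trans (evT-++ (mulT p q) (mulT p r) x) (+-cong (evT-mul p q x) (evT-mul p r x))))))) ,
                      (λ p q r → by λ x → trans (evT-mul (q ++ r) p x) (trans (*-congʳ (evT-++ q r x)) (trans (distribʳ _ _ _) (sym (trans (evT-++ (mulT q p) (mulT r p) x) (+-cong (evT-mul q p x) (evT-mul r p x)))))))
          }
        ; *-comm = λ p q → by λ x → trans (evT-mul p q x) (trans (*-comm _ _) (sym (evT-mul q p x))) } }

    evT-Hom : Vec Carrier d → Hom TermsRing R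
    evT-Hom x = record
      { ⟦_⟧ = λ p → evT p x ; cong = λ e → at-point e x ; +-hom = λ p q → evT-++ p q x ; *-hom = λ p q → evT-mul p q x ; 1-hom = evT-const 1# x }

  coeffT-++ : ∀ {d} (p q : Terms d) e → coeffT (p ++ q) e ≈ coeffT p e + coeffT q e
  coeffT-++ [] q e = sym (+-identityˡ _)
  coeffT-++ ((c , e′) ∷ p) q e with e′ ≟m e
  ... | yes _ = trans (+-congˡ (coeffT-++ p q e)) (sym (+-assoc _ _ _))
  ... | no _ = coeffT-++ p q e

  coeffT-scale : ∀ {d} a (p : Terms d) e → coeffT (scaleT a p) e ≈ a * coeffT p e
  coeffT-scale a [] e = sym (zeroʳ a)
  coeffT-scale a ((c , e′) ∷ p) e with e′ ≟m e
  ... | yes _ = trans (+-congˡ (coeffT-scale a p e)) (sym (distribˡ _ _ _))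
  ... | no _ = coeffT-scale a p e

  -- The coefficient of the n-th power of the first variable, a polynomial in the others.
  slice : ∀ {d} → ℕ → Terms (suc d) → Terms d
  slice n [] = []
  slice n ((c , k ∷ e) ∷ p) with k ℕP.≟ n
  ... | yes _ = (c , e) ∷ slice n p
  ... | no _ = slice n p

  coeffT-slice : ∀ {d} (p : Terms (suc d)) n e → coeffT p (n ∷ e) ≈ coeffT (slice n p) e
  coeffT-slice [] n e = refl
  coeffT-slice ((c , k ∷ e′) ∷ p) n e with (k ∷ e′) ≟m (n ∷ e) | k ℕP.≟ n
  ... | yes ≡.refl | no k≢k = contradiction ≡.refl k≢k
  ... | no _ | no _ = coeffT-slice p n e
  ... | yes ke | yes ≡.refl with e′ ≟m e
  ...   | yes _ = +-congˡ (coeffT-slice p n e)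
  ...   | no e≢ = contradiction (≡.cong Vec.tail ke) e≢
  coeffT-slice ((c , k ∷ e′) ∷ p) n e | no ke≢ | yes ≡.refl with e′ ≟m e
  ...   | yes ≡.refl = contradiction ≡.refl ke≢
  ...   | no _ = coeffT-slice p n e

  open Poly R

  private
    shift : ℕ → Carrier → List Carrier
    shift zero c = c ∷ []
    shift (suc k) c = 0# ∷ shift k c

    eval-shift : ∀ x k c → eval x (shift k c) ≈ x ^ k * c
    eval-shift x zero c = trans (eval-C x c) (sym (*-identityˡ c))
    eval-shift x (suc k) c = trans (+-identityˡ _) (trans (*-congˡ (eval-shift x k c)) (sym (*-assoc _ _ _)))

    coef-shift-≡ : ∀ k c → coef (shift k c) k ≈ c
    coef-shift-≡ zero c = refl
    coef-shift-≡ (suc k) c = coef-shift-≡ k c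

    coef-shift-≢ : ∀ k c n → k ≢ n → coef (shift k c) n ≈ 0#
    coef-shift-≢ zero c zero k≢n = contradiction ≡.refl k≢n
    coef-shift-≢ zero c (suc n) k≢n = refl
    coef-shift-≢ (suc k) c zero k≢n = refl
    coef-shift-≢ (suc k) c (suc n) k≢n = coef-shift-≢ k c n (λ e → k≢n (≡.cong suc e))

  -- The polynomial in the first variable that remains when the others are fixed.
  fibre : ∀ {d} → Terms (suc d) → Vec Carrier d → List Carrier
  fibre [] x = []
  fibre ((c , k ∷ e) ∷ p) x = shift k (c * mono x e) P.+ fibre p x

  eval-fibre : ∀ {d} (p : Terms (suc d)) y x → eval y (fibre p x) ≈ evT p (y ∷ x)
  eval-fibre [] y x = refl
  eval-fibre ((c , k ∷ e) ∷ p) y x = trans (eval-+ y (shift k (c * mono x e)) _) (+-cong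
    (trans (eval-shift y k _) (solve 3 (λ a b c → a :* (b :* c) := b :* (a :* c)) refl _ _ _)) (eval-fibre p y x))

  coef-fibre : ∀ {d} (p : Terms (suc d)) n x → coef (fibre p x) n ≈ evT (slice n p) x
  coef-fibre [] n x = refl
  coef-fibre ((c , k ∷ e) ∷ p) n x with k ℕP.≟ n
  ... | yes ≡.refl = trans (coef-add (shift k (c * mono x e)) _ n) (+-cong (coef-shift-≡ k _) (coef-fibre p n x))
  ... | no k≢n = trans (coef-add (shift k (c * mono x e)) _ n) (trans (+-cong (coef-shift-≢ k _ n k≢n) (coef-fibre p n x)) (+-identityˡ _))

  module _ (vanishing : ∀ p → (∀ x → eval x p ≈ 0#) → p ≋ []) where
    -- Each fibre is a polynomial in one variable with all values zero, so its coefficients are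
    -- zero. These are the values of the slices, to which the induction on d applies.
    coefficients-vanish : ∀ {d} (p : Terms d) → (∀ x → evT p x ≈ 0#) → ∀ e → coeffT p e ≈ 0#
    coefficients-vanish {zero} p z [] = trans (go p) (z [])
      where
      go : ∀ p → coeffT p [] ≈ evT p []
      go [] = refl
      go ((c , []) ∷ p) = +-cong (sym (*-identityʳ c)) (go p)
    coefficients-vanish {suc d} p z (n ∷ e) = trans (coeffT-slice p n e) (coefficients-vanish (slice n p)
      (λ x → trans (sym (coef-fibre p n x)) (at (vanishing (fibre p x) (λ y → trans (eval-fibre p y x) (z (y ∷ x)))) n)) e)

-- Vanishing on grids in characteristic zero

module Grid (R : CommutativeRing 0ℓ 0ℓ)
  (_≟_ : Discrete R)
  (domain : NoZeroDivisors R)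
  (char0 : (i : ℕ) → ¬ CommutativeRing._≈_ R (Kit.ι R (+ suc i)) (CommutativeRing.0# R)) where
  open Kit R
  open Poly R
  open Domain R _≟_ domain
  open Lines.Line R using (along)

  nat : ℕ → Carrier
  nat n = ι (+ n)

  nat-injective : ∀ {i j} → i < j → ¬ nat i ≈ nat j
  nat-injective {i} {j} i<j e with ℕP.m≤n⇒∃[o]m+o≡n i<j
  ... | o , ≡.refl = char0 o (begin
    nat (suc o)                       ≈⟨ solve 2 (λ a b → a := (b :+ a) :- b) refl (nat (suc o)) (nat i) ⟩
    (nat i + nat (suc o)) - nat i     ≈⟨ +-congʳ (ι-+ (+ i) (+ suc o)) ⟨
    nat (i ℕ.+ suc o) - nat i         ≈⟨ +-congʳ (trans (reflexive (≡.cong nat (ℕP.+-suc i o))) (sym e)) ⟩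
    nat i - nat i                     ≈⟨ -‿inverseʳ _ ⟩
    0#                                ∎)

  roots⇒zero : ∀ K p → length p ≤ suc K → (∀ n → n ≤ K → eval (nat n) p ≈ 0#) → p ≋ []
  roots⇒zero K p l z = too-many-simple-roots (applyUpTo nat (suc K)) p
    (AllPairsP.applyUpTo⁺₁ nat (suc K) (λ i<j _ → nat-injective i<j))
    (AllP.applyUpTo⁺₁ nat (suc K) (λ i<K → z _ (ℕP.≤-pred i<K)))
    (ℕP.≤-trans l (ℕP.≤-reflexive (≡.sym (ListP.length-applyUpTo nat (suc K)))))

  vanishing : ∀ p → (∀ x → eval x p ≈ 0#) → p ≋ []
  vanishing p z = roots⇒zero (length p) p (ℕP.n≤1+n _) (λ n _ → z (nat n))

  -- Polynomiality is recorded through restrictions to lines, the form in which it is known for the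
  -- certificate as a function of the direction.
  record Polynomial {d} (K : ℕ) (φ : Vec Carrier d → Carrier) : Set where
    field
      φ-cong : ∀ {x y} → Pointwise _≈_ x y → φ x ≈ φ y
      on-line : ∀ v w → ∃[ p ] (length p ≡ suc K × (∀ s → eval s p ≈ φ (along s v w)))

  private
    ≈-refl : ∀ {d} (v : Vec Carrier d) → Pointwise _≈_ v v
    ≈-refl [] = []
    ≈-refl (x ∷ v) = refl ∷ ≈-refl v

    along-zeros : ∀ {d} s (v : Vec Carrier d) → Pointwise _≈_ (along s v (Vec.replicate d 0#)) v
    along-zeros s [] = []
    along-zeros s (x ∷ v) = trans (+-congˡ (zeroʳ s)) (+-identityʳ x) ∷ along-zeros s v

  -- By induction φ vanishes on the hyperplanes with first coordinate 0, ..., K. The line through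
  -- the given point parallel to the first axis meets them in K + 1 points, too many for its degree.
  grid-zero : ∀ {d} K (φ : Vec Carrier d → Carrier) → Polynomial K φ →
    (∀ (g : Vec ℕ d) → VAll.All (_≤ K) g → φ (Vec.map nat g) ≈ 0#) → ∀ x → φ x ≈ 0#
  grid-zero {zero} K φ pol z [] = z [] VAll.[]
  grid-zero {suc d} K φ pol z (x ∷ xs) = begin
    φ (x ∷ xs)                                                    ≈⟨ φ-cong (trans (sym (*-identityʳ x)) (sym (+-identityˡ _)) ∷ PW.sym sym (along-zeros x xs)) ⟩
    φ (along x (0# ∷ xs) (1# ∷ Vec.replicate d 0#))               ≈⟨ proj₂ (proj₂ line) x ⟨
    eval x (proj₁ line)                                           ≈⟨ eval-≋[] x {proj₁ line} (roots⇒zero K (proj₁ line) (ℕP.≤-reflexive (proj₁ (proj₂ line))) root) ⟩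
    0#                                                            ∎
    where
    open Polynomial pol
    line = on-line (0# ∷ xs) (1# ∷ Vec.replicate d 0#)
    hyperplane : ∀ n → Polynomial K (λ y → φ (nat n ∷ y))
    hyperplane n = record
      { φ-cong = λ e → φ-cong (refl ∷ e)
      ; on-line = λ v w → let (p , l , e) = on-line (nat n ∷ v) (0# ∷ w) in
          p , l , λ s → trans (e s) (φ-cong (trans (+-congˡ (zeroʳ s)) (+-identityʳ _) ∷ ≈-refl _)) }
    root : ∀ n → n ≤ K → eval (nat n) (proj₁ line) ≈ 0#
    root n n≤K = trans (proj₂ (proj₂ line) (nat n)) (trans (φ-cong (trans (+-identityˡ _) (*-identityʳ _) ∷ along-zeros (nat n) xs))
      (grid-zero K (λ y → φ (nat n ∷ y)) (hyperplane n) (λ g l → z (n ∷ g) (n≤K VAll.∷ l)) xs))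

-- Reconstruction of the square from vanishing certificates

module Square (R : CommutativeRing 0ℓ 0ℓ) where
  open Morphism
  open Lines
  open Kit R
  open Poly R
  open Ev R
  open Line R
  open Terms R

  module _ {d : ℕ} (D h : ℕ) (2h≤D : h ℕ.+ h ≤ D) (f : PolyZ d) (low : All (λ t → totalDeg (proj₂ t) ≤ D) f)
    (a : Vec Carrier d) (z : Carrier) (z-inverse : z * (ι (+ 4) * ev f a) ≈ 1#) where

    private
      TR = TermsRing d

      displacement : Vec Carrier d → Vec Carrier d
      displacement x = Vec.tabulate (λ i → Vec.lookup x i + - Vec.lookup a i)

      -- The base point and the direction x - a of the line from a to the generic point x, over the
      -- ring of polynomials in x.
      A V : Vec (Terms d) d
      A = Vec.map constT a
      V = Vec.tabulate (λ i → varT i ++ constT (- Vec.lookup a i))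

      u : Vec Carrier d → List Carrier
      u x = Truncated.section D f low a (displacement x)

      map-const : ∀ {n} (a : Vec Carrier n) x → Pointwise _≈_ (Vec.map (λ p → evT p x) (Vec.map (constT {d}) a)) a
      map-const [] x = []
      map-const (c ∷ a) x = evT-const c x ∷ map-const a x

      map-tabulate : ∀ {n} (φ : Terms d → Carrier) (F : Fin n → Terms d) (G : Fin n → Carrier) → (∀ i → φ (F i) ≈ G i) → Pointwise _≈_ (Vec.map φ (Vec.tabulate F)) (Vec.tabulate G)
      map-tabulate {zero} φ F G e = []
      map-tabulate {suc n} φ F G e = e Fin.zero ∷ map-tabulate φ (F ∘ Fin.suc) (G ∘ Fin.suc) (e ∘ Fin.suc)

      along-1 : ∀ {n} (a x : Vec Carrier n) → Pointwise _≈_ (along 1# a (Vec.tabulate (λ i → Vec.lookup x i + - Vec.lookup a i))) x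
      along-1 [] [] = []
      along-1 (a ∷ as) (x ∷ xs) = trans (+-congˡ (*-identityˡ _)) (solve 2 (λ a x → a :+ (x :- a) := x) refl a x) ∷ along-1 as xs

      coef-u : ∀ x n → evT (Poly.coef TR (Line.restrict TR f A V) n) x ≈ coef (u x) n
      coef-u x n = trans (sym (coef-mapHom (evT-Hom d x) (Line.restrict TR f A V) n))
        (trans (at (restrict-hom (evT-Hom d x) f A V) n)
        (trans (at (restrict-cong f (map-const a x) (map-tabulate _ _ _ (λ i → trans (evT-++ (varT i) (constT (- Vec.lookup a i)) x) (+-cong (evT-var i x) (evT-const (- Vec.lookup a i) x))))) n)
        (sym (at (Truncated.section≋ D f low a (displacement x)) n))))

    -- The value at t = 1 of the root along the line from a to x. It is computed with x as an
    -- indeterminate and therefore is one polynomial in x, not a family of values; z = 1/(4 f(a))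
    -- undoes the rescaling.
    root-terms : Terms d
    root-terms = Poly.eval TR (constT z) (Sqrt.root TR (Poly.coef TR (Line.restrict TR f A V)) D h)

    evT-root-terms : ∀ x → evT root-terms x ≈ eval z (Sqrt.root R (coef (u x)) D h)
    evT-root-terms x = trans (eval-hom (evT-Hom d x) (constT z) (Sqrt.root TR (Poly.coef TR (Line.restrict TR f A V)) D h))
      (trans (eval-cong _ (root-hom (evT-Hom d x) _ _ (coef-u x) D h)) (eval-point (Sqrt.root R (coef (u x)) D h) (evT-const z x)))

    is-square : (∀ v k → h ≤ k → k < D → cert D f a v k ≈ 0#) → ∀ x → ev f x ≈ ev f a * (evT root-terms x * evT root-terms x)
    is-square small x = begin
      ev f x                                             ≈⟨ ev-cong f (PW.sym sym (along-1 a x)) ⟩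
      ev f (along 1# a (displacement x))                 ≈⟨ eval-section (displacement x) 1# ⟨
      eval 1# (u x)                                      ≈⟨ Sqrt.eval-square R (u x) D h (ℕP.≤-reflexive (length-section (displacement x))) 2h≤D
                                                              (λ k h≤k k<D → trans (sqrt-section (displacement x) k) (small _ k h≤k k<D)) z (trans (*-congˡ (*-congˡ (section-0 _))) z-inverse) ⟩
      coef (u x) 0 * (eval z ρ * eval z ρ)               ≈⟨ *-cong (section-0 _) (*-cong (sym (evT-root-terms x)) (sym (evT-root-terms x))) ⟩
      ev f a * (evT root-terms x * evT root-terms x)     ∎
      where
      open Truncated D f low a
      ρ = Sqrt.root R (coef (u x)) D h

-- Rational points and the search for a certificate

module Rational where
  open Morphism
  open Lines
  open Normal

  ℤring ℚring : CommutativeRing 0ℓ 0ℓ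
  ℤring = ℤP.+-*-commutativeRing
  ℚring = ℚP.+-*-commutativeRing

  ι-Hom : ∀ S → Hom ℤring S
  ι-Hom S = record { ⟦_⟧ = ι ; cong = λ e → reflexive (≡.cong ι e) ; +-hom = ι-+ ; *-hom = ι-* ; 1-hom = ι-1 }
    where open Kit S

  private
    module Q = Kit ℚring
    module TQ = Terms ℚring

  -- Normalised fractions do not compute for a variable n, so the identity is checked on
  -- unnormalised ones.
  suc/1 : ∀ n → ℚ.1ℚ ℚ.+ (+ n ℚ./ 1) ≡ + suc n ℚ./ 1
  suc/1 n = ℚP.toℚᵘ-injective (ℚᵘP.≃-trans (ℚP.toℚᵘ-homo-+ ℚ.1ℚ (+ n ℚ./ 1)) (ℚᵘP.≃-trans (ℚᵘP.+-congʳ (ℚ.toℚᵘ ℚ.1ℚ) (ℚP.toℚᵘ-fromℚᵘ (mkℚᵘ (+ n) 0)))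
    (ℚᵘP.≃-trans (*≡* eq) (ℚᵘP.≃-sym (ℚP.toℚᵘ-fromℚᵘ (mkℚᵘ (+ suc n) 0))))))
    where
    eq : (+ 1 ℤ.* + 1 ℤ.+ + n ℤ.* + 1) ℤ.* + 1 ≡ + suc n ℤ.* + 1
    eq = ≡.cong (ℤ._* + 1) (≡.cong (ℤ._+_ (+ 1)) (ℤP.*-identityʳ (+ n)))

  ι≡/1 : ∀ i → Q.ι i ≡ i ℚ./ 1
  ι≡/1 (+ n) = go n
    where
    go : ∀ n → Q.ι (+ n) ≡ + n ℚ./ 1
    go zero = ≡.refl
    go (suc n) = ≡.trans (≡.cong (ℚ._+_ ℚ.1ℚ) (go n)) (suc/1 n)
  ι≡/1 -[1+ n ] = ≡.cong (ℚ.-_) (ι≡/1 (+ suc n))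

  ι≡0⇒≡0 : ∀ i → Q.ι i ≡ ℚ.0ℚ → i ≡ + 0
  ι≡0⇒≡0 i e with ℚᵘP.≃-trans (ℚᵘP.≃-sym (ℚP.toℚᵘ-fromℚᵘ (mkℚᵘ i 0))) (ℚP.toℚᵘ-cong (≡.trans (≡.sym (ι≡/1 i)) e))
  ... | *≡* eq = ≡.trans (≡.sym (ℤP.*-identityʳ i)) eq

  char0 : ∀ i → ¬ Q.ι (+ suc i) ≡ ℚ.0ℚ
  char0 i e with ι≡0⇒≡0 (+ suc i) e
  ... | ()

  ℚ-inverse : ∀ p → p ≢ ℚ.0ℚ → ∃[ q ] q ℚ.* p ≡ ℚ.1ℚ
  ℚ-inverse p p≢0 = ℚ.1/_ p {{ℚ.≢-nonZero p≢0}} , ℚP.*-inverseˡ p {{ℚ.≢-nonZero p≢0}}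

  ℚ-domain : ∀ p q → p ℚ.* q ≡ ℚ.0ℚ → p ≡ ℚ.0ℚ ⊎ q ≡ ℚ.0ℚ
  ℚ-domain p q e with p ℚ.≟ ℚ.0ℚ
  ... | yes p≡0 = inj₁ p≡0
  ... | no p≢0 with ℚ-inverse p p≢0
  ...   | r , rp≡1 = inj₂ (≡.trans (≡.sym (ℚP.*-identityˡ q)) (≡.trans (≡.cong (ℚ._* q) (≡.sym rp≡1))
      (≡.trans (ℚP.*-assoc r p q) (≡.trans (≡.cong (ℚ._*_ r) e) (ℚP.*-zeroʳ r)))))

  module G = Grid ℚring ℚ._≟_ ℚ-domain char0

  search : {A : Set} {P : A → Set} → (∀ x → Dec (P x)) → ∀ xs → (∃[ x ] (x ∈ xs × P x)) ⊎ (∀ x → x ∈ xs → ¬ P x)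
  search P? [] = inj₂ λ _ ()
  search P? (x ∷ xs) with P? x
  ... | yes p = inj₁ (x , here ≡.refl , p)
  ... | no ¬p with search P? xs
  ...   | inj₁ (y , y∈ , p) = inj₁ (y , there y∈ , p)
  ...   | inj₂ none = inj₂ λ { _ (here ≡.refl) → ¬p ; y (there y∈) → none y y∈ }

  coeffQ≡coeffT : ∀ {d} (p : PolyQ d) e → coeffQ p e ≡ TQ.coeffT p e
  coeffQ≡coeffT [] e = ≡.refl
  coeffQ≡coeffT ((c , e′) ∷ p) e with e′ ≟m e
  ... | yes _ = ≡.cong (ℚ._+_ c) (coeffQ≡coeffT p e)
  ... | no _ = coeffQ≡coeffT p e

  mulQ≡mulT : ∀ {d} (p q : PolyQ d) → mulQ p q ≡ TQ.mulT p q
  mulQ≡mulT [] q = ≡.refl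
  mulQ≡mulT ((a , e) ∷ p) q = ≡.cong₂ _++_ (go q) (mulQ≡mulT p q)
    where
    go : ∀ q → map (λ { (b , e′) → (a ℚ.* b , addMono e e′) }) q ≡ TQ.mulTerm (a , e) q
    go [] = ≡.refl
    go (t ∷ q) = ≡.cong (_ ∷_) (go q)

  evT-toQ : ∀ {d} (f : PolyZ d) x → TQ.evT (toQ f) x ≡ Ev.ev ℚring f x
  evT-toQ [] x = ≡.refl
  evT-toQ ((c , e) ∷ f) x = ≡.cong₂ (λ p q → p ℚ.* Ev.mono ℚring x e ℚ.+ q) (≡.sym (ι≡/1 c)) (evT-toQ f x)

  coeffQ-toQ : ∀ {d} (f : PolyZ d) e → coeffQ (toQ f) e ≡ Q.ι (coeffZ f e)
  coeffQ-toQ [] e = ≡.refl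
  coeffQ-toQ ((c , e′) ∷ f) e with e′ ≟m e
  ... | yes _ = ≡.trans (≡.cong₂ ℚ._+_ (≡.sym (ι≡/1 c)) (coeffQ-toQ f e)) (≡.sym (Q.ι-+ c (coeffZ f e)))
  ... | no _ = coeffQ-toQ f e

  coefficients-vanish : ∀ {d} (p : PolyQ d) → (∀ x → TQ.evT p x ≡ ℚ.0ℚ) → ∀ e → coeffQ p e ≡ ℚ.0ℚ
  coefficients-vanish p z e = ≡.trans (coeffQ≡coeffT p e) (TQ.coefficients-vanish G.vanishing p z e)

  module _ {d : ℕ} (D h : ℕ) (2h≤D : h ℕ.+ h ≤ D) (f : PolyZ d) (low : All (λ t → totalDeg (proj₂ t) ≤ D) f) where
    private
      module EZ = Ev ℤring
      module EQ = Ev ℚring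
      module LZ = Line ℤring
      module LQ = Line ℚring
      K = CertLine.cert-degree ℚring D

    lift : Vec ℕ d → Vec ℤ d
    lift = Vec.map +_

    private
      ιᵛ : Vec ℤ d → Vec ℚ d
      ιᵛ = Vec.map Q.ι

      nat-lift : ∀ g → Vec.map G.nat g ≡ ιᵛ (lift g)
      nat-lift g = VecP.map-∘ Q.ι +_ g

      ev-polynomial : G.Polynomial D (EQ.ev f)
      ev-polynomial = record
        { φ-cong = EQ.ev-cong f
        ; on-line = λ v w → LQ.Truncated.section D f low v w , LQ.Truncated.length-section D f low v w , LQ.Truncated.eval-section D f low v w }

      cert-polynomial : ∀ a k → k < D → G.Polynomial K (λ v → LQ.cert D f a v k)
      cert-polynomial a k k<D = record
        { φ-cong = λ e → LQ.cert-cong D f (PW.refl ≡.refl) e k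
        ; on-line = λ v w → CertLine.cert-along ℚring D f low a v w k k<D }

    -- If f vanished on the whole grid, it would vanish at all rational points and have zero
    -- coefficients.
    nonzero-point : ∀ e → coeffZ f e ≢ + 0 → ∃[ g ] (g ∈ box d D × EZ.ev f (lift g) ≢ + 0)
    nonzero-point e nz = case (search (λ g → ¬? (EZ.ev f (lift g) ℤ.≟ + 0)) (box d D))
      where
      case : _ → _
      case (inj₁ found) = found
      case (inj₂ none) = contradiction (ι≡0⇒≡0 _ (≡.trans (≡.sym (coeffQ-toQ f e)) (coefficients-vanish (toQ f) (λ x → ≡.trans (evT-toQ f x) (everywhere x)) e))) nz
        where
        on-grid : ∀ g → VAll.All (_≤ D) g → EQ.ev f (Vec.map G.nat g) ≡ ℚ.0ℚ
        on-grid g l = ≡.trans (≡.cong (EQ.ev f) (nat-lift g)) (≡.trans (≡.sym (ev-hom (ι-Hom ℚring) f (lift g)))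
          (≡.cong Q.ι (decidable-stable (EZ.ev f (lift g) ℤ.≟ + 0) (none g (∈-box l)))))
        everywhere : ∀ x → EQ.ev f x ≡ ℚ.0ℚ
        everywhere = G.grid-zero D (EQ.ev f) ev-polynomial on-grid

    module _ (a : Vec ℤ d) (fa≢0 : EZ.ev f a ≢ + 0) where
      private
        fa : ℚ
        fa = EQ.ev f (ιᵛ a)

        fa≡ : Q.ι (EZ.ev f a) ≡ fa
        fa≡ = ev-hom (ι-Hom ℚring) f a

        4fa≢0 : Q.ι (+ 4) ℚ.* fa ≢ ℚ.0ℚ
        4fa≢0 e with ℚ-domain (Q.ι (+ 4)) fa e
        ... | inj₁ z = char0 3 z
        ... | inj₂ z = fa≢0 (ι≡0⇒≡0 _ (≡.trans fa≡ z))

      -- Vanishing spreads from the grid to all rational directions, which gives f = f(a) g² as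
      -- functions on rational points; applying `coefficients-vanish` to the difference makes it an
      -- identity of coefficients.
      vanishing-cert⇒square : (∀ g → g ∈ box d K → ∀ k → h ≤ k → k < D → LZ.cert D f a (lift g) k ≡ + 0) → IsConstTimesSquare f
      vanishing-cert⇒square z = fa , g , λ e → difference e
        where
        everywhere : ∀ v k → h ≤ k → k < D → LQ.cert D f (ιᵛ a) v k ≡ ℚ.0ℚ
        everywhere v k h≤k k<D = G.grid-zero K (λ v → LQ.cert D f (ιᵛ a) v k) (cert-polynomial (ιᵛ a) k k<D)
          (λ g l → ≡.trans (≡.cong (λ w → LQ.cert D f (ιᵛ a) w k) (nat-lift g)) (≡.trans (≡.sym (cert-hom (ι-Hom ℚring) D f a (lift g) k)) (≡.cong Q.ι (z g (∈-box l) k h≤k k<D)))) v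
        inverse = ℚ-inverse (Q.ι (+ 4) ℚ.* fa) 4fa≢0
        module Sq = Square ℚring
        g : PolyQ d
        g = Sq.root-terms D h 2h≤D f low (ιᵛ a) (proj₁ inverse) (proj₂ inverse)
        square : ∀ x → EQ.ev f x ≡ fa ℚ.* (TQ.evT g x ℚ.* TQ.evT g x)
        square = Sq.is-square D h 2h≤D f low (ιᵛ a) (proj₁ inverse) (proj₂ inverse) everywhere
        zeroQ : PolyQ d
        zeroQ = toQ f ++ TQ.scaleT (ℚ.- fa) (TQ.mulT g g)
        cancel : ∀ x y → x ≡ y → x ℚ.+ ℚ.- y ≡ ℚ.0ℚ
        cancel x _ ≡.refl = ℚP.+-inverseʳ x
        zeroQ-ev : ∀ x → TQ.evT zeroQ x ≡ ℚ.0ℚ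
        zeroQ-ev x = ≡.trans (TQ.evT-++ (toQ f) _ x) (≡.trans (≡.cong₂ ℚ._+_ (evT-toQ f x) (≡.trans (TQ.evT-scale (ℚ.- fa) (TQ.mulT g g) x)
          (≡.trans (≡.cong (ℚ._*_ (ℚ.- fa)) (TQ.evT-mul g g x)) (≡.sym (ℚP.neg-distribˡ-* fa _))))) (cancel _ _ (square x)))
        difference : ∀ e → coeffQ (toQ f) e ≡ fa ℚ.* coeffQ (mulQ g g) e
        difference e = Q.x∙y⁻¹≈ε⇒x≈y _ _ (≡.trans (≡.sym (≡.trans (coeffQ≡coeffT zeroQ e) (≡.trans (TQ.coeffT-++ (toQ f) _ e)
          (≡.cong₂ ℚ._+_ (≡.sym (coeffQ≡coeffT (toQ f) e)) (≡.trans (TQ.coeffT-scale (ℚ.- fa) (TQ.mulT g g) e)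
            (≡.trans (≡.sym (ℚP.neg-distribˡ-* fa _)) (≡.cong (λ c → ℚ.- (fa ℚ.* c)) (≡.trans (≡.sym (coeffQ≡coeffT (TQ.mulT g g) e)) (≡.cong (λ p → coeffQ p e) (≡.sym (mulQ≡mulT g g))))))))))) (coefficients-vanish zeroQ zeroQ-ev e))

      -- The candidates are finite in number and decidable, so a failed search would prove that f is
      -- a constant times a square; the negative hypothesis thus produces a witness.
      certificate-point : ¬ IsConstTimesSquare f → ∃[ g ] ∃[ k ] (g ∈ box d K × h ≤ k × k < D × LZ.cert D f a (lift g) k ≢ + 0)
      certificate-point nsq = case (search (λ t → (h ℕP.≤? proj₂ t) ×-dec ¬? (LZ.cert D f a (lift (proj₁ t)) (proj₂ t) ℤ.≟ + 0)) (cartesianProduct (box d K) (upTo D)))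
        where
        case : _ → _
        case (inj₁ ((g , k) , gk∈ , h≤k , nz)) = g , k , proj₁ (∈-cartesianProduct⁻ (box d K) (upTo D) gk∈) , h≤k , ∈-upTo⁻ (proj₂ (∈-cartesianProduct⁻ (box d K) (upTo D) gk∈)) , nz
        case (inj₂ none) = contradiction (vanishing-cert⇒square λ g g∈ k h≤k k<D → decidable-stable (LZ.cert D f a (lift g) k ℤ.≟ + 0)
          λ nz → none (g , k) (∈-cartesianProduct⁺ g∈ (∈-upTo⁺ k<D)) (h≤k , nz)) nsq

-- Height bounds

module Height where
  open Morphism
  open Lines
  open Normal
  open Rational using (ℤring)

  private
    module Z = Kit ℤring
  open Poly ℤring
  open Sqrt ℤring using (sqrt; γ; δ)
  open Line ℤring using (restrict; cert)

  ^-distrib-* : ∀ a b n → (a ℕ.* b) ℕ.^ n ≡ a ℕ.^ n ℕ.* b ℕ.^ n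
  ^-distrib-* a b zero = ≡.refl
  ^-distrib-* a b (suc n) = ≡.trans (≡.cong (a ℕ.* b ℕ.*_) (^-distrib-* a b n)) (eq a b (a ℕ.^ n) (b ℕ.^ n))
    where
    eq : ∀ a b x y → a ℕ.* b ℕ.* (x ℕ.* y) ≡ a ℕ.* x ℕ.* (b ℕ.* y)
    eq = solve-∀

  ∣coeffZ∣≤height : ∀ {d} (f : PolyZ d) e → ∣ coeffZ f e ∣ ≤ height f
  ∣coeffZ∣≤height f e with coeffZ f e ℤ.≟ + 0
  ... | yes z = ≡.subst (λ c → ∣ c ∣ ≤ height f) (≡.sym z) z≤n
  ... | no nz = bound f (occurs f nz)
    where
    occurs : ∀ g → coeffZ g e ≢ + 0 → ∃[ c ] (c , e) ∈ g
    occurs [] nz = contradiction ≡.refl nz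
    occurs ((c , e′) ∷ g) nz with e′ ≟m e
    ... | yes ≡.refl = c , here ≡.refl
    ... | no _ with occurs g nz
    ...   | c′ , p = c′ , there p
    bound : ∀ g → ∃[ c ] (c , e) ∈ g → ∣ coeffZ f e ∣ ≤ foldr (λ { (_ , e) h → ∣ coeffZ f e ∣ ℕ.⊔ h }) 0 g
    bound (t ∷ g) (c , here ≡.refl) = ℕP.m≤m⊔n _ _
    bound (t ∷ g) (c , there p) = ℕP.≤-trans (bound g (c , p)) (ℕP.m≤n⊔m _ _)

  -- The l¹ norm of the first n coefficients. Unlike the height, it is submultiplicative.
  part : ℕ → (ℕ → ℤ) → ℕ
  part zero p = 0
  part (suc n) p = ∣ p 0 ∣ ℕ.+ part n (p ∘ suc)

  part-cong : ∀ n {p q : ℕ → ℤ} → (∀ k → p k ≡ q k) → part n p ≡ part n q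
  part-cong zero e = ≡.refl
  part-cong (suc n) e = ≡.cong₂ ℕ._+_ (≡.cong ∣_∣ (e 0)) (part-cong n (e ∘ suc))

  part-mono : ∀ n p → part n p ≤ part (suc n) p
  part-mono zero p = z≤n
  part-mono (suc n) p = ℕP.+-monoʳ-≤ ∣ p 0 ∣ (part-mono n (p ∘ suc))

  ∣term∣≤part : ∀ n p → ∣ p n ∣ ≤ part (suc n) p
  ∣term∣≤part zero p = ℕP.m≤m+n _ _
  ∣term∣≤part (suc n) p = ℕP.≤-trans (∣term∣≤part n (p ∘ suc)) (ℕP.m≤n+m _ ∣ p 0 ∣)

  part-+ : ∀ n (p q : ℕ → ℤ) → part n (λ k → p k ℤ.+ q k) ≤ part n p ℕ.+ part n q
  part-+ zero p q = z≤n
  part-+ (suc n) p q = ℕP.≤-trans (ℕP.+-mono-≤ (ℤP.∣i+j∣≤∣i∣+∣j∣ (p 0) (q 0)) (part-+ n (p ∘ suc) (q ∘ suc))) (ℕP.≤-reflexive (eq ∣ p 0 ∣ ∣ q 0 ∣ _ _))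
    where
    eq : ∀ a b c d → a ℕ.+ b ℕ.+ (c ℕ.+ d) ≡ a ℕ.+ c ℕ.+ (b ℕ.+ d)
    eq = solve-∀

  part-scale : ∀ n c (p : ℕ → ℤ) → part n (λ k → c ℤ.* p k) ≡ ∣ c ∣ ℕ.* part n p
  part-scale zero c p = ≡.sym (ℕP.*-zeroʳ ∣ c ∣)
  part-scale (suc n) c p = ≡.trans (≡.cong₂ ℕ._+_ (ℤP.abs-* c (p 0)) (part-scale n c (p ∘ suc))) (≡.sym (ℕP.*-distribˡ-+ ∣ c ∣ ∣ p 0 ∣ _))

  part-mul : ∀ n (p q : ℕ → ℤ) → part n (mul p q) ≤ part n p ℕ.* part n q
  part-mul zero p q = z≤n
  part-mul (suc n) p q = begin
    ∣ p 0 ℤ.* q 0 ∣ ℕ.+ part n (λ k → p 0 ℤ.* q (suc k) ℤ.+ mul (tl p) q k)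
      ≤⟨ ℕP.+-mono-≤ (ℕP.≤-reflexive (ℤP.abs-* (p 0) (q 0))) (part-+ n (λ k → p 0 ℤ.* q (suc k)) (mul (tl p) q)) ⟩
    ∣ p 0 ∣ ℕ.* ∣ q 0 ∣ ℕ.+ (part n (λ k → p 0 ℤ.* q (suc k)) ℕ.+ part n (mul (tl p) q))
      ≤⟨ ℕP.+-monoʳ-≤ (∣ p 0 ∣ ℕ.* ∣ q 0 ∣) (ℕP.+-mono-≤ (ℕP.≤-reflexive (part-scale n (p 0) (q ∘ suc))) (ℕP.≤-trans (part-mul n (tl p) q) (ℕP.*-monoʳ-≤ (part n (tl p)) (part-mono n q)))) ⟩
    ∣ p 0 ∣ ℕ.* ∣ q 0 ∣ ℕ.+ (∣ p 0 ∣ ℕ.* part n (q ∘ suc) ℕ.+ part n (tl p) ℕ.* part (suc n) q)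
      ≡⟨ eq ∣ p 0 ∣ ∣ q 0 ∣ (part n (q ∘ suc)) (part n (tl p)) ⟩
    (∣ p 0 ∣ ℕ.+ part n (tl p)) ℕ.* (∣ q 0 ∣ ℕ.+ part n (q ∘ suc)) ∎
    where
    open ℕP.≤-Reasoning
    eq : ∀ a b c d → a ℕ.* b ℕ.+ (a ℕ.* c ℕ.+ d ℕ.* (b ℕ.+ c)) ≡ (a ℕ.+ d) ℕ.* (b ℕ.+ c)
    eq = solve-∀

  record Norm (B : ℕ) (p : List ℤ) : Set where
    constructor mkNorm
    field bounded : ∀ n → part n (coef p) ≤ B
  open Norm

  Norm-mono : ∀ {A B p} → A ≤ B → Norm A p → Norm B p
  Norm-mono l a = mkNorm λ n → ℕP.≤-trans (bounded a n) l

  Norm-≋ : ∀ {B p q} → p ≋ q → Norm B p → Norm B q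
  Norm-≋ e a = mkNorm λ n → ≡.subst (_≤ _) (part-cong n (at e)) (bounded a n)

  Norm-+ : ∀ {A B p q} → Norm A p → Norm B q → Norm (A ℕ.+ B) (p P.+ q)
  Norm-+ {_} {_} {p} {q} a b = mkNorm λ n → ℕP.≤-trans (ℕP.≤-reflexive (part-cong n (coef-add p q))) (ℕP.≤-trans (part-+ n (coef p) (coef q)) (ℕP.+-mono-≤ (bounded a n) (bounded b n)))

  Norm-* : ∀ {A B p q} → Norm A p → Norm B q → Norm (A ℕ.* B) (p P.* q)
  Norm-* {_} {_} {p} {q} a b = mkNorm λ n → ℕP.≤-trans (ℕP.≤-reflexive (part-cong n (coef-mul p q))) (ℕP.≤-trans (part-mul n (coef p) (coef q)) (ℕP.*-mono-≤ (bounded a n) (bounded b n)))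

  private
    part-0 : ∀ n → part n (λ _ → + 0) ≡ 0
    part-0 zero = ≡.refl
    part-0 (suc n) = part-0 n

  Norm-[] : ∀ {B} → Norm B []
  Norm-[] = mkNorm λ n → ℕP.≤-trans (ℕP.≤-reflexive (part-0 n)) z≤n

  Norm-∷ : ∀ {A B c p} → ∣ c ∣ ≤ A → Norm B p → Norm (A ℕ.+ B) (c ∷ p)
  Norm-∷ l a = mkNorm λ { zero → z≤n ; (suc n) → ℕP.+-mono-≤ l (bounded a n) }

  Norm-C : ∀ c → Norm ∣ c ∣ (C c)
  Norm-C c = ≡.subst (λ B → Norm B (C c)) (ℕP.+-identityʳ _) (Norm-∷ {c = c} ℕP.≤-refl (Norm-[] {0}))

  ι≡ : ∀ i → Z.ι i ≡ i
  ι≡ (+ n) = go n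
    where
    go : ∀ n → Z.ι (+ n) ≡ + n
    go zero = ≡.refl
    go (suc n) = ≡.cong (ℤ._+_ (+ 1)) (go n)
  ι≡ -[1+ n ] = ≡.cong (λ z → ℤ.- (+ 1 ℤ.+ z)) (ι≡ (+ n))

  Norm-ι : ∀ i → Norm ∣ i ∣ (P.ι i)
  Norm-ι i = Norm-≋ (P.trans (C-cong (≡.sym (ι≡ i))) (Hom.ι-hom (C-Hom ℤring) i)) (Norm-C i)

  Norm-^ : ∀ {A p} → Norm A p → ∀ n → Norm (A ℕ.^ n) (p P.^ n)
  Norm-^ a zero = Norm-C (+ 1)
  Norm-^ a (suc n) = Norm-* a (Norm-^ a n)

  Norm-monomial : ∀ {d A} {x : Vec (List ℤ) d} → VAll.All (Norm A) x → ∀ e → Norm (A ℕ.^ totalDeg e) (Ev.mono PolyRing x e)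
  Norm-monomial VAll.[] [] = Norm-C (+ 1)
  Norm-monomial {A = A} (a VAll.∷ as) (e ∷ es) = Norm-mono (ℕP.≤-reflexive (≡.sym (ℕP.^-distribˡ-+-* A e _))) (Norm-* (Norm-^ a e) (Norm-monomial as es))

  -- The bound `suc A` is at least 1, so its powers increase with the exponent and D can replace
  -- every total degree.
  Norm-ev : ∀ {d D} A H (f : PolyZ d) {x : Vec (List ℤ) d} → All (λ t → totalDeg (proj₂ t) ≤ D) f → All (λ t → ∣ proj₁ t ∣ ≤ H) f → VAll.All (Norm (suc A)) x →
    Norm (length f ℕ.* (H ℕ.* suc A ℕ.^ D)) (Ev.ev PolyRing f x)
  Norm-ev A H [] _ _ as = Norm-[]
  Norm-ev A H ((c , e) ∷ f) (l ∷ ls) (b ∷ bs) as = Norm-+ (Norm-mono (ℕP.*-mono-≤ b (ℕP.^-monoʳ-≤ (suc A) l)) (Norm-* (Norm-ι c) (Norm-monomial as e))) (Norm-ev A H f ls bs as)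

  Norm-restrict : ∀ {d D} A H (f : PolyZ d) → All (λ t → totalDeg (proj₂ t) ≤ D) f → All (λ t → ∣ proj₁ t ∣ ≤ H) f →
    ∀ (a v : Vec ℤ d) → VAll.All (λ z → ∣ z ∣ ≤ A) a → VAll.All (λ z → ∣ z ∣ ≤ A) v → Norm (length f ℕ.* (H ℕ.* suc (A ℕ.+ A) ℕ.^ D)) (restrict f a v)
  Norm-restrict A H f low bd a v la lv = Norm-ev (A ℕ.+ A) H f low bd (linear a v la lv)
    where
    linear : ∀ {n} (a v : Vec ℤ n) → VAll.All (λ z → ∣ z ∣ ≤ A) a → VAll.All (λ z → ∣ z ∣ ≤ A) v → VAll.All (Norm (suc (A ℕ.+ A))) (Vec.zipWith lin a v)
    linear [] [] _ _ = VAll.[]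
    linear (a ∷ as) (v ∷ vs) (la VAll.∷ las) (lv VAll.∷ lvs) = Norm-mono (ℕP.≤-trans (ℕP.≤-reflexive (≡.cong (A ℕ.+_) (ℕP.+-identityʳ A))) (ℕP.n≤1+n _))
      (Norm-∷ la (Norm-∷ lv (Norm-[] {0}))) VAll.∷ linear as vs las lvs

  -- If the coefficients of u are at most 1 + T, those of the i-th iterate are at most factor times
  -- (1 + T)^exponent. Neither depends on T, so the certificate is polynomially bounded in the
  -- height.
  sqrt-factor sqrt-exponent : ℕ → ℕ → ℕ
  sqrt-factor D zero = 0
  sqrt-factor D (suc i) = 4 ℕ.^ D ℕ.+ D ℕ.* (sqrt-factor D i ℕ.* sqrt-factor D i)
  sqrt-exponent D zero = 0
  sqrt-exponent D (suc i) = suc D ℕ.+ (sqrt-exponent D i ℕ.+ sqrt-exponent D i)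

  ∣^∣ : ∀ x n → ∣ x Z.^ n ∣ ≡ ∣ x ∣ ℕ.^ n
  ∣^∣ x zero = ≡.refl
  ∣^∣ x (suc n) = ≡.trans (ℤP.abs-* x (x Z.^ n)) (≡.cong (∣ x ∣ ℕ.*_) (∣^∣ x n))

  ∣mul∣≤ : ∀ B (p q : ℕ → ℤ) n → (∀ k → k ≤ n → ∣ p k ∣ ≤ B) → (∀ k → k ≤ n → ∣ q k ∣ ≤ B) → ∣ mul p q n ∣ ≤ suc n ℕ.* (B ℕ.* B)
  ∣mul∣≤ B p q zero bp bq = ℕP.≤-trans (ℕP.≤-reflexive (ℤP.abs-* (p 0) (q 0))) (ℕP.≤-trans (ℕP.*-mono-≤ (bp 0 z≤n) (bq 0 z≤n)) (ℕP.m≤m+n _ _))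
  ∣mul∣≤ B p q (suc n) bp bq = ℕP.≤-trans (ℤP.∣i+j∣≤∣i∣+∣j∣ (p 0 ℤ.* q (suc n)) _) (ℕP.+-mono-≤
    (ℕP.≤-trans (ℕP.≤-reflexive (ℤP.abs-* (p 0) (q (suc n)))) (ℕP.*-mono-≤ (bp 0 z≤n) (bq (suc n) ℕP.≤-refl)))
    (∣mul∣≤ B (tl p) q n (λ k l → bp (suc k) (s≤s l)) (λ k l → bq k (ℕP.m≤n⇒m≤1+n l))))

  module _ (D T : ℕ) (u : ℕ → ℤ) (∣u∣≤ : ∀ n → ∣ u n ∣ ≤ suc T) where
    open ℕP.≤-Reasoning
    ∣γ∣≤ : ∀ n → n < D → ∣ γ u n ∣ ≤ 4 ℕ.^ D ℕ.* suc T ℕ.^ suc D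
    ∣γ∣≤ n n<D = begin
      ∣ δ u Z.^ n ℤ.* u (suc n) ∣                          ≡⟨ ≡.trans (ℤP.abs-* (δ u Z.^ n) (u (suc n))) (≡.cong (ℕ._* ∣ u (suc n) ∣) (≡.trans (∣^∣ (δ u) n) (≡.cong (ℕ._^ n) (ℤP.abs-* (Z.ι (+ 4)) (u 0))))) ⟩
      (4 ℕ.* ∣ u 0 ∣) ℕ.^ n ℕ.* ∣ u (suc n) ∣              ≤⟨ ℕP.*-mono-≤ (ℕP.^-monoˡ-≤ n (ℕP.*-monoʳ-≤ 4 (∣u∣≤ 0))) (∣u∣≤ (suc n)) ⟩
      (4 ℕ.* suc T) ℕ.^ n ℕ.* suc T                        ≤⟨ ℕP.*-monoˡ-≤ (suc T) (ℕP.^-monoʳ-≤ (4 ℕ.* suc T) (ℕP.<⇒≤ n<D)) ⟩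
      (4 ℕ.* suc T) ℕ.^ D ℕ.* suc T                        ≡⟨ ≡.cong (ℕ._* suc T) (^-distrib-* 4 (suc T) D) ⟩
      4 ℕ.^ D ℕ.* suc T ℕ.^ D ℕ.* suc T                    ≡⟨ ≡.trans (ℕP.*-assoc (4 ℕ.^ D) _ _) (≡.cong (4 ℕ.^ D ℕ.*_) (ℕP.*-comm _ (suc T))) ⟩
      4 ℕ.^ D ℕ.* suc T ℕ.^ suc D                          ∎

    ∣sqrt∣≤ : ∀ i k → k < D → ∣ sqrt u i k ∣ ≤ sqrt-factor D i ℕ.* suc T ℕ.^ sqrt-exponent D i
    ∣sqrt∣≤ zero k k<D = z≤n
    ∣sqrt∣≤ (suc i) zero k<D = ℕP.≤-trans (∣γ∣≤ 0 k<D) (ℕP.*-mono-≤ (ℕP.m≤m+n (4 ℕ.^ D) (D ℕ.* (sqrt-factor D i ℕ.* sqrt-factor D i))) (ℕP.^-monoʳ-≤ (suc T) (ℕP.m≤m+n (suc D) (sqrt-exponent D i ℕ.+ sqrt-exponent D i))))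
    ∣sqrt∣≤ (suc i) (suc k) k<D = begin
      ∣ γ u (suc k) ℤ.- mul b b k ∣                        ≤⟨ ℤP.∣i-j∣≤∣i∣+∣j∣ (γ u (suc k)) (mul b b k) ⟩
      ∣ γ u (suc k) ∣ ℕ.+ ∣ mul b b k ∣                    ≤⟨ ℕP.+-mono-≤ (∣γ∣≤ (suc k) k<D) (ℕP.≤-trans (∣mul∣≤ (F ℕ.* U) b b k below below) (ℕP.*-monoˡ-≤ (F ℕ.* U ℕ.* (F ℕ.* U)) (ℕP.<⇒≤ k<D))) ⟩
      4 ℕ.^ D ℕ.* suc T ℕ.^ suc D ℕ.+ D ℕ.* (F ℕ.* U ℕ.* (F ℕ.* U))    ≡⟨ ≡.cong (4 ℕ.^ D ℕ.* suc T ℕ.^ suc D ℕ.+_) (≡.trans (eq D F U) (≡.cong (D ℕ.* (F ℕ.* F) ℕ.*_) (≡.sym (ℕP.^-distribˡ-+-* (suc T) E E)))) ⟩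
      4 ℕ.^ D ℕ.* suc T ℕ.^ suc D ℕ.+ D ℕ.* (F ℕ.* F) ℕ.* suc T ℕ.^ (E ℕ.+ E)   ≤⟨ ℕP.+-mono-≤ (ℕP.*-monoʳ-≤ (4 ℕ.^ D) (ℕP.^-monoʳ-≤ (suc T) (ℕP.m≤m+n (suc D) (E ℕ.+ E)))) (ℕP.*-monoʳ-≤ (D ℕ.* (F ℕ.* F)) (ℕP.^-monoʳ-≤ (suc T) (ℕP.m≤n+m (E ℕ.+ E) (suc D)))) ⟩
      4 ℕ.^ D ℕ.* V ℕ.+ D ℕ.* (F ℕ.* F) ℕ.* V              ≡⟨ ℕP.*-distribʳ-+ V (4 ℕ.^ D) _ ⟨
      sqrt-factor D (suc i) ℕ.* V                          ∎
      where
      b = sqrt u i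
      F = sqrt-factor D i
      E = sqrt-exponent D i
      U = suc T ℕ.^ E
      V = suc T ℕ.^ sqrt-exponent D (suc i)
      below : ∀ j → j ≤ k → ∣ b j ∣ ≤ F ℕ.* U
      below j j≤k = ∣sqrt∣≤ i j (ℕP.<-trans (s≤s j≤k) k<D)
      eq : ∀ D F U → D ℕ.* (F ℕ.* U ℕ.* (F ℕ.* U)) ≡ D ℕ.* (F ℕ.* F) ℕ.* (U ℕ.* U)
      eq = solve-∀

-- The constants and the theorem

open Morphism
open Lines
open Normal
open OneVar
open CharSum
open Bound
open Rational
open Height

prime-odd : ∀ {p} → Prime p → 2 < p → ∃[ e ] p ≡ suc (e ℕ.+ e)
prime-odd {p} pr 2<p with half p
... | e , inj₂ odd = e , odd
... | e , inj₁ even with prime⇒irreducible pr {2} (ℕD.divides e (≡.trans even (≡.trans (≡.cong (e ℕ.+_) (≡.sym (ℕP.+-identityʳ e))) (ℕP.*-comm 2 e))))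
...   | inj₁ ()
...   | inj₂ 2≡p = contradiction 2≡p (ℕP.<⇒≢ 2<p)

evalZ≡ev : ∀ {d} (f : PolyZ d) x → evalZ f x ≡ Ev.ev ℤring f x
evalZ≡ev [] x = ≡.refl
evalZ≡ev ((c , e) ∷ f) x = ≡.cong₂ ℤ._+_ (≡.cong₂ ℤ._*_ (≡.sym (ι≡ c)) (monomial x e)) (evalZ≡ev f x)
  where
  power : ∀ x n → x ℤ.^ n ≡ Kit._^_ ℤring x n
  power x zero = ≡.refl
  power x (suc n) = ≡.cong (x ℤ.*_) (power x n)
  monomial : ∀ {d} (x : Vec ℤ d) e → Vec.foldr _ ℤ._*_ (+ 1) (Vec.zipWith ℤ._^_ x e) ≡ Ev.mono ℤring x e
  monomial [] [] = ≡.refl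
  monomial (x ∷ xs) (e ∷ es) = ≡.cong₂ ℤ._*_ (power x e) (monomial xs es)

-- Without variables f is a constant times 1², so the case d = 0 is void.
constant-is-square : (f : PolyZ 0) → IsConstTimesSquare f
constant-is-square f = coeffQ (toQ f) [] , (ℚ.1ℚ , []) ∷ [] , λ { [] → ≡.sym (ℚP.*-identityʳ _) }

∣legendre∣≤1 : ∀ ℓ x → ∣ legendre ℓ x ∣ ≤ 1
∣legendre∣≤1 zero x = z≤n
∣legendre∣≤1 (suc k) x with x %ℕ suc k
... | zero = z≤n
... | suc r with any? (λ y → (y ℕ.* y) ℕ.% suc k ℕP.≟ suc r) (upTo (suc k))
...   | yes _ = s≤s z≤n
...   | no _ = s≤s z≤n

trivial-bound : ∀ {d} ℓ (f : PolyZ d) → ∣ charSum ℓ f ∣ ≤ ℓ ℕ.^ d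
trivial-bound {d} ℓ f = ℕP.≤-trans (abs-sumL (points ℓ d) (λ x → legendre ℓ (evalZ f x))) (ℕP.≤-trans (sumℕ-mono (points ℓ d) (λ x → ∣legendre∣≤1 ℓ (evalZ f x)))
  (ℕP.≤-reflexive (≡.trans (sumℕ-const (points ℓ d) 1) (≡.trans (ℕP.*-identityʳ _) (length-points ℓ d)))))

module Constants (d m : ℕ) where
  -- `A` bounds the coordinates of a and v, taken from boxes of sides D and K. Then `c` times the
  -- height bounds the l¹ norm of f(a + t v), and κ H^E bounds B₀. `W` is the one-variable constant
  -- for lists of length D + 1.
  D h K A c κ E W B₁ : ℕ
  D = d ℕ.* m
  h = proj₁ (half D)
  K = CertLine.cert-degree ℚring D
  A = D ℕ.+ K
  c = length (box d m) ℕ.* suc (A ℕ.+ A) ℕ.^ D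
  E = suc (sqrt-exponent D D)
  κ = sqrt-factor D D ℕ.* suc c ℕ.^ E
  W = 6 ℕ.* suc D ℕ.+ 6
  B₁ = 4 ℕ.* (1 ℕ.+ W ℕ.+ K)

  2h≤D : h ℕ.+ h ≤ D
  2h≤D with half D
  ... | x , inj₁ e = ℕP.≤-reflexive (≡.sym e)
  ... | x , inj₂ e = ℕP.≤-trans (ℕP.n≤1+n _) (ℕP.≤-reflexive (≡.sym e))

  D≤2h+1 : D ≤ suc (h ℕ.+ h)
  D≤2h+1 with half D
  ... | x , inj₁ e = ℕP.≤-trans (ℕP.≤-reflexive e) (ℕP.n≤1+n _)
  ... | x , inj₂ e = ℕP.≤-reflexive e

  -- Primes up to the threshold are left to the trivial bound; it collects the size conditions of
  -- the one-variable estimate and κ. In `C₁` the summand κ absorbs the factor κ, since κ ≤ 2^κ ≤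
  -- H^κ for H ≥ 2. The term 4 B₁ in `C₂` is the constant of `square-bound`.
  threshold C₁ C₂ : ℕ
  threshold = 48 ℕ.+ 4 ℕ.* suc (suc D) ℕ.+ κ
  C₁ = κ ℕ.+ E
  C₂ = threshold ℕ.+ 4 ℕ.* B₁

  48≤threshold : 48 ≤ threshold
  48≤threshold = ℕP.≤-trans (ℕP.m≤m+n 48 (4 ℕ.* suc (suc D))) (ℕP.m≤m+n (48 ℕ.+ 4 ℕ.* suc (suc D)) κ)

  4D≤threshold : 4 ℕ.* suc (suc D) ≤ threshold
  4D≤threshold = ℕP.≤-trans (ℕP.m≤n+m (4 ℕ.* suc (suc D)) 48) (ℕP.m≤m+n (48 ℕ.+ 4 ℕ.* suc (suc D)) κ)

  κ≤threshold : κ ≤ threshold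
  κ≤threshold = ℕP.m≤n+m κ (48 ℕ.+ 4 ℕ.* suc (suc D))

  module _ (f : PolyZ d) (deg : HasDegree f m) (nsq : ¬ IsConstTimesSquare f) where
    f′ : PolyZ d
    f′ = normal m f

    coeff′ : ∀ e → coeffZ f′ e ≡ coeffZ f e
    coeff′ = coeffZ-normal m f (proj₂ deg)

    low : All (λ t → totalDeg (proj₂ t) ≤ D) f′
    low = normal-low m f

    nsq′ : ¬ IsConstTimesSquare f′
    nsq′ (q , g , e) = nsq (q , g , λ x → ≡.trans (≡.trans (coeffQ-toQ f x) (≡.trans (≡.cong (Kit.ι ℚring) (≡.sym (coeff′ x))) (≡.sym (coeffQ-toQ f′ x)))) (e x))

    private
      leading : Mono d
      leading = proj₁ (proj₁ deg)

      leading≢0 : coeffZ f leading ≢ + 0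
      leading≢0 = proj₁ (proj₂ (proj₁ deg))

      point = nonzero-point D h 2h≤D f′ low leading (λ z → leading≢0 (≡.trans (≡.sym (coeff′ leading)) z))
      ga = proj₁ point

    a : Vec ℤ d
    a = Vec.map +_ ga

    fa≢0 : Ev.ev ℤring f′ a ≢ + 0
    fa≢0 = proj₂ (proj₂ point)

    private
      direction = certificate-point D h 2h≤D f′ low a fa≢0 nsq′
      gv = proj₁ direction

    v : Vec ℤ d
    v = Vec.map +_ gv

    n : ℕ
    n = proj₁ (proj₂ direction)

    h≤n : h ≤ n
    h≤n = proj₁ (proj₂ (proj₂ (proj₂ direction)))

    n<D : n < D
    n<D = proj₁ (proj₂ (proj₂ (proj₂ (proj₂ direction))))

    cert≢0 : Line.cert ℤring D f′ a v n ≢ + 0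
    cert≢0 = proj₂ (proj₂ (proj₂ (proj₂ (proj₂ direction))))

    B₀ : ℤ
    B₀ = Ev.ev ℤring f′ a ℤ.* Line.cert ℤring D f′ a v n

    B₀≢0 : B₀ ≢ + 0
    B₀≢0 e with ℤP.i*j≡0⇒i≡0∨j≡0 (Ev.ev ℤring f′ a) e
    ... | inj₁ z = fa≢0 z
    ... | inj₂ z = cert≢0 z

    H : ℕ
    H = height f

    1≤H : 1 ≤ H
    1≤H = ℕP.≤-trans (ℕP.n≢0⇒n>0 (λ z → leading≢0 (ℤP.∣i∣≡0⇒i≡0 z))) (∣coeffZ∣≤height f leading)

    private
      T : ℕ
      T = c ℕ.* H

      bounded-lift : ∀ {g : Vec ℕ d} {M} → M ≤ A → VAll.All (_≤ M) g → VAll.All (λ z → ∣ z ∣ ≤ A) (Vec.map +_ g)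
      bounded-lift M≤A l = VAllP.map⁺ (VAll.map (λ x≤M → ℕP.≤-trans x≤M M≤A) l)

      norm : Norm T (Line.restrict ℤring f′ a v)
      norm = Norm-mono (ℕP.≤-reflexive eq) (Norm-restrict A H f′ low (AllP.map⁺ (All.tabulate (λ {e} _ → ∣coeffZ∣≤height f e))) a v
          (bounded-lift (ℕP.m≤m+n D K) (∈-box⁻ (proj₁ (proj₂ point)))) (bounded-lift (ℕP.m≤n+m K D) (∈-box⁻ (proj₁ (proj₂ (proj₂ direction))))))
        where
        eq : length f′ ℕ.* (H ℕ.* suc (A ℕ.+ A) ℕ.^ D) ≡ T
        eq = ≡.trans (≡.cong (ℕ._* (H ℕ.* suc (A ℕ.+ A) ℕ.^ D)) (ListP.length-map (λ e → coeffZ f e , e) (box d m))) (eq′ (length (box d m)) H (suc (A ℕ.+ A) ℕ.^ D))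
          where
          eq′ : ∀ l H x → l ℕ.* (H ℕ.* x) ≡ l ℕ.* x ℕ.* H
          eq′ = solve-∀

      ∣u∣≤ : ∀ k → ∣ Poly.coef ℤring (Line.restrict ℤring f′ a v) k ∣ ≤ suc T
      ∣u∣≤ k = ℕP.≤-trans (∣term∣≤part k (Poly.coef ℤring (Line.restrict ℤring f′ a v))) (ℕP.≤-trans (Norm.bounded norm (suc k)) (ℕP.n≤1+n T))

      fa≡ : Ev.ev ℤring f′ a ≡ Poly.coef ℤring (Line.restrict ℤring f′ a v) 0
      fa≡ = ≡.sym (≡.trans (Line.coef0≈eval0 ℤring (Line.restrict ℤring f′ a v)) (≡.trans (Line.eval-restrict ℤring f′ (+ 0) a v) (Ev.ev-cong ℤring f′ (Line.along-0 ℤring a v))))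

    ∣B₀∣≤ : ∣ B₀ ∣ ≤ κ ℕ.* H ℕ.^ E
    ∣B₀∣≤ = begin
      ∣ B₀ ∣                                                           ≡⟨ ℤP.abs-* (Ev.ev ℤring f′ a) (Line.cert ℤring D f′ a v n) ⟩
      ∣ Ev.ev ℤring f′ a ∣ ℕ.* ∣ Line.cert ℤring D f′ a v n ∣          ≤⟨ ℕP.*-mono-≤ (ℕP.≤-trans (ℕP.≤-reflexive (≡.cong ∣_∣ fa≡)) (∣u∣≤ 0)) (∣sqrt∣≤ D T _ ∣u∣≤ D n n<D) ⟩
      suc T ℕ.* (sqrt-factor D D ℕ.* suc T ℕ.^ sqrt-exponent D D)      ≡⟨ eq₁ (suc T) (sqrt-factor D D) (suc T ℕ.^ sqrt-exponent D D) ⟩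
      -- Since H ≥ 1, 1 + c H is at most (1 + c) H, which separates the constant from the height.
      sqrt-factor D D ℕ.* suc T ℕ.^ E                                  ≤⟨ ℕP.*-monoʳ-≤ (sqrt-factor D D) (ℕP.^-monoˡ-≤ E (ℕP.+-mono-≤ 1≤H (ℕP.≤-refl {T}))) ⟩
      sqrt-factor D D ℕ.* (suc c ℕ.* H) ℕ.^ E                          ≡⟨ ≡.cong (sqrt-factor D D ℕ.*_) (^-distrib-* (suc c) H E) ⟩
      sqrt-factor D D ℕ.* (suc c ℕ.^ E ℕ.* H ℕ.^ E)                    ≡⟨ ℕP.*-assoc (sqrt-factor D D) _ _ ⟨
      κ ℕ.* H ℕ.^ E                                                    ∎
      where
      open ℕP.≤-Reasoning
      eq₁ : ∀ t s x → t ℕ.* (s ℕ.* x) ≡ s ℕ.* (t ℕ.* x)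
      eq₁ = solve-∀

    -- Both factors of B₀ are computed over ℤ. They commute with reduction modulo ℓ, so as ℓ divides
    -- neither, the value at a and the certificate stay nonzero over ℤ/ℓ.
    large-prime : ∀ k (pr : Prime (suc k)) → threshold < suc k → ¬ suc k ℕD.∣ ∣ B₀ ∣ → ∀ N → 4 ℕ.* (N ℕ.* N) ≤ suc k →
      N ℕ.* ∣ charSum (suc k) f ∣ ≤ B₁ ℕ.* suc k ℕ.^ d
    large-prime k pr large ∤B₀ N 4N²≤ = ≡.subst (λ z → N ℕ.* ∣ z ∣ ≤ B₁ ℕ.* ℓ ℕ.^ d) (≡.sym same)
      (LineSums.main-bound k pr e (ℕP.suc-injective k≡) D h D≤2h+1 f′ low a v n h≤n n<D fa≉0 cert≉0
        (ℕP.≤-trans 48≤threshold (ℕP.<⇒≤ large))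
        (ℕP.≤-trans 4D≤threshold (ℕP.<⇒≤ large)) N 4N²≤ N≤ℓ)
      where
      open Zmod k pr
      2<ℓ : 2 < ℓ
      2<ℓ = ℕP.≤-<-trans (ℕP.≤-trans (s≤s (s≤s (z≤n {46}))) 48≤threshold) large
      e = proj₁ (prime-odd pr 2<ℓ)
      k≡ = proj₂ (prime-odd pr 2<ℓ)
      N≤ℓ : N ≤ ℓ
      N≤ℓ = ℕP.≤-trans (N≤4N² N) 4N²≤
        where
        N≤4N² : ∀ N → N ≤ 4 ℕ.* (N ℕ.* N)
        N≤4N² zero = z≤n
        N≤4N² (suc N) = ℕP.≤-trans (ℕP.m≤m*n (suc N) (suc N)) (ℕP.m≤n*m (suc N ℕ.* suc N) 4)
      id-mod : Hom ℤring ℤmod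
      id-mod = record { ⟦_⟧ = λ x → x ; cong = ≡⇒≈ ; +-hom = λ _ _ → ≡⇒≈ ≡.refl ; *-hom = λ _ _ → ≡⇒≈ ≡.refl ; 1-hom = ≡⇒≈ ≡.refl }
      module M = Kit ℤmod
      ev-mod : ∀ (g : PolyZ d) x → Ev.ev ℤring g x ≈ℓ Ev.ev ℤmod g x
      ev-mod g x = M.trans (ev-hom id-mod g x) (M.reflexive (≡.cong (Ev.ev ℤmod g) (VecP.map-id x)))
      cert-mod : Line.cert ℤring D f′ a v n ≈ℓ Line.cert ℤmod D f′ a v n
      cert-mod = M.trans (cert-hom id-mod D f′ a v n) (M.reflexive (≡.cong₂ (λ x y → Line.cert ℤmod D f′ x y n) (VecP.map-id a) (VecP.map-id v)))
      fa≉0 : ¬ Ev.ev ℤmod f′ a ≈ℓ + 0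
      fa≉0 z = ∤B₀ (≡.subst (suc k ℕD.∣_) (≡.sym (ℤP.abs-* (Ev.ev ℤring f′ a) _)) (ℕD.∣m⇒∣m*n ∣ Line.cert ℤring D f′ a v n ∣ (≈0⇒∣ (M.trans (ev-mod f′ a) z))))
      cert≉0 : ¬ Line.cert ℤmod D f′ a v n ≈ℓ + 0
      cert≉0 z = ∤B₀ (≡.subst (suc k ℕD.∣_) (≡.sym (ℤP.abs-* (Ev.ev ℤring f′ a) _)) (ℕD.∣n⇒∣m*n ∣ Ev.ev ℤring f′ a ∣ (≈0⇒∣ (M.trans cert-mod z))))
      same : charSum ℓ f ≡ sumL (points ℓ d) (λ x → legendre ℓ (Ev.ev ℤmod f′ x))
      same = sumL-cong (points ℓ d) λ x → legendre-cong (M.trans (M.reflexive (evalZ≡ev f x)) (M.trans (ev-mod f x) (ev-ext ℤmod f f′ (λ e → ≡.sym (coeff′ e)) x)))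

-- For N ≥ 1, ℓ < 4(N + 1)² ≤ 16N², so ℓ s² ≤ 16 (N s)² and one factor ℓ cancels. The assumption 4 ≤
-- ℓ excludes N = 0.
square-bound : ∀ ℓ N s B d → ℓ < 4 ℕ.* (suc N ℕ.* suc N) → 4 ≤ ℓ → N ℕ.* s ≤ B ℕ.* ℓ ℕ.^ suc d →
  s ℕ.* s ≤ (4 ℕ.* B) ℕ.* (4 ℕ.* B) ℕ.* ℓ ℕ.^ (2 ℕ.* suc d ℕ.∸ 1)
square-bound ℓ zero s B d hi 4≤ℓ _ = contradiction hi (ℕP.≤⇒≯ 4≤ℓ)
square-bound ℓ@(suc _) (suc N) s B d hi 4≤ℓ b = ℕP.*-cancelˡ-≤ ℓ (begin
  ℓ ℕ.* (s ℕ.* s)                                                  ≤⟨ ℕP.*-monoˡ-≤ (s ℕ.* s) (ℕP.≤-trans (ℕP.<⇒≤ hi) (ℕP.*-monoʳ-≤ 4 (ℕP.*-mono-≤ N+2≤ N+2≤))) ⟩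
  4 ℕ.* (2 ℕ.* suc N ℕ.* (2 ℕ.* suc N)) ℕ.* (s ℕ.* s)              ≡⟨ eq₁ (suc N) s ⟩
  16 ℕ.* (suc N ℕ.* s ℕ.* (suc N ℕ.* s))                           ≤⟨ ℕP.*-monoʳ-≤ 16 (ℕP.*-mono-≤ b b) ⟩
  16 ℕ.* (B ℕ.* ℓ ℕ.^ suc d ℕ.* (B ℕ.* ℓ ℕ.^ suc d))               ≡⟨ eq₂ B (ℓ ℕ.^ d) ℓ ⟩
  ℓ ℕ.* ((4 ℕ.* B) ℕ.* (4 ℕ.* B) ℕ.* (ℓ ℕ.^ d ℕ.* (ℓ ℕ.* ℓ ℕ.^ d)))    ≡⟨ ≡.cong (λ z → ℓ ℕ.* ((4 ℕ.* B) ℕ.* (4 ℕ.* B) ℕ.* z)) power ⟩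
  ℓ ℕ.* ((4 ℕ.* B) ℕ.* (4 ℕ.* B) ℕ.* ℓ ℕ.^ (2 ℕ.* suc d ℕ.∸ 1))    ∎)
  where
  open ℕP.≤-Reasoning
  N+2≤ : suc (suc N) ≤ 2 ℕ.* suc N
  N+2≤ = ℕP.≤-trans (s≤s (s≤s (ℕP.m≤m+n N (N ℕ.+ 0)))) (ℕP.≤-reflexive (≡.cong suc (≡.sym (ℕP.+-suc N (N ℕ.+ 0)))))
  eq₁ : ∀ N s → 4 ℕ.* (2 ℕ.* N ℕ.* (2 ℕ.* N)) ℕ.* (s ℕ.* s) ≡ 16 ℕ.* (N ℕ.* s ℕ.* (N ℕ.* s))
  eq₁ = solve-∀
  eq₂ : ∀ B x l → 16 ℕ.* (B ℕ.* (l ℕ.* x) ℕ.* (B ℕ.* (l ℕ.* x))) ≡ l ℕ.* ((4 ℕ.* B) ℕ.* (4 ℕ.* B) ℕ.* (x ℕ.* (l ℕ.* x)))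
  eq₂ = solve-∀
  power : ℓ ℕ.^ d ℕ.* (ℓ ℕ.* ℓ ℕ.^ d) ≡ ℓ ℕ.^ (2 ℕ.* suc d ℕ.∸ 1)
  power = ≡.trans (≡.sym (ℕP.^-distribˡ-+-* ℓ d (suc d))) (≡.cong (λ n → ℓ ℕ.^ (d ℕ.+ n)) (≡.sym (ℕP.+-identityʳ (suc d))))

-- The trivial bound exceeds the desired power by one factor ℓ, which is at most t ≤ t².
small-bound : ∀ ℓ s t d → s ≤ ℓ ℕ.^ suc d → ℓ ≤ t → 1 ≤ t → s ℕ.* s ≤ t ℕ.* t ℕ.* ℓ ℕ.^ (2 ℕ.* suc d ℕ.∸ 1)
small-bound ℓ s t d b ℓ≤t 1≤t = begin
  s ℕ.* s                                        ≤⟨ ℕP.*-mono-≤ b b ⟩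
  ℓ ℕ.* ℓ ℕ.^ d ℕ.* ℓ ℕ.^ suc d                  ≡⟨ ℕP.*-assoc ℓ _ _ ⟩
  ℓ ℕ.* (ℓ ℕ.^ d ℕ.* ℓ ℕ.^ suc d)                ≤⟨ ℕP.*-monoˡ-≤ _ (ℕP.≤-trans ℓ≤t (ℕP.m≤m*n t t {{ℕ.>-nonZero 1≤t}})) ⟩
  t ℕ.* t ℕ.* (ℓ ℕ.^ d ℕ.* ℓ ℕ.^ suc d)          ≡⟨ ≡.cong (t ℕ.* t ℕ.*_) (≡.trans (≡.sym (ℕP.^-distribˡ-+-* ℓ d (suc d))) (≡.cong (λ n → ℓ ℕ.^ (d ℕ.+ n)) (≡.sym (ℕP.+-identityʳ (suc d))))) ⟩
  t ℕ.* t ℕ.* ℓ ℕ.^ (2 ℕ.* suc d ℕ.∸ 1)          ∎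
  where open ℕP.≤-Reasoning

n≤2^n : ∀ n → n ≤ 2 ℕ.^ n
n≤2^n zero = z≤n
n≤2^n (suc n) = ℕP.≤-trans (ℕP.+-mono-≤ (ℕP.m^n>0 2 n) (n≤2^n n)) (ℕP.≤-reflexive (≡.cong (2 ℕ.^ n ℕ.+_) (≡.sym (ℕP.+-identityʳ _))))

module Positive-dimension (d m : ℕ) where
  open Constants (suc d) m

  1≤threshold : 1 ≤ threshold
  1≤threshold = s≤s z≤n

  module _ (f : PolyZ (suc d)) (deg : HasDegree f m) (nsq : ¬ IsConstTimesSquare f) where

    -- Divisibility is excluded only above the threshold, so that the choices B = B₀ and B = 1 can
    -- share the estimate.
    ∣S∣²≤ : ∀ ℓ → Prime ℓ → (threshold < ℓ → ¬ ℓ ℕD.∣ ∣ B₀ f deg nsq ∣) → ∣ charSum ℓ f ∣ ℕ.* ∣ charSum ℓ f ∣ ≤ (C₂ ℕ.* C₂) ℕ.* ℓ ℕ.^ (2 ℕ.* suc d ℕ.∸ 1)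
    ∣S∣²≤ zero pr _ = contradiction (ℕ.nonTrivial⇒n>1 0 {{prime⇒nonTrivial pr}}) λ ()
    ∣S∣²≤ ℓ@(suc k) pr ∤B₀ = case (threshold ℕP.<? ℓ)
      where
      s = ∣ charSum ℓ f ∣
      power = ℓ ℕ.^ (2 ℕ.* suc d ℕ.∸ 1)
      sqrt = half-sqrt ℓ
      case : Dec (threshold < ℓ) → s ℕ.* s ≤ (C₂ ℕ.* C₂) ℕ.* power
      case (no small) = ℕP.≤-trans (small-bound ℓ s threshold d (trivial-bound ℓ f) (ℕP.≮⇒≥ small) 1≤threshold)
        (ℕP.*-monoˡ-≤ power (ℕP.*-mono-≤ (ℕP.m≤m+n threshold _) (ℕP.m≤m+n threshold _)))
      case (yes large) = ℕP.≤-trans (square-bound ℓ (proj₁ sqrt) s B₁ d (proj₂ (proj₂ sqrt)) 4≤ℓ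
          (large-prime f deg nsq k pr large (∤B₀ large) (proj₁ sqrt) (proj₁ (proj₂ sqrt))))
        (ℕP.*-monoˡ-≤ power (ℕP.*-mono-≤ (ℕP.m≤n+m (4 ℕ.* B₁) threshold) (ℕP.m≤n+m (4 ℕ.* B₁) threshold)))
        where
        4≤ℓ : 4 ≤ ℓ
        4≤ℓ = ℕP.≤-trans (ℕP.≤-trans (s≤s (s≤s (s≤s (s≤s (z≤n {44}))))) 48≤threshold) (ℕP.<⇒≤ large)

    -- For height 1 the exceptional primes are bounded in terms of d and m alone, and are absorbed in C₂.
    witness : ∃[ B ] (1 ≤ ∣ B ∣ × ∣ B ∣ ≤ height f ℕ.^ C₁ × ((ℓ : ℕ) → Prime ℓ → ¬ (ℓ ℕD.∣ ∣ B ∣) →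
      ∣ charSum ℓ f ∣ ℕ.* ∣ charSum ℓ f ∣ ≤ (C₂ ℕ.* C₂) ℕ.* ℓ ℕ.^ (2 ℕ.* suc d ℕ.∸ 1)))
    witness = case (2 ℕP.≤? height f)
      where
      b₀ = B₀ f deg nsq
      1≤∣b₀∣ : 1 ≤ ∣ b₀ ∣
      1≤∣b₀∣ = ℕP.n≢0⇒n>0 (λ z → B₀≢0 f deg nsq (ℤP.∣i∣≡0⇒i≡0 z))
      case : Dec (2 ≤ height f) → _
      case (yes 2≤H) = b₀ , 1≤∣b₀∣ , ℕP.≤-trans (∣B₀∣≤ f deg nsq) (ℕP.≤-trans (ℕP.*-monoˡ-≤ (height f ℕ.^ E) (ℕP.≤-trans (n≤2^n κ) (ℕP.^-monoˡ-≤ κ 2≤H)))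
          (ℕP.≤-reflexive (≡.sym (ℕP.^-distribˡ-+-* (height f) κ E)))) , λ ℓ pr ∤B → ∣S∣²≤ ℓ pr (λ _ → ∤B)
      case (no 2≰H) = + 1 , s≤s z≤n , ℕP.≤-trans (ℕP.≤-reflexive (≡.sym (ℕP.^-zeroˡ C₁))) (ℕP.^-monoˡ-≤ C₁ (1≤H f deg nsq)) ,
          λ ℓ pr _ → ∣S∣²≤ ℓ pr (λ large ∣b₀ → ℕP.<⇒≱ (ℕP.≤-<-trans (ℕP.≤-trans ∣b₀∣≤κ κ≤threshold) large) (ℕD.∣⇒≤ {{ℕ.>-nonZero 1≤∣b₀∣}} ∣b₀))
        where
        ∣b₀∣≤κ : ∣ b₀ ∣ ≤ κ
        ∣b₀∣≤κ = ℕP.≤-trans (∣B₀∣≤ f deg nsq) (ℕP.≤-trans (ℕP.*-monoʳ-≤ κ (ℕP.^-monoˡ-≤ E (ℕP.≤-pred (ℕP.≰⇒> 2≰H)))) (ℕP.≤-reflexive (≡.trans (≡.cong (κ ℕ.*_) (ℕP.^-zeroˡ E)) (ℕP.*-identityʳ κ))))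

open import Data.Nat using (_*_; _^_; _∸_)
open import Data.Nat.Divisibility using (_∣_)

-- The constants precede f because they may depend on d and m only. The estimate is squared to make
-- the exponent d - 1/2 an integer.
theorem6p3 : (d m : ℕ) → ∃[ C₁ ] ∃[ C₂ ]
    ((f : PolyZ d) → HasDegree f m → ¬ IsConstTimesSquare f →
      ∃[ B ] (1 ≤ ∣ B ∣ × ∣ B ∣ ≤ height f ^ C₁ ×
        ((ℓ : ℕ) → Prime ℓ → ¬ (ℓ ∣ ∣ B ∣) →
          ∣ charSum ℓ f ∣ * ∣ charSum ℓ f ∣ ≤ (C₂ * C₂) * ℓ ^ (2 * d ∸ 1))))
theorem6p3 zero m = 0 , 0 , λ f _ nsq → contradiction (constant-is-square f) nsq
theorem6p3 (suc d) m = Constants.C₁ (suc d) m , Constants.C₂ (suc d) m , Positive-dimension.witness d m
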